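{- For all $u,v,w\in S_n$, the generating function $$P_{u,v,w}(t) \,:=\, \sum_{N=1}^\infty c_{N*u,N*v}^{N*w}\, t^N$$ is a rational function of $t$. Moreover, the function $f_{u,v,w}:\mathbb{N}_{\ge1}\to\mathbb{N}$, $f_{u,v,w}(N):=c_{N*u,N*v}^{N*w}$, is eventually quasi-polynomial.
   Context: $S_n$ is the symmetric group on $[n]=\{1,\dots,n\}$. It embeds in $S_{n+1}$ by letting permutations fix $n+1$, and $S_\infty=\bigcup_n S_n$. For $w_0=(n,n-1,\dots,1)\in S_n$, put $\mathfrak S_{w_0}=x_1^{n-1}x_2^{n-2}\cdots x_{n-1}$. Whenever $w(i)<w(i+1)$, put $\mathfrak S_w=\partial_i\mathfrak S_{ws_i}$, where $s_i$ is the simple transposition $(i,i+1)$ and $\partial_i f=(f-s_if)/(x_i-x_{i+1})$, with $s_i$ acting on polynomials by swapping $x_i$ and $x_{i+1}$. These Schubert polynomials are compatible with the embeddings $S_n\subset S_{n+1}$ and form a $\mathbb Z$-basis of $\mathbb Z[x_1,x_2,\dots]$. The Schubert coefficients $c_{u,v}^w$ ($u,v,w\in S_\infty$) are defined by $\mathfrak S_u\mathfrak S_v=\sum_{w}c_{u,v}^w\mathfrak S_w$. Lehmer code: for $w\in S_n$ and $i\in[n]$, let $c_i(w)=|\{j>i: w(j)<w(i)\}|$ and $\mathrm{code}(w)=(c_1(w),\dots,c_n(w))$. The code determines $w\in S_\infty$ uniquely. For an integer $N\ge1$ and $w\in S_n$, $N*w\in S_{Nn}$ is the unique permutation whose Lehmer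 code is $(Nc_1(w),\dots,Nc_n(w),0,\dots,0)$. A function $f:\mathbb N_{\ge1}\to\mathbb N$ is eventually quasi-polynomial if there exist integers $m,M\ge1$ and polynomials $g_0,\dots,g_{m-1}$ such that $f(N)=g_i(N)$ for all $N\ge M$ with $N\equiv i\pmod m$. -}

module Defs where

open import Data.Nat as ℕ using (ℕ; zero; suc; _∸_; _<_; _≤_; _<?_)
import Data.Nat.Properties as ℕP
open import Data.Nat.DivMod using (_mod_)
open import Data.Integer as ℤ using (ℤ)
open import Data.Rational as ℚ using (ℚ)
open import Data.Fin using (Fin)
open import Data.List as L using (List; []; _∷_; _++_; map; reverse; upTo; length; filter; dropWhile; concatMap; foldr)
open import Data.List.Properties using (≡-dec)
open import Data.List.Membership.Propositional using (_∈_; _∉_)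
open import Data.List.Relation.Unary.All using (All)
open import Data.List.Relation.Unary.Unique.Propositional using (Unique)
open import Data.List.Relation.Binary.Permutation.Propositional using (_↭_)
open import Data.Product using (Σ; ∃; _×_; _,_)
open import Relation.Binary.PropositionalEquality using (_≡_; _≢_)
open import Relation.Nullary using (does)
open import Data.Bool using (true; false)

-- Lists of naturals as 1-based sequences, with default value 0.

at : List ℕ → ℕ → ℕ
at []      _             = 0
at (a ∷ l) zero          = 0
at (a ∷ l) (suc zero)    = a
at (a ∷ l) (suc (suc i)) = at l (suc i)

set : List ℕ → ℕ → ℕ → List ℕ
set l       zero          b = l
set []      (suc zero)    b = b ∷ []
set (a ∷ l) (suc zero)    b = b ∷ l
set []      (suc (suc i)) b = 0 ∷ set [] (suc i) b
set (a ∷ l) (suc (suc i)) b = a ∷ set l (suc i) b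

swapAt : ℕ → List ℕ → List ℕ
swapAt i l = set (set l i (at l (suc i))) (suc i) (at l i)

stripZeros : List ℕ → List ℕ
stripZeros l = reverse (dropWhile (λ x → x ℕ.≟ 0) (reverse l))

range : ℕ → List ℕ
range n = map suc (upTo n)

-- w ∈ S_n, written in one-line notation (w(1), ..., w(n))
IsPerm : ℕ → List ℕ → Set
IsPerm n w = w ↭ range n

w₀ : ℕ → List ℕ
w₀ n = reverse (range n)

lehmer : List ℕ → List ℕ
lehmer []      = []
lehmer (a ∷ l) = length (filter (λ b → b <? a) l) ∷ lehmer l

-- Canonical name of an element of S_∞: its Lehmer code with trailing
-- zeros removed (the code determines w ∈ S_∞ uniquely, and w and its
-- image under S_n ⊂ S_{n+1} get the same key).
Key : Set
Key = List ℕ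

key : List ℕ → Key
key w = stripZeros (lehmer w)

-- key of N * w : the permutation with code (N c_1(w), ..., N c_n(w), 0, ...)
starKey : ℕ → List ℕ → Key
starKey N w = stripZeros (map (N ℕ.*_) (lehmer w))

-- Polynomials in ℤ[x_1, x_2, ...]: finite lists of (exponent vector, coeff).
-- Exponent vectors are lists (a_1, a_2, ...) up to trailing zeros.

Mono : Set
Mono = List ℕ

Poly : Set
Poly = List (Mono × ℤ)

coeff : Poly → Mono → ℤ
coeff []            m = ℤ.0ℤ
coeff ((a , k) ∷ p) m with does (≡-dec ℕ._≟_ (stripZeros a) (stripZeros m))
... | true  = k ℤ.+ coeff p m
... | false = coeff p m

infix 4 _≈ₚ_
_≈ₚ_ : Poly → Poly → Set
p ≈ₚ q = ∀ m → coeff p m ≡ coeff q m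

monoMul : Mono → Mono → Mono
monoMul []      b       = b
monoMul (x ∷ a) []      = x ∷ a
monoMul (x ∷ a) (y ∷ b) = (x ℕ.+ y) ∷ monoMul a b

_+ₚ_ : Poly → Poly → Poly
p +ₚ q = p ++ q

_·ₚ_ : ℤ → Poly → Poly
k ·ₚ p = map (λ { (a , c) → (a , k ℤ.* c) }) p

-ₚ_ : Poly → Poly
-ₚ p = ℤ.-1ℤ ·ₚ p

_-ₚ_ : Poly → Poly → Poly
p -ₚ q = p +ₚ (-ₚ q)

_*ₚ_ : Poly → Poly → Poly
p *ₚ q = concatMap (λ { (a , c) → map (λ { (b , d) → (monoMul a b , c ℤ.* d) }) q }) p

sumₚ : List Poly → Poly
sumₚ = foldr _+ₚ_ []

var : ℕ → Poly
var i = (set [] i 1 , ℤ.1ℤ) ∷ []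

sₚ : ℕ → Poly → Poly
sₚ i p = map (λ { (a , c) → (swapAt i a , c) }) p

xδ : ℕ → Poly
xδ n = (reverse (upTo n) , ℤ.1ℤ) ∷ []

-- Schubert polynomials, characterised by their defining recursion.
-- S 𝔖 says 𝔖 (a function on S_∞, indexed by keys) satisfies
--   𝔖_{w₀} = x^δ for w₀ ∈ S_n (every n), and
--   𝔖_w = ∂_i 𝔖_{w s_i} whenever w(i) < w(i+1), i.e. (since ℤ[x] is a
--   domain) (x_i - x_{i+1}) 𝔖_w = 𝔖_{w s_i} - s_i 𝔖_{w s_i}.
-- These conditions determine 𝔖 uniquely; the Schubert polynomials satisfy them.

IsSchubert : (Key → Poly) → Set
IsSchubert 𝔖 =
  (∀ n → 𝔖 (key (w₀ n)) ≈ₚ xδ n)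
  × (∀ n w i → IsPerm n w → 1 ≤ i → i < n → at w i < at w (suc i) →
       (var i -ₚ var (suc i)) *ₚ 𝔖 (key w)
         ≈ₚ 𝔖 (key (swapAt i w)) -ₚ sₚ i (𝔖 (key (swapAt i w))))

-- Schubert coefficients: c u v w = c_{u,v}^w (arguments are keys), i.e.
-- 𝔖_u 𝔖_v = Σ_w c_{u,v}^w 𝔖_w with finitely many nonzero terms.
-- (Uniquely determined since the 𝔖_w form a ℤ-basis.)
IsSchubertCoeff : (Key → Poly) → (Key → Key → Key → ℤ) → Set
IsSchubertCoeff 𝔖 c =
  ∀ n u v → IsPerm n u → IsPerm n v →
  Σ (List (List ℕ)) λ ws →
      All (λ w → ∃ λ m → IsPerm m w) ws
    × Unique (map key ws)
    × (𝔖 (key u) *ₚ 𝔖 (key v)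
         ≈ₚ sumₚ (map (λ w → c (key u) (key v) (key w) ·ₚ 𝔖 (key w)) ws))
    × (∀ m w → IsPerm m w → key w ∉ map key ws → c (key u) (key v) (key w) ≡ ℤ.0ℤ)

coefQ : List ℚ → ℕ → ℚ
coefQ []      _       = ℚ.0ℚ
coefQ (a ∷ p) zero    = a
coefQ (a ∷ p) (suc i) = coefQ p i

evalQ : List ℚ → ℚ → ℚ
evalQ []      t = ℚ.0ℚ
evalQ (a ∷ p) t = a ℚ.+ t ℚ.* evalQ p t

conv : List ℚ → (ℕ → ℚ) → ℕ → ℚ
conv q a N = go N
  where
  go : ℕ → ℚ
  go zero    = coefQ q 0 ℚ.* a N
  go (suc k) = coefQ q (suc k) ℚ.* a (N ∸ suc k) ℚ.+ go k

-- the power series Σ_{N≥1} f(N) t^N is a rational function of t: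
-- q(t) · Σ f(N) t^N = p(t) for polynomials p, q with q ≠ 0.
IsRationalGF : (ℕ → ℤ) → Set
IsRationalGF f =
  Σ (List ℚ) λ p → Σ (List ℚ) λ q →
    (∃ λ k → coefQ q k ≢ ℚ.0ℚ)
    × (∀ N → conv q a N ≡ coefQ p N)
  where
  a : ℕ → ℚ
  a zero    = ℚ.0ℚ
  a (suc j) = ℚ._/_ (f (suc j)) 1

IsEventuallyQuasiPoly : (ℕ → ℤ) → Set
IsEventuallyQuasiPoly f =
  Σ ℕ λ m′ → Σ ℕ λ M → Σ (Fin (suc m′) → List ℚ) λ g →
    1 ≤ M × (∀ N → M ≤ N → ℚ._/_ (f N) 1 ≡ evalQ (g (N mod suc m′)) (ℚ._/_ (ℤ.+ N) 1))

{-# OPTIONS --safe #-}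
-- Sorting the code of N * w by the moves (a , b) ↦ (b + 1 , a) into a strictly decreasing code writes 𝔖_{N*w}, for
-- large N, as a fixed product of divided differences applied to a monomial x^{Nλ+ρ}. Hence N ↦ 𝔖_{N*u} 𝔖_{N*v} is
-- annihilated, from some point on, by a product of operators 1 - t x^ν, where t is the shift in N.
-- Dually, sorting the code of N * w by the moves (a , b) ↦ (b , a - 1) into an increasing code λ reduces the
-- coefficient of 𝔖_{N*w} to that of a Grassmannian Schubert polynomial. Composites of divided differences followed by
-- evaluation at 0 kill symmetric polynomials of positive degree, so this coefficient is obtained by extracting, for
-- k = n, …, 1, the coefficients of x_k^{λ_k+r} and multiplying them by (-1)^r e_r(x_1, …, x_{k-1}).
-- Extracting the coefficient of x_k^{cN+σ} preserves annihilation by products of 1 - t^m x^ν: Elliott's partial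
-- fractions reduce to the case where the weights of all t^m x^ν have one sign. At the end N ↦ c_{N*u,N*v}^{N*w} is
-- annihilated by a product of 1 - t^m, which makes it a rational and eventually quasi-polynomial sequence.

module Submission where

open import Defs
open import Algebra.Bundles using (CommutativeRing)
import Algebra.Properties.AbelianGroup as AbelianGroupProperties
import Algebra.Properties.Ring as RingProperties
import Algebra.Properties.Semiring.Mult as SemiringMult
import Algebra.Solver.Ring as RingSolver
open import Algebra.Solver.Ring.AlmostCommutativeRing
  using (AlmostCommutativeRing; fromCommutativeRing; _-Raw-AlmostCommutative⟶_; Induced-equivalence)
open import Data.Bool using (true; false; if_then_else_)
open import Data.Empty using (⊥-elim)
import Data.Fin as Fin
import Data.Fin.Properties as FinP
open import Data.Integer as ℤ using (ℤ; +_; -[1+_]; 0ℤ; 1ℤ)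
import Data.Integer.Properties as ℤP
import Data.Integer.Solver as ℤS
open import Data.List using (List; []; _∷_; _++_; map; reverse; upTo; length; filter; dropWhile; replicate; _∷ʳ_; applyUpTo; downFrom)
import Data.List.Membership.DecPropositional as DecMembership
open import Data.List.Membership.Propositional using (_∈_; _∉_)
import Data.List.Properties as LP
open import Data.List.Relation.Binary.Permutation.Propositional as Perm using (_↭_)
import Data.List.Relation.Binary.Permutation.Propositional.Properties as PermP
open import Data.List.Relation.Unary.All as All using (All; []; _∷_)
import Data.List.Relation.Unary.All.Properties as AllP
open import Data.List.Relation.Unary.AllPairs using ([]; _∷_)
open import Data.List.Relation.Unary.Any using (here; there)
open import Data.List.Relation.Unary.Linked using (Linked; []; [-]; _∷_)
open import Data.List.Relation.Unary.Unique.Propositional using (Unique)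
import Data.List.Relation.Unary.Unique.Propositional.Properties as UniqueP
open import Data.Maybe using (Maybe; just; nothing)
open import Data.Nat as ℕ using (ℕ; zero; suc; pred; _+_; _*_; _∸_; _⊔_; _≤_; _<_; z≤n; s≤s; _≤?_; _<?_)
import Data.Nat.DivMod as DivMod
open import Data.Nat.ListAction using (sum)
import Data.Nat.Properties as ℕP
import Data.Nat.Solver as ℕS
open import Data.Product using (Σ; _×_; _,_; proj₁; proj₂)
open import Data.Rational as ℚ using (ℚ)
import Data.Rational.Properties as ℚP
import Data.Rational.Solver as ℚS
import Data.Rational.Unnormalised as ℚᵘ
import Data.Rational.Unnormalised.Properties as ℚᵘP
open import Data.Sum using (_⊎_; inj₁; inj₂; [_,_]′)
open import Data.Unit using (⊤; tt)
open import Function using (_∘_)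
open import Level using (Level)
open import Relation.Binary.Definitions using (tri<; tri≈; tri>)
open import Relation.Binary.PropositionalEquality as ≡ using (_≡_; _≢_; refl; cong; cong₂; subst)
import Relation.Binary.Reasoning.Setoid as SetoidReasoning
open import Relation.Nullary using (¬_; Dec; yes; no; does)
open import Relation.Nullary.Decidable using (dec-true; dec-false)

-- The obstacle: reading off the coefficient of 𝔖_{N*w} by divided differences takes as many of them
-- as N*w has inversions, a number that grows with N, whereas each ∂_i enlarges the list of
-- annihilating factors. Sorting helps because entries N c_i changed by one stay eventually affine:
-- for all large N the same moves apply, and their number depends on w alone. What is left is one
-- block ∂_{k+m-1} ... ∂_k for each entry m of the sorted code. Sortedness makes the functional
-- behind a block vanish on the ideal of symmetric polynomials of positive degree in the variables
-- up to the last one that the block touches, and this gives the block a closed formula. Elementary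
-- symmetric polynomials vanish in degrees above the number of variables, so boundedly many
-- coefficients are extracted although m grows. The period has its origin in the partial fractions:
-- opposite weights must first be made equal in size by taking powers, and so factors 1 - t^m x^ν
-- with m > 1 enter.

private variable
  ℓ₁ ℓ₂ : Level

-- A ring solver with integer coefficients

module IntegerCoefficientSolver (R : CommutativeRing ℓ₁ ℓ₂) where
  open CommutativeRing R renaming (refl to ≈-refl; _+_ to _⊕_; _*_ to _⊛_)
  open SemiringMult semiring using (×-homo-+; ×1-homo-*) renaming (_×_ to _ˣ_)
  open RingProperties ring using (-‿distribˡ-*; -‿distribʳ-*; -0#≈0#; -‿involutive)
  open AbelianGroupProperties +-abelianGroup using (⁻¹-∙-comm)
  open SetoidReasoning setoid

  ⟦_⟧ℤ : ℤ → Carrier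
  ⟦ + n ⟧ℤ      = n ˣ 1#
  ⟦ -[1+ n ] ⟧ℤ = - (suc n ˣ 1#)

  ⟦⟧ℤ-neg : ∀ z → ⟦ ℤ.- z ⟧ℤ ≈ - ⟦ z ⟧ℤ
  ⟦⟧ℤ-neg (+ zero)   = sym -0#≈0#
  ⟦⟧ℤ-neg (+ suc n)  = ≈-refl
  ⟦⟧ℤ-neg -[1+ n ]   = sym (-‿involutive _)

  ⟦⟧ℤ-⊖ : ∀ m n → ⟦ m ℤ.⊖ n ⟧ℤ ≈ m ˣ 1# ⊕ - (n ˣ 1#)
  ⟦⟧ℤ-⊖ m zero = begin
    m ˣ 1#              ≈⟨ +-identityʳ _ ⟨
    m ˣ 1# ⊕ 0#         ≈⟨ +-congˡ -0#≈0# ⟨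
    m ˣ 1# ⊕ - 0#       ∎
  ⟦⟧ℤ-⊖ zero (suc n) = sym (+-identityˡ _)
  ⟦⟧ℤ-⊖ (suc m) (suc n) = begin
    ⟦ suc m ℤ.⊖ suc n ⟧ℤ            ≡⟨ cong ⟦_⟧ℤ (ℤP.[1+m]⊖[1+n]≡m⊖n m n) ⟩
    ⟦ m ℤ.⊖ n ⟧ℤ                    ≈⟨ ⟦⟧ℤ-⊖ m n ⟩
    x ⊕ - y                         ≈⟨ +-identityˡ _ ⟨
    0# ⊕ (x ⊕ - y)                  ≈⟨ +-congʳ (-‿inverseʳ 1#) ⟨
    (1# ⊕ - 1#) ⊕ (x ⊕ - y)         ≈⟨ +-assoc _ _ _ ⟩
    1# ⊕ (- 1# ⊕ (x ⊕ - y))         ≈⟨ +-congˡ (+-assoc _ _ _) ⟨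
    1# ⊕ ((- 1# ⊕ x) ⊕ - y)         ≈⟨ +-congˡ (+-congʳ (+-comm _ _)) ⟩
    1# ⊕ ((x ⊕ - 1#) ⊕ - y)         ≈⟨ +-congˡ (+-assoc _ _ _) ⟩
    1# ⊕ (x ⊕ (- 1# ⊕ - y))         ≈⟨ +-assoc _ _ _ ⟨
    (1# ⊕ x) ⊕ (- 1# ⊕ - y)         ≈⟨ +-congˡ (⁻¹-∙-comm 1# y) ⟩
    (1# ⊕ x) ⊕ - (1# ⊕ y)           ∎
    where x = m ˣ 1#
          y = n ˣ 1#

  ⟦⟧ℤ-+ : ∀ a b → ⟦ a ℤ.+ b ⟧ℤ ≈ ⟦ a ⟧ℤ ⊕ ⟦ b ⟧ℤ
  ⟦⟧ℤ-+ (+ m) (+ n)       = ×-homo-+ 1# m n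
  ⟦⟧ℤ-+ (+ m) -[1+ n ]    = ⟦⟧ℤ-⊖ m (suc n)
  ⟦⟧ℤ-+ -[1+ m ] (+ n)    = trans (⟦⟧ℤ-⊖ n (suc m)) (+-comm _ _)
  ⟦⟧ℤ-+ -[1+ m ] -[1+ n ] = begin
    - (suc (suc (m + n)) ˣ 1#) ≡⟨ cong (λ k → - (k ˣ 1#)) (≡.sym (cong suc (ℕP.+-suc m n))) ⟩
    - ((suc m + suc n) ˣ 1#)            ≈⟨ -‿cong (×-homo-+ 1# (suc m) (suc n)) ⟩
    - ((suc m ˣ 1#) ⊕ (suc n ˣ 1#))     ≈⟨ ⁻¹-∙-comm _ _ ⟨
    - (suc m ˣ 1#) ⊕ - (suc n ˣ 1#)     ∎

  ⟦⟧ℤ-*⁺ : ∀ m n → ⟦ + m ℤ.* + n ⟧ℤ ≈ (m ˣ 1#) ⊛ (n ˣ 1#)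
  ⟦⟧ℤ-*⁺ m n = trans (reflexive (cong ⟦_⟧ℤ (≡.sym (ℤP.pos-* m n)))) (×1-homo-* m n)

  ⟦⟧ℤ-*± : ∀ m b → ⟦ + m ℤ.* b ⟧ℤ ≈ (m ˣ 1#) ⊛ ⟦ b ⟧ℤ
  ⟦⟧ℤ-*± m (+ n)    = ⟦⟧ℤ-*⁺ m n
  ⟦⟧ℤ-*± m -[1+ n ] = begin
    ⟦ + m ℤ.* (ℤ.- (+ suc n)) ⟧ℤ     ≡⟨ cong ⟦_⟧ℤ (≡.sym (ℤP.neg-distribʳ-* (+ m) (+ suc n))) ⟩
    ⟦ ℤ.- (+ m ℤ.* + suc n) ⟧ℤ       ≈⟨ ⟦⟧ℤ-neg (+ m ℤ.* + suc n) ⟩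
    - ⟦ + m ℤ.* + suc n ⟧ℤ           ≈⟨ -‿cong (⟦⟧ℤ-*⁺ m (suc n)) ⟩
    - ((m ˣ 1#) ⊛ (suc n ˣ 1#))      ≈⟨ -‿distribʳ-* _ _ ⟩
    (m ˣ 1#) ⊛ - (suc n ˣ 1#)        ∎

  ⟦⟧ℤ-* : ∀ a b → ⟦ a ℤ.* b ⟧ℤ ≈ ⟦ a ⟧ℤ ⊛ ⟦ b ⟧ℤ
  ⟦⟧ℤ-* (+ m) b    = ⟦⟧ℤ-*± m b
  ⟦⟧ℤ-* -[1+ m ] b = begin
    ⟦ (ℤ.- (+ suc m)) ℤ.* b ⟧ℤ      ≡⟨ cong ⟦_⟧ℤ (≡.sym (ℤP.neg-distribˡ-* (+ suc m) b)) ⟩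
    ⟦ ℤ.- (+ suc m ℤ.* b) ⟧ℤ        ≈⟨ ⟦⟧ℤ-neg (+ suc m ℤ.* b) ⟩
    - ⟦ + suc m ℤ.* b ⟧ℤ            ≈⟨ -‿cong (⟦⟧ℤ-*± (suc m) b) ⟩
    - ((suc m ˣ 1#) ⊛ ⟦ b ⟧ℤ)       ≈⟨ -‿distribˡ-* _ _ ⟩
    - (suc m ˣ 1#) ⊛ ⟦ b ⟧ℤ         ∎

  acr : AlmostCommutativeRing ℓ₁ ℓ₂
  acr = fromCommutativeRing R

  ℤ⟶R : CommutativeRing.rawRing ℤP.+-*-commutativeRing -Raw-AlmostCommutative⟶ acr
  ℤ⟶R = record
    { ⟦_⟧ = ⟦_⟧ℤ ; +-homo = ⟦⟧ℤ-+ ; *-homo = ⟦⟧ℤ-* ; -‿homo = ⟦⟧ℤ-neg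
    ; 0-homo = ≈-refl ; 1-homo = +-identityʳ 1# }

  -- The solver cancels only coefficients that it can compare. Equality in R comes with no decision
  -- procedure, hence the integers.
  _coeff≟_ : ∀ a b → Maybe (Induced-equivalence ℤ⟶R a b)
  a coeff≟ b with a ℤ.≟ b
  ... | yes a≡b = just (reflexive (cong ⟦_⟧ℤ a≡b))
  ... | no  _   = nothing

  open RingSolver (CommutativeRing.rawRing ℤP.+-*-commutativeRing) acr ℤ⟶R _coeff≟_ public
    using (solve; _:=_; _:+_; _:*_; _:-_; :-_; con)

-- Series annihilated by products of 1 - t^m x

-- Instantiated for polynomials with `χ` = `mono`, and for ℤ and ℚ with constant `χ`. Keeping X
-- apart from its image under `χ` lets the exponents of a generator be read off, as its weight
-- requires.
module Series (R : CommutativeRing ℓ₁ ℓ₂) {X : Set} (_∙_ : X → X → X)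
              (χ : X → CommutativeRing.Carrier R)
              (χ-∙ : ∀ x y → CommutativeRing._≈_ R (χ (x ∙ y)) (CommutativeRing._*_ R (χ x) (χ y))) where
  open CommutativeRing R hiding (zero) renaming (refl to ≈-refl; _+_ to _⊕_; _*_ to _⊛_)
  open IntegerCoefficientSolver R
  open SetoidReasoning setoid

  Seq : Set ℓ₁
  Seq = ℕ → Carrier

  infix 4 _≗_
  _≗_ : Seq → Seq → Set ℓ₂
  F ≗ G = ∀ N → F N ≈ G N

  EventuallyZero : Seq → Set ℓ₂
  EventuallyZero F = Σ ℕ λ M → ∀ N → M ≤ N → F N ≈ 0#

  -- Multiplication of Σ F(N) t^N by t^m. The padding by 0 is what makes every 1 - t^(m+1) χ(x)
  -- invertible on sequences.
  sh : ℕ → Seq → Seq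
  sh zero    F N       = F N
  sh (suc m) F zero    = 0#
  sh (suc m) F (suc N) = sh m F N

  -- A generator (m , x) stands for the term t^(m+1) χ(x) of a factor 1 - t^(m+1) χ(x).
  Gen : Set
  Gen = ℕ × X

  act : Gen → Seq → Seq
  act (m , x) F N = χ x ⊛ sh (suc m) F N

  Del : Gen → Seq → Seq
  Del A F N = F N - act A F N

  Dels : List Gen → Seq → Seq
  Dels []       F = F
  Dels (A ∷ As) F = Dels As (Del A F)

  Killed : List Gen → Seq → Set ℓ₂
  Killed As F = EventuallyZero (Dels As F)

  -- Σ F(N) t^N is a polynomial in t divided by a product of factors 1 - t^m χ(x). The factors are
  -- kept as data because partial fractions and extraction operate on them one by one.
  Rat : Seq → Set ℓ₂
  Rat F = Σ (List Gen) λ As → Killed As F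

  sh-cong : ∀ m {F G} → F ≗ G → sh m F ≗ sh m G
  sh-cong zero    e N       = e N
  sh-cong (suc m) e zero    = ≈-refl
  sh-cong (suc m) e (suc N) = sh-cong m e N

  sh-⊕ : ∀ m F G N → sh m (λ n → F n ⊕ G n) N ≈ sh m F N ⊕ sh m G N
  sh-⊕ zero    F G N       = ≈-refl
  sh-⊕ (suc m) F G zero    = sym (+-identityˡ _)
  sh-⊕ (suc m) F G (suc N) = sh-⊕ m F G N

  sh-⊛ : ∀ m x F N → sh m (λ n → x ⊛ F n) N ≈ x ⊛ sh m F N
  sh-⊛ zero    x F N       = ≈-refl
  sh-⊛ (suc m) x F zero    = sym (zeroʳ x)
  sh-⊛ (suc m) x F (suc N) = sh-⊛ m x F N

  sh-sh : ∀ m n F N → sh m (sh n F) N ≡ sh (m + n) F N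
  sh-sh zero    n F N       = refl
  sh-sh (suc m) n F zero    = refl
  sh-sh (suc m) n F (suc N) = sh-sh m n F N

  sh-local : ∀ m {F G} N → (∀ j → j < N → F j ≈ G j) → sh (suc m) F N ≈ sh (suc m) G N
  sh-local m       zero    e = ≈-refl
  sh-local zero    (suc N) e = e N ℕP.≤-refl
  sh-local (suc m) (suc N) e = sh-local m N (λ j j<N → e j (ℕP.m≤n⇒m≤1+n j<N))

  sh-late : ∀ m {F} M N → (∀ j → M ≤ j → F j ≈ 0#) → m + M ≤ N → sh m F N ≈ 0#
  sh-late zero    M N       e le       = e N le
  sh-late (suc m) M zero    e le       = ≈-refl
  sh-late (suc m) M (suc N) e (s≤s le) = sh-late m M N e le

  act-cong : ∀ A {F G} → F ≗ G → act A F ≗ act A G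
  act-cong (m , x) e N = *-congˡ (sh-cong (suc m) e N)

  act-local : ∀ A {F G} N → (∀ j → j < N → F j ≈ G j) → act A F N ≈ act A G N
  act-local (m , x) N e = *-congˡ (sh-local m N e)

  act-⊕ : ∀ A F G N → act A (λ n → F n ⊕ G n) N ≈ act A F N ⊕ act A G N
  act-⊕ (m , x) F G N = trans (*-congˡ (sh-⊕ (suc m) F G N)) (distribˡ _ _ _)

  act-scale : ∀ A y F N → act A (λ n → y ⊛ F n) N ≈ y ⊛ act A F N
  act-scale (m , x) y F N = trans (*-congˡ (sh-⊛ (suc m) y F N))
    (solve 3 (λ x y z → x :* (y :* z) := y :* (x :* z)) ≈-refl (χ x) y (sh (suc m) F N))

  act-neg : ∀ A F N → act A (λ n → - F n) N ≈ - act A F N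
  act-neg A F N = begin
    act A (λ n → - F n) N ≈⟨ act-cong A (λ n → solve 1 (λ z → :- z := con ℤ.-1ℤ :* z) ≈-refl (F n)) N ⟩
    act A (λ n → ⟦ ℤ.-1ℤ ⟧ℤ ⊛ F n) N   ≈⟨ act-scale A ⟦ ℤ.-1ℤ ⟧ℤ F N ⟩
    ⟦ ℤ.-1ℤ ⟧ℤ ⊛ act A F N            ≈⟨ solve 1 (λ z → con ℤ.-1ℤ :* z := :- z) ≈-refl (act A F N) ⟩
    - act A F N                   ∎

  act-sub : ∀ A F G N → act A (λ n → F n - G n) N ≈ act A F N - act A G N
  act-sub A F G N = trans (act-⊕ A F (λ n → - G n) N) (+-congˡ (act-neg A G N))

  act-sh : ∀ A m F N → act A (sh m F) N ≈ sh m (act A F) N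
  act-sh (n , x) m F N = begin
    χ x ⊛ sh (suc n) (sh m F) N  ≡⟨ cong (χ x ⊛_) (sh-sh (suc n) m F N) ⟩
    χ x ⊛ sh (suc n + m) F N     ≡⟨ cong (λ k → χ x ⊛ sh k F N) (ℕP.+-comm (suc n) m) ⟩
    χ x ⊛ sh (m + suc n) F N     ≡⟨ cong (χ x ⊛_) (sh-sh m (suc n) F N) ⟨
    χ x ⊛ sh m (sh (suc n) F) N  ≈⟨ sh-⊛ m (χ x) (sh (suc n) F) N ⟨
    sh m (act (n , x) F) N       ∎

  act-comm : ∀ A B F N → act A (act B F) N ≈ act B (act A F) N
  act-comm A (n , y) F N = begin
    act A (λ k → χ y ⊛ sh (suc n) F k) N   ≈⟨ act-scale A (χ y) (sh (suc n) F) N ⟩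
    χ y ⊛ act A (sh (suc n) F) N           ≈⟨ *-congˡ (act-sh A (suc n) F N) ⟩
    act (n , y) (act A F) N                ∎

  infixl 7 _⋆_
  _⋆_ : Gen → Gen → Gen
  (m , x) ⋆ (n , y) = m + suc n , x ∙ y

  act-⋆ : ∀ A B F N → act (A ⋆ B) F N ≈ act A (act B F) N
  act-⋆ (m , x) (n , y) F N = begin
    χ (x ∙ y) ⊛ sh (suc m + suc n) F N             ≈⟨ *-congʳ (χ-∙ x y) ⟩
    (χ x ⊛ χ y) ⊛ sh (suc m + suc n) F N           ≈⟨ *-assoc _ _ _ ⟩
    χ x ⊛ (χ y ⊛ sh (suc m + suc n) F N) ≡⟨ cong (λ z → χ x ⊛ (χ y ⊛ z)) (sh-sh (suc m) (suc n) F N) ⟨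
    χ x ⊛ (χ y ⊛ sh (suc m) (sh (suc n) F) N) ≈⟨ *-congˡ (sh-⊛ (suc m) (χ y) (sh (suc n) F) N) ⟨
    act (m , x) (act (n , y) F) N                  ∎

  Del-cong : ∀ A {F G} → F ≗ G → Del A F ≗ Del A G
  Del-cong A e N = +-cong (e N) (-‿cong (act-cong A e N))

  Del-⊕ : ∀ A F G N → Del A (λ n → F n ⊕ G n) N ≈ Del A F N ⊕ Del A G N
  Del-⊕ A F G N = trans (+-congˡ (-‿cong (act-⊕ A F G N)))
    (solve 4 (λ a b c d → (a :+ b) :- (c :+ d) := (a :- c) :+ (b :- d)) ≈-refl _ _ _ _)

  Del-scale : ∀ A y F N → Del A (λ n → y ⊛ F n) N ≈ y ⊛ Del A F N
  Del-scale A y F N = trans (+-congˡ (-‿cong (act-scale A y F N)))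
    (solve 3 (λ y a b → y :* a :- y :* b := y :* (a :- b)) ≈-refl _ _ _)

  Del-act : ∀ A B F N → Del A (act B F) N ≈ act B (Del A F) N
  Del-act A B F N = trans (+-congˡ (-‿cong (act-comm A B F N))) (sym (act-sub B F (act A F) N))

  Del-comm : ∀ A B F N → Del A (Del B F) N ≈ Del B (Del A F) N
  Del-comm A B F N = begin
    (F N - act B F N) - act A (Del B F) N ≈⟨ +-congˡ (-‿cong (act-sub A F (act B F) N)) ⟩
    (F N - act B F N) - (act A F N - act A (act B F) N) ≈⟨ +-congˡ (-‿cong (+-congˡ (-‿cong (act-comm A B F N)))) ⟩
    (F N - act B F N) - (act A F N - act B (act A F) N)
      ≈⟨ solve 4 (λ f b a d → (f :- b) :- (a :- d) := (f :- a) :- (b :- d)) ≈-refl _ _ _ _ ⟩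
    (F N - act A F N) - (act B F N - act B (act A F) N) ≈⟨ +-congˡ (-‿cong (act-sub B F (act A F) N)) ⟨
    Del B (Del A F) N                                     ∎

  Dels-cong : ∀ As {F G} → F ≗ G → Dels As F ≗ Dels As G
  Dels-cong []       e = e
  Dels-cong (A ∷ As) e = Dels-cong As (Del-cong A e)

  Dels-⊕ : ∀ As F G N → Dels As (λ n → F n ⊕ G n) N ≈ Dels As F N ⊕ Dels As G N
  Dels-⊕ []       F G N = ≈-refl
  Dels-⊕ (A ∷ As) F G N = trans (Dels-cong As (Del-⊕ A F G) N) (Dels-⊕ As (Del A F) (Del A G) N)

  Dels-scale : ∀ As y F N → Dels As (λ n → y ⊛ F n) N ≈ y ⊛ Dels As F N
  Dels-scale []       y F N = ≈-refl
  Dels-scale (A ∷ As) y F N = trans (Dels-cong As (Del-scale A y F) N) (Dels-scale As y (Del A F) N)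

  Dels-act : ∀ As B F N → Dels As (act B F) N ≈ act B (Dels As F) N
  Dels-act []       B F N = ≈-refl
  Dels-act (A ∷ As) B F N = trans (Dels-cong As (Del-act A B F) N) (Dels-act As B (Del A F) N)

  Dels-Del : ∀ As A F N → Dels As (Del A F) N ≈ Del A (Dels As F) N
  Dels-Del []       A F N = ≈-refl
  Dels-Del (B ∷ As) A F N = trans (Dels-cong As (Del-comm B A F) N) (Dels-Del As A (Del B F) N)

  Dels-++ : ∀ As Bs F → Dels (As ++ Bs) F ≡ Dels Bs (Dels As F)
  Dels-++ []       Bs F = refl
  Dels-++ (A ∷ As) Bs F = Dels-++ As Bs (Del A F)

  ev0-cong : ∀ {F G} → F ≗ G → EventuallyZero F → EventuallyZero G
  ev0-cong e (M , z) = M , λ N le → trans (sym (e N)) (z N le)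

  ev0-⊕ : ∀ {F G} → EventuallyZero F → EventuallyZero G → EventuallyZero (λ n → F n ⊕ G n)
  ev0-⊕ (M , z) (M′ , z′) = M + M′ , λ N le → trans
    (+-cong (z N (ℕP.≤-trans (ℕP.m≤m+n M M′) le)) (z′ N (ℕP.≤-trans (ℕP.m≤n+m M′ M) le)))
    (+-identityˡ 0#)

  ev0-scale : ∀ {F} y → EventuallyZero F → EventuallyZero (λ n → y ⊛ F n)
  ev0-scale y (M , z) = M , λ N le → trans (*-congˡ (z N le)) (zeroʳ y)

  ev0-act : ∀ A {F} → EventuallyZero F → EventuallyZero (act A F)
  ev0-act (m , x) (M , z) = suc m + M , λ N le → trans (*-congˡ (sh-late (suc m) M N z le)) (zeroʳ _)

  ev0-Del : ∀ A {F} → EventuallyZero F → EventuallyZero (Del A F)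
  ev0-Del A z = ev0-cong (λ N → +-congˡ (solve 1 (λ z → con ℤ.-1ℤ :* z := :- z) ≈-refl _))
    (ev0-⊕ z (ev0-scale ⟦ ℤ.-1ℤ ⟧ℤ (ev0-act A z)))

  ev0-Dels : ∀ As {F} → EventuallyZero F → Killed As F
  ev0-Dels []       z = z
  ev0-Dels (A ∷ As) z = ev0-Dels As (ev0-Del A z)

  killed-cong : ∀ As {F G} → F ≗ G → Killed As F → Killed As G
  killed-cong As e = ev0-cong (Dels-cong As e)

  killed-⊕ˡ : ∀ As Bs {F} → Killed As F → Killed (As ++ Bs) F
  killed-⊕ˡ As Bs {F} k rewrite Dels-++ As Bs F = ev0-Dels Bs k

  Dels-Dels : ∀ As Bs F N → Dels As (Dels Bs F) N ≈ Dels Bs (Dels As F) N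
  Dels-Dels []       Bs F N = ≈-refl
  Dels-Dels (A ∷ As) Bs F N = trans (Dels-cong As (λ n → sym (Dels-Del Bs A F n)) N) (Dels-Dels As Bs (Del A F) N)

  killed-⊕ʳ : ∀ As Bs {F} → Killed Bs F → Killed (As ++ Bs) F
  killed-⊕ʳ As Bs {F} k rewrite Dels-++ As Bs F = ev0-cong (Dels-Dels As Bs F) (ev0-Dels As k)

  killed-⊕ : ∀ As Bs {F G} → Killed As F → Killed Bs G → Killed (As ++ Bs) (λ n → F n ⊕ G n)
  killed-⊕ As Bs {F} {G} k k′ = ev0-cong (λ N → sym (Dels-⊕ (As ++ Bs) F G N))
    (ev0-⊕ (killed-⊕ˡ As Bs k) (killed-⊕ʳ As Bs k′))

  killed-scale : ∀ As y {F} → Killed As F → Killed As (λ n → y ⊛ F n)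
  killed-scale As y {F} k = ev0-cong (λ N → sym (Dels-scale As y F N)) (ev0-scale y k)

  killed-act : ∀ As B {F} → Killed As F → Killed As (act B F)
  killed-act As B {F} k = ev0-cong (λ N → sym (Dels-act As B F N)) (ev0-act B k)

  -- F and G differ by an eventually zero sequence, and such a sequence stays eventually zero under
  -- every `Del`.
  killed-ev : ∀ As {F G} M → (∀ N → M ≤ N → F N ≈ G N) → Killed As F → Killed As G
  killed-ev As {F} {G} M e k = ev0-cong
    (λ N → trans (sym (Dels-⊕ As F (λ n → G n - F n) N))
                 (Dels-cong As (λ n → solve 2 (λ f g → f :+ (g :- f) := g) ≈-refl (F n) (G n)) N))
    (ev0-⊕ k (ev0-Dels As (M , λ N le → trans (+-congʳ (sym (e N le))) (-‿inverseʳ _))))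

  rat-cong : ∀ {F G} → F ≗ G → Rat F → Rat G
  rat-cong e (As , k) = As , killed-cong As e k

  rat-ev : ∀ {F G} M → (∀ N → M ≤ N → F N ≈ G N) → Rat F → Rat G
  rat-ev M e (As , k) = As , killed-ev As M e k

  rat-⊕ : ∀ {F G} → Rat F → Rat G → Rat (λ n → F n ⊕ G n)
  rat-⊕ (As , k) (Bs , k′) = As ++ Bs , killed-⊕ As Bs k k′

  rat-scale : ∀ y {F} → Rat F → Rat (λ n → y ⊛ F n)
  rat-scale y (As , k) = As , killed-scale As y k

  rat-0 : Rat (λ _ → 0#)
  rat-0 = [] , 0 , λ _ _ → ≈-refl

  rat-act : ∀ B {F} → Rat F → Rat (act B F)
  rat-act B (As , k) = As , killed-act As B k

  rat-Del⁻ : ∀ B {F} → Rat (Del B F) → Rat F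
  rat-Del⁻ B (As , k) = B ∷ As , k

  -- Strong induction on N, since `act` reads only earlier terms. Identities between quotients can
  -- therefore be checked after clearing the denominator.
  Del-injective : ∀ A {F G} → Del A F ≗ Del A G → F ≗ G
  Del-injective A {F} {G} e N = go (suc N) N ℕP.≤-refl
    where
    go : ∀ M N → N < M → F N ≈ G N
    go (suc M) N (s≤s N≤M) = begin
      F N ≈⟨ solve 2 (λ f a → f := (f :- a) :+ a) ≈-refl (F N) (act A F N) ⟩
      Del A F N ⊕ act A F N ≈⟨ +-cong (e N) (act-local A N (λ j j<N → go M j (ℕP.<-≤-trans j<N N≤M))) ⟩
      Del A G N ⊕ act A G N ≈⟨ solve 2 (λ f a → (f :- a) :+ a := f) ≈-refl (G N) (act A G N) ⟩
      G N                           ∎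

  -- The fuel bounds N; the recursion descends because act delays by at least one step.
  invFuel : Gen → Seq → ℕ → Seq
  invFuel A G zero    N = 0#
  invFuel A G (suc f) N = G N ⊕ act A (invFuel A G f) N

  inv : Gen → Seq → Seq
  inv A G N = invFuel A G (suc N) N

  invFuel-stable : ∀ A G f f′ N → N < f → N < f′ → invFuel A G f N ≈ invFuel A G f′ N
  invFuel-stable A G (suc f) (suc f′) N (s≤s le) (s≤s le′) =
    +-congˡ (act-local A N (λ j j<N → invFuel-stable A G f f′ j (ℕP.<-≤-trans j<N le) (ℕP.<-≤-trans j<N le′)))

  Del-inv : ∀ A G → Del A (inv A G) ≗ G
  Del-inv A G N = begin
    (G N ⊕ act A (invFuel A G N) N) - act A (inv A G) N
      ≈⟨ +-congʳ (+-congˡ (act-local A N (λ j j<N → invFuel-stable A G N (suc j) j j<N ℕP.≤-refl))) ⟩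
    (G N ⊕ act A (inv A G) N) - act A (inv A G) N
      ≈⟨ solve 2 (λ g a → (g :+ a) :- a := g) ≈-refl _ _ ⟩
    G N ∎

  power : Gen → ℕ → Gen
  power A zero    = A
  power A (suc s) = A ⋆ power A s

  -- 1 - A C = (1 - A) + A (1 - C) for C = `power A s`, which is A^(s+1).
  Del-power : ∀ A s {F} → EventuallyZero (Del A F) → EventuallyZero (Del (power A s) F)
  Del-power A zero    z = z
  Del-power A (suc s) {F} z = ev0-cong
    (λ N → begin
      (F N - act A F N) ⊕ act A (Del (power A s) F) N
        ≈⟨ +-congˡ (act-sub A F (act (power A s) F) N) ⟩
      (F N - act A F N) ⊕ (act A F N - act A (act (power A s) F) N)
        ≈⟨ +-congˡ (+-congˡ (-‿cong (act-⋆ A (power A s) F N))) ⟨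
      (F N - act A F N) ⊕ (act A F N - act (A ⋆ power A s) F N)
        ≈⟨ solve 3 (λ f a b → (f :- a) :+ (a :- b) := f :- b) ≈-refl _ _ _ ⟩
      Del (A ⋆ power A s) F N ∎)
    (ev0-⊕ z (ev0-act A (Del-power A s z)))

  killed-power : ∀ A s As {F} → Killed (A ∷ As) F → Killed (power A s ∷ As) F
  killed-power A s As {F} k = ev0-cong (λ N → sym (Dels-Del As (power A s) F N))
    (Del-power A s (ev0-cong (Dels-Del As A F) k))

  killed-perm : ∀ {As Bs} → As ↭ Bs → ∀ {F} → Killed As F → Killed Bs F
  killed-perm Perm.refl k = k
  killed-perm (Perm.prep A p) k = killed-perm p k
  killed-perm (Perm.swap {xs = As} A B p) {F} k = killed-perm p (killed-cong As (Del-comm B A F) k)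
  killed-perm (Perm.trans p q) k = killed-perm q (killed-perm p k)

  -- Elliott's reduction: (1-A)(1-B) + A(1-B) + B(1-A) = 1 - AB.
  module Elliott (A B : Gen) (As : List Gen) {F : Seq} (k : Killed (A ∷ B ∷ As) F) where
    F₁ F₂ F₃ : Seq
    F₁ = inv (A ⋆ B) (Del A (Del B F))
    F₂ = inv (A ⋆ B) (act A (Del B F))
    F₃ = inv (A ⋆ B) (act B (Del A F))

    elliott-sum : F ≗ (λ N → (F₁ N ⊕ F₂ N) ⊕ F₃ N)
    elliott-sum = Del-injective (A ⋆ B) λ N → sym (begin
      Del (A ⋆ B) (λ N → (F₁ N ⊕ F₂ N) ⊕ F₃ N) N
        ≈⟨ trans (Del-⊕ (A ⋆ B) (λ N → F₁ N ⊕ F₂ N) F₃ N) (+-congʳ (Del-⊕ (A ⋆ B) F₁ F₂ N)) ⟩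
      (Del (A ⋆ B) F₁ N ⊕ Del (A ⋆ B) F₂ N) ⊕ Del (A ⋆ B) F₃ N
        ≈⟨ +-cong (+-cong (Del-inv (A ⋆ B) _ N) (Del-inv (A ⋆ B) _ N)) (Del-inv (A ⋆ B) _ N) ⟩
      ((Del B F N - act A (Del B F) N) ⊕ act A (Del B F) N) ⊕ act B (Del A F) N
        ≈⟨ +-congˡ (act-sub B F (act A F) N) ⟩
      (((F N - act B F N) - act A (Del B F) N) ⊕ act A (Del B F) N) ⊕ (act B F N - act B (act A F) N)
        ≈⟨ solve 4 (λ f b x d → (((f :- b) :- x) :+ x) :+ (b :- d) := f :- d) ≈-refl _ _ _ _ ⟩
      F N - act B (act A F) N
        ≈⟨ +-congˡ (-‿cong (trans (act-comm B A F N) (sym (act-⋆ A B F N)))) ⟩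
      Del (A ⋆ B) F N ∎)

    private
      AB = A ⋆ B

    -- After division by 1 - AB, the summand (1 - A)(1 - B) cancels both old factors, A (1 - B)
    -- leaves only 1 - A, and B (1 - A) leaves only 1 - B.
    elliott₁ : Killed (AB ∷ As) F₁
    elliott₁ = killed-cong As (λ N → trans (Del-comm B A F N) (sym (Del-inv AB _ N))) k

    elliott₂ : Killed (AB ∷ A ∷ As) F₂
    elliott₂ = killed-cong As (λ N → trans (trans (act-cong A (Del-comm B A F) N) (sym (Del-act A A (Del B F) N)))
                                           (Del-cong A (λ n → sym (Del-inv AB _ n)) N))
                (killed-act As A k)

    elliott₃ : Killed (AB ∷ B ∷ As) F₃
    elliott₃ = killed-cong As (λ N → trans (sym (Del-act B B (Del A F) N))
                                           (Del-cong B (λ n → sym (Del-inv AB _ n)) N))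
                (killed-act As B k)

  Simple : List X → List Gen
  Simple = map (0 ,_)

  -- All delays are 1 here, which the formula for termwise products relies on. Longer delays appear
  -- only after the products and the divided differences have been taken.
  Rat₁ : Seq → Set ℓ₂
  Rat₁ F = Σ (List X) λ xs → Killed (Simple xs) F

  rat₁⇒rat : ∀ {F} → Rat₁ F → Rat F
  rat₁⇒rat (xs , k) = Simple xs , k

  rat₁-ev : ∀ {F G} M → (∀ N → M ≤ N → F N ≈ G N) → Rat₁ F → Rat₁ G
  rat₁-ev M e (xs , k) = xs , killed-ev (Simple xs) M e k

  rat₁-⊕ : ∀ {F G} → Rat₁ F → Rat₁ G → Rat₁ (λ n → F n ⊕ G n)
  rat₁-⊕ {F} {G} (xs , k) (ys , k′) = xs ++ ys , subst (λ z → Killed z (λ n → F n ⊕ G n))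
    (≡.sym (LP.map-++ (0 ,_) xs ys)) (killed-⊕ (Simple xs) (Simple ys) k k′)

  -- For the termwise product, (1 - ab t)(F·G) = (1 - a t)F · G + (a t F) · (1 - b t)G, so the two lists shrink in turn.
  rat₁-⊛ : ∀ {F G} → Rat₁ F → Rat₁ G → Rat₁ (λ n → F n ⊛ G n)
  rat₁-⊛ (xs , k) (ys , k′) = go xs ys k k′
    where
    go : ∀ xs ys {F G} → Killed (Simple xs) F → Killed (Simple ys) G → Rat₁ (λ n → F n ⊛ G n)
    go []       ys       (M , z) k′ = [] , M , λ N le → trans (*-congʳ (z N le)) (zeroˡ _)
    go (x ∷ xs) []       k (M , z)  = [] , M , λ N le → trans (*-congˡ (z N le)) (zeroʳ _)
    go (x ∷ xs) (y ∷ ys) {F} {G} k k′ =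
      let zs , k″ = rat₁-⊕ (go xs (y ∷ ys) {Del (0 , x) F} {G} k k′)
                           (go (x ∷ xs) ys {act (0 , x) F} {Del (0 , y) G} (killed-act (Simple (x ∷ xs)) (0 , x) {F} k) k′)
      in x ∙ y ∷ zs , killed-cong (Simple zs) (λ N → sym (step N)) k″
      where
      sh1 : ∀ N → sh 1 (λ n → F n ⊛ G n) N ≈ sh 1 F N ⊛ sh 1 G N
      sh1 zero    = sym (zeroˡ _)
      sh1 (suc N) = ≈-refl
      step : ∀ N → Del (0 , x ∙ y) (λ n → F n ⊛ G n) N
                 ≈ Del (0 , x) F N ⊛ G N ⊕ act (0 , x) F N ⊛ Del (0 , y) G N
      step N = begin
        F N ⊛ G N - χ (x ∙ y) ⊛ sh 1 (λ n → F n ⊛ G n) N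
          ≈⟨ +-congˡ (-‿cong (*-cong (χ-∙ x y) (sh1 N))) ⟩
        F N ⊛ G N - (χ x ⊛ χ y) ⊛ (sh 1 F N ⊛ sh 1 G N)
          ≈⟨ solve 6 (λ f g a b p q → f :* g :- (a :* b) :* (p :* q)
                := (f :- a :* p) :* g :+ (a :* p) :* (g :- b :* q)) ≈-refl
                (F N) (G N) (χ x) (χ y) (sh 1 F N) (sh 1 G N) ⟩
        Del (0 , x) F N ⊛ G N ⊕ act (0 , x) F N ⊛ Del (0 , y) G N ∎

-- Exponent vectors and the ring of polynomials

-- Exponent vectors are read through their 0-based entries; two lists with the same entries
-- (that is, equal up to trailing zeros) are identified by _≋_.

ix : Mono → ℕ → ℕ
ix a i = at a (suc i)

put : Mono → ℕ → ℕ → Mono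
put a i v = set a (suc i) v

infix 4 _≋_
record _≋_ (a b : Mono) : Set where
  constructor eqv
  field ix≡ : ∀ i → ix a i ≡ ix b i
open _≋_

≋-refl : ∀ {a} → a ≋ a
≋-refl = eqv λ i → refl

≋-sym : ∀ {a b} → a ≋ b → b ≋ a
≋-sym e = eqv λ i → ≡.sym (ix≡ e i)

≋-trans : ∀ {a b c} → a ≋ b → b ≋ c → a ≋ c
≋-trans e f = eqv λ i → ≡.trans (ix≡ e i) (ix≡ f i)

ix-put-same : ∀ a i v → ix (put a i v) i ≡ v
ix-put-same []      zero    v = refl
ix-put-same (x ∷ a) zero    v = refl
ix-put-same []      (suc i) v = ix-put-same [] i v
ix-put-same (x ∷ a) (suc i) v = ix-put-same a i v

ix-put-other : ∀ a i j v → i ≢ j → ix (put a i v) j ≡ ix a j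
ix-put-other []      zero    zero    v ne = ⊥-elim (ne refl)
ix-put-other []      zero    (suc j) v ne = refl
ix-put-other (x ∷ a) zero    zero    v ne = ⊥-elim (ne refl)
ix-put-other (x ∷ a) zero    (suc j) v ne = refl
ix-put-other []      (suc i) zero    v ne = refl
ix-put-other []      (suc i) (suc j) v ne = ix-put-other [] i j v (ne ∘ cong suc)
ix-put-other (x ∷ a) (suc i) zero    v ne = refl
ix-put-other (x ∷ a) (suc i) (suc j) v ne = ix-put-other a i j v (ne ∘ cong suc)

ix-monoMul : ∀ a b i → ix (monoMul a b) i ≡ ix a i + ix b i
ix-monoMul []      b       i       = refl
ix-monoMul (x ∷ a) []      i       = ≡.sym (ℕP.+-identityʳ _)
ix-monoMul (x ∷ a) (y ∷ b) zero    = refl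
ix-monoMul (x ∷ a) (y ∷ b) (suc i) = ix-monoMul a b i

monoMul-cong : ∀ {a a′ b b′} → a ≋ a′ → b ≋ b′ → monoMul a b ≋ monoMul a′ b′
monoMul-cong {a} {a′} {b} {b′} e f = eqv λ i → ≡.trans (ix-monoMul a b i)
  (≡.trans (cong₂ _+_ (ix≡ e i) (ix≡ f i)) (≡.sym (ix-monoMul a′ b′ i)))

monoMul-comm : ∀ a b → monoMul a b ≋ monoMul b a
monoMul-comm a b = eqv λ i → ≡.trans (ix-monoMul a b i) (≡.trans (ℕP.+-comm (ix a i) (ix b i)) (≡.sym (ix-monoMul b a i)))

monoMul-assoc : ∀ a b c → monoMul (monoMul a b) c ≋ monoMul a (monoMul b c)
monoMul-assoc a b c = eqv λ i → begin
  ix (monoMul (monoMul a b) c) i   ≡⟨ ix-monoMul (monoMul a b) c i ⟩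
  ix (monoMul a b) i + ix c i      ≡⟨ cong (_+ ix c i) (ix-monoMul a b i) ⟩
  (ix a i + ix b i) + ix c i       ≡⟨ ℕP.+-assoc (ix a i) _ _ ⟩
  ix a i + (ix b i + ix c i)       ≡⟨ cong (λ z → ix a i + z) (ix-monoMul b c i) ⟨
  ix a i + ix (monoMul b c) i      ≡⟨ ix-monoMul a (monoMul b c) i ⟨
  ix (monoMul a (monoMul b c)) i   ∎
  where open ≡.≡-Reasoning

private
  -- `trim` and `strip` restate `stripZeros` by structural recursion; its two reversals are opaque
  -- to induction on the list.
  trim : ℕ → Mono → Mono
  trim zero    []      = []
  trim zero    (y ∷ l) = 0 ∷ y ∷ l
  trim (suc x) l       = suc x ∷ l

  strip : Mono → Mono
  strip []      = []
  strip (x ∷ l) = trim x (strip l)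

  dropWhile-∷ʳ : ∀ ys x → reverse (dropWhile (ℕ._≟ 0) (ys ∷ʳ x)) ≡ trim x (reverse (dropWhile (ℕ._≟ 0) ys))
  dropWhile-∷ʳ []           zero    = refl
  dropWhile-∷ʳ []           (suc x) = refl
  dropWhile-∷ʳ (zero ∷ ys)  x       = dropWhile-∷ʳ ys x
  dropWhile-∷ʳ (suc y ∷ ys) x = ≡.trans (LP.reverse-++ (suc y ∷ ys) (x ∷ [])) (≡.sym (trim-nonempty x))
    where
    trim-nonempty : ∀ x → trim x (reverse (suc y ∷ ys)) ≡ x ∷ reverse (suc y ∷ ys)
    trim-nonempty (suc x) = refl
    trim-nonempty zero rewrite LP.unfold-reverse (suc y) ys with reverse ys
    ... | []     = refl
    ... | z ∷ zs = refl

  stripZeros≡strip : ∀ l → stripZeros l ≡ strip l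
  stripZeros≡strip []      = refl
  stripZeros≡strip (x ∷ l) rewrite LP.unfold-reverse x l =
    ≡.trans (dropWhile-∷ʳ (reverse l) x) (cong (trim x) (stripZeros≡strip l))

  ix-trim : ∀ x l i → ix (trim x l) i ≡ ix (x ∷ l) i
  ix-trim zero    []      zero    = refl
  ix-trim zero    []      (suc i) = refl
  ix-trim zero    (y ∷ l) i       = refl
  ix-trim (suc x) l       i       = refl

  ix-strip : ∀ l i → ix (strip l) i ≡ ix l i
  ix-strip []      i       = refl
  ix-strip (x ∷ l) zero    = ix-trim x (strip l) zero
  ix-strip (x ∷ l) (suc i) = ≡.trans (ix-trim x (strip l) (suc i)) (ix-strip l i)

  strip-[] : ∀ l → (∀ i → ix l i ≡ 0) → strip l ≡ []
  strip-[] []      e = refl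
  strip-[] (x ∷ l) e rewrite strip-[] l (e ∘ suc) | e 0 = refl

  strip-≋ : ∀ a b → (∀ i → ix a i ≡ ix b i) → strip a ≡ strip b
  strip-≋ []      b       e = ≡.sym (strip-[] b (λ i → ≡.sym (e i)))
  strip-≋ (x ∷ a) []      e = strip-[] (x ∷ a) e
  strip-≋ (x ∷ a) (y ∷ b) e = cong₂ trim (e 0) (strip-≋ a b (e ∘ suc))

ix-stripZeros : ∀ l → stripZeros l ≋ l
ix-stripZeros l = eqv λ i → ≡.trans (cong (λ z → ix z i) (stripZeros≡strip l)) (ix-strip l i)

stripZeros-≋ : ∀ {a b} → a ≋ b → stripZeros a ≡ stripZeros b
stripZeros-≋ {a} {b} e rewrite stripZeros≡strip a | stripZeros≡strip b = strip-≋ a b (ix≡ e)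

≋-stripZeros : ∀ {a b} → stripZeros a ≡ stripZeros b → a ≋ b
≋-stripZeros {a} {b} e = ≋-trans (≋-sym (ix-stripZeros a)) (subst (_≋ b) (≡.sym e) (ix-stripZeros b))

_≋?_ : ∀ a b → Dec (a ≋ b)
a ≋? b with LP.≡-dec ℕ._≟_ (stripZeros a) (stripZeros b)
... | yes e = yes (≋-stripZeros {a} {b} e)
... | no ne = no (ne ∘ stripZeros-≋)

-- Equality of polynomials is tested by functionals, so that linear operators are handled through their adjoints.

Resp : (Mono → ℤ) → Set
Resp L = ∀ {a b} → a ≋ b → L a ≡ L b

pair : (Mono → ℤ) → Poly → ℤ
pair L []            = 0ℤ
pair L ((a , k) ∷ p) = k ℤ.* L a ℤ.+ pair L p

infix 4 _≃_
record _≃_ (p q : Poly) : Set where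
  constructor mk
  field pair-≡ : ∀ L → Resp L → pair L p ≡ pair L q
open _≃_

module ℤ-Solver = ℤS.+-*-Solver

mono : Mono → Poly
mono a = (a , 1ℤ) ∷ []

pair-mono : ∀ L a → pair L (mono a) ≡ L a
pair-mono L a = ≡.trans (ℤP.+-identityʳ _) (ℤP.*-identityˡ _)

pair-++ : ∀ L p q → pair L (p ++ q) ≡ pair L p ℤ.+ pair L q
pair-++ L []            q = ≡.sym (ℤP.+-identityˡ _)
pair-++ L ((a , k) ∷ p) q = ≡.trans (cong (λ z → k ℤ.* L a ℤ.+ z) (pair-++ L p q)) (≡.sym (ℤP.+-assoc (k ℤ.* L a) _ _))

pair-map : ∀ {g : Mono → Mono} k (f : Mono × ℤ → Mono × ℤ) → (∀ a c → f (a , c) ≡ (g a , k ℤ.* c)) →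
           ∀ L p → pair L (map f p) ≡ k ℤ.* pair (L ∘ g) p
pair-map k f e L []            = ≡.sym (ℤP.*-zeroʳ k)
pair-map {g} k f e L ((a , c) ∷ p) rewrite e a c | pair-map {g} k f e L p =
  solve 4 (λ k c x y → k :* c :* x :+ k :* y := k :* (c :* x :+ y)) refl k c (L (g a)) (pair (L ∘ g) p)
  where open ℤ-Solver

pair-· : ∀ L k p → pair L (k ·ₚ p) ≡ k ℤ.* pair L p
pair-· L k p = pair-map k _ (λ _ _ → refl) L p

pair-neg : ∀ L p → pair L (-ₚ p) ≡ ℤ.- pair L p
pair-neg L p = ≡.trans (pair-· L ℤ.-1ℤ p) (ℤP.-1*i≡-i _)

pair-sub : ∀ L p q → pair L (p -ₚ q) ≡ pair L p ℤ.- pair L q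
pair-sub L p q = ≡.trans (pair-++ L p (-ₚ q)) (cong (λ z → pair L p ℤ.+ z) (pair-neg L q))

pair-cong : ∀ {L L′} → (∀ a → L a ≡ L′ a) → ∀ p → pair L p ≡ pair L′ p
pair-cong e []            = refl
pair-cong e ((a , k) ∷ p) = cong₂ (λ x y → k ℤ.* x ℤ.+ y) (e a) (pair-cong e p)

pair-+ᴸ : ∀ L L′ p → pair (λ a → L a ℤ.+ L′ a) p ≡ pair L p ℤ.+ pair L′ p
pair-+ᴸ L L′ []            = refl
pair-+ᴸ L L′ ((a , k) ∷ p) rewrite pair-+ᴸ L L′ p =
  solve 5 (λ k x y u v → k :* (x :+ y) :+ (u :+ v) := (k :* x :+ u) :+ (k :* y :+ v)) refl
    k (L a) (L′ a) (pair L p) (pair L′ p)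
  where open ℤ-Solver

pair-*ᴸ : ∀ k L p → pair (λ a → k ℤ.* L a) p ≡ k ℤ.* pair L p
pair-*ᴸ k L []            = ≡.sym (ℤP.*-zeroʳ k)
pair-*ᴸ k L ((a , c) ∷ p) rewrite pair-*ᴸ k L p =
  solve 4 (λ k c x y → c :* (k :* x) :+ k :* y := k :* (c :* x :+ y)) refl k c (L a) (pair L p)
  where open ℤ-Solver

pair-0ᴸ : ∀ p → pair (λ _ → 0ℤ) p ≡ 0ℤ
pair-0ᴸ []            = refl
pair-0ᴸ ((a , k) ∷ p) rewrite pair-0ᴸ p | ℤP.*-zeroʳ k = refl

-- Interchange of two finite sums; commutativity of `*ₚ` and `lift-*` rest on it.
pair-swap : ∀ (K : Mono → Mono → ℤ) p q →
            pair (λ a → pair (K a) q) p ≡ pair (λ b → pair (λ a → K a b) p) q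
pair-swap K []            q = ≡.sym (pair-0ᴸ q)
pair-swap K ((a , k) ∷ p) q = ≡.trans
  (cong₂ ℤ._+_ (≡.sym (pair-*ᴸ k (K a) q)) (pair-swap K p q))
  (≡.sym (pair-+ᴸ (λ b → k ℤ.* K a b) (λ b → pair (λ a → K a b) p) q))

pair-* : ∀ L p q → pair L (p *ₚ q) ≡ pair (λ a → pair (λ b → L (monoMul a b)) q) p
pair-* L []            q = refl
pair-* L ((a , k) ∷ p) q = ≡.trans (pair-++ L (map _ q) (p *ₚ q))
  (cong₂ ℤ._+_ (pair-map k _ (λ _ _ → refl) L q) (pair-* L p q))

pair-sₚ : ∀ L i p → pair L (sₚ i p) ≡ pair (L ∘ swapAt i) p
pair-sₚ L i p = ≡.trans (pair-map 1ℤ _ (λ a c → cong (swapAt i a ,_) (≡.sym (ℤP.*-identityˡ c))) L p) (ℤP.*-identityˡ _)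

-- Linear extension from monomials. `∂`, `ext` and `peel` are built from it, so that identities
-- between them reduce to monomials.
lift : (Mono → Poly) → Poly → Poly
lift g []            = []
lift g ((a , k) ∷ p) = (k ·ₚ g a) ++ lift g p

pair-lift : ∀ L g p → pair L (lift g p) ≡ pair (λ a → pair L (g a)) p
pair-lift L g []            = refl
pair-lift L g ((a , k) ∷ p) = ≡.trans (pair-++ L (k ·ₚ g a) (lift g p))
  (cong₂ ℤ._+_ (pair-· L k (g a)) (pair-lift L g p))

module _ where
  open ≡.≡-Reasoning

  ≃-refl : ∀ {p} → p ≃ p
  ≃-refl = mk λ L r → refl

  ≃-sym : ∀ {p q} → p ≃ q → q ≃ p
  ≃-sym (mk e) = mk λ L r → ≡.sym (e L r)

  ≃-trans : ∀ {p q s} → p ≃ q → q ≃ s → p ≃ s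
  ≃-trans (mk e) (mk f) = mk λ L r → ≡.trans (e L r) (f L r)

  lift-cong : ∀ {g} → (∀ {a b} → a ≋ b → g a ≃ g b) → ∀ {p q} → p ≃ q → lift g p ≃ lift g q
  lift-cong {g} rg {p} {q} e = mk λ L r → begin
    pair L (lift g p)             ≡⟨ pair-lift L g p ⟩
    pair (λ a → pair L (g a)) p   ≡⟨ pair-≡ e _ (λ a≋b → pair-≡ (rg a≋b) L r) ⟩
    pair (λ a → pair L (g a)) q   ≡⟨ pair-lift L g q ⟨
    pair L (lift g q)             ∎

  mono-cong : ∀ {a b} → a ≋ b → mono a ≃ mono b
  mono-cong {a} {b} e = mk λ L r → ≡.trans (pair-mono L a) (≡.trans (r e) (≡.sym (pair-mono L b)))

  +ₚ-cong : ∀ {p p′ q q′} → p ≃ p′ → q ≃ q′ → p +ₚ q ≃ p′ +ₚ q′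
  +ₚ-cong {p} {p′} {q} {q′} e f = mk λ L r → begin
    pair L (p ++ q)            ≡⟨ pair-++ L p q ⟩
    pair L p ℤ.+ pair L q      ≡⟨ cong₂ ℤ._+_ (pair-≡ e L r) (pair-≡ f L r) ⟩
    pair L p′ ℤ.+ pair L q′    ≡⟨ pair-++ L p′ q′ ⟨
    pair L (p′ ++ q′)          ∎

  *ₚ-cong : ∀ {p p′ q q′} → p ≃ p′ → q ≃ q′ → p *ₚ q ≃ p′ *ₚ q′
  *ₚ-cong {p} {p′} {q} {q′} e f = mk λ L r → begin
    pair L (p *ₚ q)                                   ≡⟨ pair-* L p q ⟩
    pair (λ a → pair (λ b → L (monoMul a b)) q) p
      ≡⟨ pair-≡ e _ (λ {a} {a′} a≋ → pair-cong (λ b → r (monoMul-cong a≋ (≋-refl {b}))) q) ⟩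
    pair (λ a → pair (λ b → L (monoMul a b)) q) p′
      ≡⟨ pair-cong (λ a → pair-≡ f _ (λ b≋ → r (monoMul-cong (≋-refl {a}) b≋))) p′ ⟩
    pair (λ a → pair (λ b → L (monoMul a b)) q′) p′   ≡⟨ pair-* L p′ q′ ⟨
    pair L (p′ *ₚ q′)                                 ∎

  *ₚ-comm : ∀ p q → p *ₚ q ≃ q *ₚ p
  *ₚ-comm p q = mk λ L r → begin
    pair L (p *ₚ q)                                 ≡⟨ pair-* L p q ⟩
    pair (λ a → pair (λ b → L (monoMul a b)) q) p   ≡⟨ pair-swap (λ a b → L (monoMul a b)) p q ⟩
    pair (λ b → pair (λ a → L (monoMul a b)) p) q
      ≡⟨ pair-cong (λ b → pair-cong (λ a → r (monoMul-comm a b)) p) q ⟩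
    pair (λ b → pair (λ a → L (monoMul b a)) p) q   ≡⟨ pair-* L q p ⟨
    pair L (q *ₚ p)                                 ∎

  *ₚ-assoc : ∀ p q s → (p *ₚ q) *ₚ s ≃ p *ₚ (q *ₚ s)
  *ₚ-assoc p q s = mk λ L r → begin
    pair L ((p *ₚ q) *ₚ s)                                   ≡⟨ pair-* L (p *ₚ q) s ⟩
    pair (λ ab → pair (λ c → L (monoMul ab c)) s) (p *ₚ q)   ≡⟨ pair-* _ p q ⟩
    pair (λ a → pair (λ b → pair (λ c → L (monoMul (monoMul a b) c)) s) q) p
      ≡⟨ pair-cong (λ a → pair-cong (λ b → pair-cong (λ c → r (monoMul-assoc a b c)) s) q) p ⟩
    pair (λ a → pair (λ b → pair (λ c → L (monoMul a (monoMul b c))) s) q) p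
      ≡⟨ pair-cong (λ a → pair-* (λ bc → L (monoMul a bc)) q s) p ⟨
    pair (λ a → pair (λ bc → L (monoMul a bc)) (q *ₚ s)) p   ≡⟨ pair-* L p (q *ₚ s) ⟨
    pair L (p *ₚ (q *ₚ s))                                   ∎

  *ₚ-distribʳ : ∀ s p q → (p +ₚ q) *ₚ s ≃ (p *ₚ s) +ₚ (q *ₚ s)
  *ₚ-distribʳ s p q = mk λ L r → begin
    pair L ((p ++ q) *ₚ s)                    ≡⟨ pair-* L (p ++ q) s ⟩
    pair _ (p ++ q)                           ≡⟨ pair-++ _ p q ⟩
    pair _ p ℤ.+ pair _ q                     ≡⟨ cong₂ ℤ._+_ (pair-* L p s) (pair-* L q s) ⟨
    pair L (p *ₚ s) ℤ.+ pair L (q *ₚ s)       ≡⟨ pair-++ L (p *ₚ s) (q *ₚ s) ⟨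
    pair L ((p *ₚ s) ++ (q *ₚ s))             ∎

  *ₚ-identityˡ : ∀ p → mono [] *ₚ p ≃ p
  *ₚ-identityˡ p = mk λ L r → ≡.trans (pair-* L (mono []) p) (pair-mono (λ a → pair (λ b → L (monoMul a b)) p) [])

  +ₚ-comm : ∀ p q → p +ₚ q ≃ q +ₚ p
  +ₚ-comm p q = mk λ L r → ≡.trans (pair-++ L p q)
    (≡.trans (ℤP.+-comm (pair L p) (pair L q)) (≡.sym (pair-++ L q p)))

  -ₚ-inverseʳ : ∀ p → p +ₚ (-ₚ p) ≃ []
  -ₚ-inverseʳ p = mk λ L r → ≡.trans (pair-sub L p p) (ℤP.i≡j⇒i-j≡0 {pair L p} refl)

  -ₚ-cong : ∀ {p q} → p ≃ q → -ₚ p ≃ -ₚ q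
  -ₚ-cong {p} {q} e = mk λ L r → ≡.trans (pair-neg L p) (≡.trans (cong ℤ.-_ (pair-≡ e L r)) (≡.sym (pair-neg L q)))

≡⇒≃ : ∀ {p q} → p ≡ q → p ≃ q
≡⇒≃ refl = ≃-refl

polyRing : CommutativeRing _ _
polyRing = record
  { Carrier = Poly ; _≈_ = _≃_ ; _+_ = _+ₚ_ ; _*_ = _*ₚ_ ; -_ = -ₚ_ ; 0# = [] ; 1# = mono []
  ; isCommutativeRing = record
    { isRing = record
      { +-isAbelianGroup = record
        { isGroup = record
          { isMonoid = record
            { isSemigroup = record
              { isMagma = record
                { isEquivalence = record { refl = ≃-refl ; sym = ≃-sym ; trans = ≃-trans }
                ; ∙-cong = +ₚ-cong }
              ; assoc = λ p q s → ≡⇒≃ (LP.++-assoc p q s) }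
            ; identity = (λ p → ≃-refl) , (λ p → ≡⇒≃ (LP.++-identityʳ p)) }
          ; inverse = (λ p → ≃-trans (+ₚ-comm (-ₚ p) p) (-ₚ-inverseʳ p)) , -ₚ-inverseʳ
          ; ⁻¹-cong = -ₚ-cong }
        ; comm = +ₚ-comm }
      ; *-cong = *ₚ-cong
      ; *-assoc = *ₚ-assoc
      ; *-identity = *ₚ-identityˡ , (λ p → ≃-trans (*ₚ-comm p (mono [])) (*ₚ-identityˡ p))
      ; distrib = (λ s p q → ≃-trans (*ₚ-comm s (p +ₚ q)) (≃-trans (*ₚ-distribʳ s p q)
                      (+ₚ-cong (*ₚ-comm p s) (*ₚ-comm q s)))) , *ₚ-distribʳ }
    ; *-comm = *ₚ-comm } }

mono-* : ∀ a b → mono (monoMul a b) ≃ mono a *ₚ mono b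
mono-* a b = mk λ L r → ≡.trans (pair-mono L (monoMul a b)) (≡.sym (≡.trans (pair-* L (mono a) (mono b))
  (≡.trans (pair-mono (λ a → pair (λ b → L (monoMul a b)) (mono b)) a) (pair-mono (λ b → L (monoMul a b)) b))))

pair-mono* : ∀ L a p → pair L (mono a *ₚ p) ≡ pair (λ b → L (monoMul a b)) p
pair-mono* L a p = ≡.trans (pair-* L (mono a) p) (pair-mono (λ a → pair (λ b → L (monoMul a b)) p) a)

δ : Mono → Mono → ℤ
δ m a = if does (LP.≡-dec ℕ._≟_ (stripZeros a) (stripZeros m)) then 1ℤ else 0ℤ

δ-resp : ∀ m → Resp (δ m)
δ-resp m e rewrite stripZeros-≋ e = refl

coeff≡pair-δ : ∀ p m → coeff p m ≡ pair (δ m) p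
coeff≡pair-δ []            m = refl
coeff≡pair-δ ((a , k) ∷ p) m with does (LP.≡-dec ℕ._≟_ (stripZeros a) (stripZeros m))
... | true  = cong₂ ℤ._+_ (≡.sym (ℤP.*-identityʳ k)) (coeff≡pair-δ p m)
... | false = ≡.trans (coeff≡pair-δ p m) (≡.trans (≡.sym (ℤP.+-identityˡ _))
                (cong (ℤ._+ pair (δ m) p) (≡.sym (ℤP.*-zeroʳ k))))

private
  remove : Mono → Poly → Poly
  remove a []            = []
  remove a ((b , k) ∷ p) = if does (LP.≡-dec ℕ._≟_ (stripZeros b) (stripZeros a)) then remove a p else (b , k) ∷ remove a p

  remove-length : ∀ a p → length (remove a p) ≤ length p
  remove-length a []            = z≤n
  remove-length a ((b , k) ∷ p) with does (LP.≡-dec ℕ._≟_ (stripZeros b) (stripZeros a))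
  ... | true  = ℕP.m≤n⇒m≤1+n (remove-length a p)
  ... | false = s≤s (remove-length a p)

  pair-remove : ∀ L → Resp L → ∀ a p → pair L p ≡ coeff p a ℤ.* L a ℤ.+ pair L (remove a p)
  pair-remove L r a []            = refl
  pair-remove L r a ((b , k) ∷ p) with LP.≡-dec ℕ._≟_ (stripZeros b) (stripZeros a)
  ... | yes e rewrite r (≋-stripZeros {b} {a} e) | pair-remove L r a p =
    solve 4 (λ k x c y → k :* x :+ (c :* x :+ y) := (k :+ c) :* x :+ y) refl k (L a) (coeff p a) (pair L (remove a p))
    where open ℤ-Solver
  ... | no _ rewrite pair-remove L r a p =
    solve 4 (λ k x c y → k :* x :+ (c :+ y) := c :+ (k :* x :+ y)) refl k (L b) (coeff p a ℤ.* L a) (pair L (remove a p))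
    where open ℤ-Solver

  coeff-remove : ∀ a p m → coeff p m ≡ 0ℤ → coeff (remove a p) m ≡ 0ℤ
  coeff-remove a p m z with LP.≡-dec ℕ._≟_ (stripZeros m) (stripZeros a)
  ... | yes e = gone p
    where
    gone : ∀ p → coeff (remove a p) m ≡ 0ℤ
    gone []            = refl
    gone ((b , k) ∷ p) with LP.≡-dec ℕ._≟_ (stripZeros b) (stripZeros a)
    ... | yes _ = gone p
    ... | no ne with LP.≡-dec ℕ._≟_ (stripZeros b) (stripZeros m)
    ...   | yes e′ = ⊥-elim (ne (≡.trans e′ e))
    ...   | no _  = gone p
  ... | no ne = ≡.trans (kept p) z
    where
    kept : ∀ p → coeff (remove a p) m ≡ coeff p m
    kept []            = refl
    kept ((b , k) ∷ p) with LP.≡-dec ℕ._≟_ (stripZeros b) (stripZeros a)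
    kept ((b , k) ∷ p) | yes e with LP.≡-dec ℕ._≟_ (stripZeros b) (stripZeros m)
    ... | yes e′ = ⊥-elim (ne (≡.trans (≡.sym e′) e))
    ... | no _   = kept p
    kept ((b , k) ∷ p) | no _ with does (LP.≡-dec ℕ._≟_ (stripZeros b) (stripZeros m))
    ... | true  = cong (λ z → k ℤ.+ z) (kept p)
    ... | false = kept p

  -- All terms in the class of the first monomial are removed at once: together they contribute
  -- their total coefficient, which is 0. The remaining list is shorter but not a sublist by
  -- pattern, hence the bound n.
  pair-vanish : ∀ n L → Resp L → ∀ p → length p ≤ n → (∀ m → coeff p m ≡ 0ℤ) → pair L p ≡ 0ℤ
  pair-vanish n       L r []            le z = refl
  pair-vanish (suc n) L r ((a , k) ∷ p) (s≤s le) z =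
    ≡.trans (pair-remove L r a ((a , k) ∷ p))
      (cong₂ (λ x y → x ℤ.* L a ℤ.+ y) (z a) (pair-vanish n L r (remove a ((a , k) ∷ p)) shorter
        (λ m → coeff-remove a ((a , k) ∷ p) m (z m))))
    where
    shorter : length (remove a ((a , k) ∷ p)) ≤ n
    shorter with LP.≡-dec ℕ._≟_ (stripZeros a) (stripZeros a)
    ... | yes _ = ℕP.≤-trans (remove-length a p) le
    ... | no ne = ⊥-elim (ne refl)

-- The hypotheses on 𝔖 and c are coefficientwise; this carries them over to all functionals.
≈ₚ⇒≃ : ∀ {p q} → p ≈ₚ q → p ≃ q
≈ₚ⇒≃ {p} {q} e = mk λ L r → ℤP.i-j≡0⇒i≡j (pair L p) (pair L q) (≡.trans (≡.sym (pair-sub L p q))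
  (pair-vanish (length (p -ₚ q)) L r (p -ₚ q) ℕP.≤-refl
    (λ m → ≡.trans (coeff≡pair-δ (p -ₚ q) m) (≡.trans (pair-sub (δ m) p q)
      (ℤP.i≡j⇒i-j≡0 (≡.trans (≡.sym (coeff≡pair-δ p m)) (≡.trans (e m) (coeff≡pair-δ q m))))))))

-- Divided differences

module P = CommutativeRing polyRing
module PS = IntegerCoefficientSolver polyRing
open PS using () renaming (solve to solveₚ; _:=_ to _:≃_)

x̂ : ℕ → Poly
x̂ i = var (suc i)

e : ℕ → Mono
e i = put [] i 1

y : ℕ → Poly
y i = x̂ i -ₚ x̂ (suc i)

sw : ℕ → Poly → Poly
sw i = sₚ (suc i)

ix-e-same : ∀ i → ix (e i) i ≡ 1
ix-e-same i = ix-put-same [] i 1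

ix-e-other : ∀ i j → i ≢ j → ix (e i) j ≡ 0
ix-e-other i j ne = ix-put-other [] i j 1 ne

*ₚ-left : ∀ q {p p′} → p ≃ p′ → p *ₚ q ≃ p′ *ₚ q
*ₚ-left q {p} {p′} eq = *ₚ-cong {p} {p′} {q} {q} eq ≃-refl

*ₚ-right : ∀ p {q q′} → q ≃ q′ → p *ₚ q ≃ p *ₚ q′
*ₚ-right p {q} {q′} eq = *ₚ-cong {p} {p} {q} {q′} ≃-refl eq

+ₚ-left : ∀ q {p p′} → p ≃ p′ → p +ₚ q ≃ p′ +ₚ q
+ₚ-left q {p} {p′} eq = +ₚ-cong {p} {p′} {q} {q} eq ≃-refl

+ₚ-right : ∀ p {q q′} → q ≃ q′ → p +ₚ q ≃ p +ₚ q′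
+ₚ-right p {q} {q′} eq = +ₚ-cong {p} {p} {q} {q′} ≃-refl eq

-ₚ-cong₂ : ∀ {p p′ q q′} → p ≃ p′ → q ≃ q′ → p -ₚ q ≃ p′ -ₚ q′
-ₚ-cong₂ eq eq′ = +ₚ-cong eq (-ₚ-cong eq′)

-ₚ-right : ∀ p {q q′} → q ≃ q′ → p -ₚ q ≃ p -ₚ q′
-ₚ-right p {q} {q′} eq = +ₚ-right p (-ₚ-cong eq)

-ₚ-left : ∀ q {p p′} → p ≃ p′ → p -ₚ q ≃ p′ -ₚ q
-ₚ-left q = +ₚ-left (-ₚ q)

Off : ℕ → Mono → Mono → Set
Off i a b = ∀ j → i ≢ j → suc i ≢ j → ix a j ≡ ix b j

≋-at₂ : ∀ i a b → ix a i ≡ ix b i → ix a (suc i) ≡ ix b (suc i) → Off i a b → a ≋ b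
≋-at₂ i a b u v off = eqv go
  where
  go : ∀ j → ix a j ≡ ix b j
  go j with i ℕ.≟ j | suc i ℕ.≟ j
  ... | yes refl | _        = u
  ... | no _     | yes refl = v
  ... | no i≢j   | no si≢j  = off j i≢j si≢j

i≢si : ∀ {i} → i ≢ suc i
i≢si ()

repl : ℕ → Mono → ℕ → ℕ → Mono
repl i a u v = put (put a i u) (suc i) v

ix-repl-i : ∀ i a u v → ix (repl i a u v) i ≡ u
ix-repl-i i a u v = ≡.trans (ix-put-other (put a i u) (suc i) i v (λ ())) (ix-put-same a i u)

ix-repl-si : ∀ i a u v → ix (repl i a u v) (suc i) ≡ v
ix-repl-si i a u v = ix-put-same (put a i u) (suc i) v

repl-off : ∀ i a u v → Off i (repl i a u v) a
repl-off i a u v j i≢j si≢j = ≡.trans (ix-put-other (put a i u) (suc i) j v si≢j) (ix-put-other a i j u i≢j)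

repl-≋ : ∀ i a b {u v} → u ≡ ix b i → v ≡ ix b (suc i) → Off i a b → repl i a u v ≋ b
repl-≋ i a b {u} {v} eu ev off = ≋-at₂ i (repl i a u v) b (≡.trans (ix-repl-i i a u v) eu) (≡.trans (ix-repl-si i a u v) ev)
  (λ j ne ne′ → ≡.trans (repl-off i a u v j ne ne′) (off j ne ne′))

repl-cong : ∀ i a b u v → Off i a b → repl i a u v ≋ repl i b u v
repl-cong i a b u v off = repl-≋ i a (repl i b u v) (≡.sym (ix-repl-i i b u v)) (≡.sym (ix-repl-si i b u v))
  (λ j ne ne′ → ≡.trans (off j ne ne′) (≡.sym (repl-off i b u v j ne ne′)))

-- T i a p q is the geometric sum Σ_{j<p} of the monomials with exponents (p-1-j , q+j) at positions
-- (i , i+1), and W i is a left inverse of multiplication by y i.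
T : ℕ → Mono → ℕ → ℕ → Poly
T i a zero    q = []
T i a (suc p) q = mono (repl i a p q) +ₚ T i a p (suc q)

W : ℕ → Mono → Poly
W i a = T i a (ix a i) (ix a (suc i))

T-cong : ∀ i a b → Off i a b → ∀ p q → T i a p q ≃ T i b p q
T-cong i a b off zero    q = ≃-refl
T-cong i a b off (suc p) q = +ₚ-cong (mono-cong (repl-cong i a b p q off)) (T-cong i a b off p (suc q))

W-≡ : ∀ i a {p q} → ix a i ≡ p → ix a (suc i) ≡ q → W i a ≡ T i a p q
W-≡ i a refl refl = refl

W-cong : ∀ i {a b} → a ≋ b → W i a ≃ W i b
W-cong i {a} {b} a≋b = ≃-trans (T-cong i a b (λ j _ _ → ix≡ a≋b j) (ix a i) (ix a (suc i)))
  (≡⇒≃ (≡.sym (W-≡ i b (≡.sym (ix≡ a≋b i)) (≡.sym (ix≡ a≋b (suc i))))))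

ix-e* : ∀ i a j → ix (monoMul (e i) a) j ≡ ix (e i) j + ix a j
ix-e* i a j = ix-monoMul (e i) a j

e*-same : ∀ i a → ix (monoMul (e i) a) i ≡ suc (ix a i)
e*-same i a = ≡.trans (ix-e* i a i) (cong (_+ ix a i) (ix-e-same i))

e*-other : ∀ i a j → i ≢ j → ix (monoMul (e i) a) j ≡ ix a j
e*-other i a j ne = ≡.trans (ix-e* i a j) (cong (_+ ix a j) (ix-e-other i j ne))

-- The geometric sum of x_i a begins with a and continues as the sum of x_{i+1} a. Subtracting the
-- two leaves a, so `W i` undoes multiplication by `y i`.
W-e : ∀ i a → W i (monoMul (e i) a) ≃ mono a +ₚ W i (monoMul (e (suc i)) a)
W-e i a = begin
  W i (monoMul (e i) a) ≡⟨ W-≡ i (monoMul (e i) a) (e*-same i a) (e*-other i a (suc i) i≢si) ⟩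
  mono (repl i (monoMul (e i) a) (ix a i) (ix a (suc i))) +ₚ T i (monoMul (e i) a) (ix a i) (suc (ix a (suc i)))
    ≈⟨ +ₚ-cong (mono-cong (repl-≋ i (monoMul (e i) a) a refl refl (λ j ne _ → e*-other i a j ne)))
         (T-cong i (monoMul (e i) a) (monoMul (e (suc i)) a) (λ j ne ne′ → ≡.trans (e*-other i a j ne) (≡.sym (e*-other (suc i) a j ne′))) (ix a i) (suc (ix a (suc i)))) ⟩
  mono a +ₚ T i (monoMul (e (suc i)) a) (ix a i) (suc (ix a (suc i)))
    ≡⟨ cong (mono a +ₚ_) (W-≡ i (monoMul (e (suc i)) a) (e*-other (suc i) a i (λ ())) (e*-same (suc i) a)) ⟨
  mono a +ₚ W i (monoMul (e (suc i)) a) ∎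
  where open SetoidReasoning P.setoid

T-y : ∀ i a p q → y i *ₚ T i a p q ≃ mono (repl i a p q) -ₚ mono (repl i a 0 (p + q))
T-y i a zero    q = ≃-trans (P.zeroʳ (y i)) (≃-sym (P.-‿inverseʳ (mono (repl i a 0 q))))
T-y i a (suc p) q = begin
  y i *ₚ (mono m +ₚ T i a p (suc q))
    ≈⟨ solveₚ 4 (λ x x′ m t → (x PS.:- x′) PS.:* (m PS.:+ t) :≃ (x PS.:* m PS.:- x′ PS.:* m) PS.:+ (x PS.:- x′) PS.:* t) ≃-refl
         (x̂ i) (x̂ (suc i)) (mono m) (T i a p (suc q)) ⟩
  ((x̂ i *ₚ mono m) -ₚ (x̂ (suc i) *ₚ mono m)) +ₚ (y i *ₚ T i a p (suc q))
    ≈⟨ +ₚ-cong (-ₚ-cong₂ (raise i up₁) (raise (suc i) up₂)) (T-y i a p (suc q)) ⟩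
  (A -ₚ B) +ₚ (B -ₚ mono (repl i a 0 (p + suc q)))
    ≈⟨ solveₚ 3 (λ a b c → (a PS.:- b) PS.:+ (b PS.:- c) :≃ a PS.:- c) ≃-refl A B (mono (repl i a 0 (p + suc q))) ⟩
  A -ₚ mono (repl i a 0 (p + suc q)) ≡⟨ cong (λ z → A -ₚ mono (repl i a 0 z)) (ℕP.+-suc p q) ⟩
  A -ₚ mono (repl i a 0 (suc p + q)) ∎
  where
  open SetoidReasoning P.setoid
  m = repl i a p q
  A = mono (repl i a (suc p) q)
  B = mono (repl i a p (suc q))
  raise : ∀ k {b} → monoMul (e k) m ≋ b → x̂ k *ₚ mono m ≃ mono b
  raise k r = ≃-trans (≃-sym (mono-* (e k) m)) (mono-cong r)
  up₁ : monoMul (e i) m ≋ repl i a (suc p) q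
  up₁ = ≋-sym (repl-≋ i a (monoMul (e i) m) (≡.sym (≡.trans (e*-same i m) (cong suc (ix-repl-i i a p q))))
                        (≡.sym (≡.trans (e*-other i m (suc i) i≢si) (ix-repl-si i a p q)))
                        (λ j ne ne′ → ≡.sym (≡.trans (e*-other i m j ne) (repl-off i a p q j ne ne′))))
  up₂ : monoMul (e (suc i)) m ≋ repl i a p (suc q)
  up₂ = ≋-sym (repl-≋ i a (monoMul (e (suc i)) m) (≡.sym (≡.trans (e*-other (suc i) m i (λ ())) (ix-repl-i i a p q)))
                        (≡.sym (≡.trans (e*-same (suc i) m) (cong suc (ix-repl-si i a p q))))
                        (λ j ne ne′ → ≡.sym (≡.trans (e*-other (suc i) m j ne′) (repl-off i a p q j ne ne′))))

lift-ext : ∀ {g h} → (∀ a → g a ≃ h a) → ∀ p → lift g p ≃ lift h p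
lift-ext {g} {h} eq p = mk λ L r → ≡.trans (pair-lift L g p)
  (≡.trans (pair-cong (λ a → pair-≡ (eq a) L r) p) (≡.sym (pair-lift L h p)))

lift-+ : ∀ g p q → lift g (p +ₚ q) ≃ lift g p +ₚ lift g q
lift-+ g p q = mk λ L r → begin
  pair L (lift g (p ++ q))                ≡⟨ pair-lift L g (p ++ q) ⟩
  pair _ (p ++ q)                         ≡⟨ pair-++ _ p q ⟩
  pair _ p ℤ.+ pair _ q                   ≡⟨ cong₂ ℤ._+_ (pair-lift L g p) (pair-lift L g q) ⟨
  pair L (lift g p) ℤ.+ pair L (lift g q) ≡⟨ pair-++ L (lift g p) (lift g q) ⟨
  pair L (lift g p ++ lift g q)           ∎
  where open ≡.≡-Reasoning

lift-· : ∀ g k p → lift g (k ·ₚ p) ≃ k ·ₚ lift g p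
lift-· g k p = mk λ L r → begin
  pair L (lift g (k ·ₚ p))     ≡⟨ pair-lift L g (k ·ₚ p) ⟩
  pair _ (k ·ₚ p)              ≡⟨ pair-· _ k p ⟩
  k ℤ.* pair _ p               ≡⟨ cong (k ℤ.*_) (pair-lift L g p) ⟨
  k ℤ.* pair L (lift g p)      ≡⟨ pair-· L k (lift g p) ⟨
  pair L (k ·ₚ lift g p)       ∎
  where open ≡.≡-Reasoning

lift-diff : ∀ g p q → lift g (p -ₚ q) ≃ lift g p -ₚ lift g q
lift-diff g p q = ≃-trans (lift-+ g p (-ₚ q)) (+ₚ-right (lift g p) (lift-· g ℤ.-1ℤ q))

lift-mono : ∀ g a → lift g (mono a) ≃ g a
lift-mono g a = mk λ L r → ≡.trans (pair-lift L g (mono a)) (pair-mono (λ b → pair L (g b)) a)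

lift-id : ∀ p → lift mono p ≃ p
lift-id p = mk λ L r → ≡.trans (pair-lift L mono p) (pair-cong (pair-mono L) p)

lift-* : ∀ g q p → lift (λ a → q *ₚ g a) p ≃ q *ₚ lift g p
lift-* g q p = mk λ L r → begin
  pair L (lift (λ a → q *ₚ g a) p)                               ≡⟨ pair-lift L (λ a → q *ₚ g a) p ⟩
  pair (λ a → pair L (q *ₚ g a)) p ≡⟨ pair-cong (λ a → pair-* L q (g a)) p ⟩
  pair (λ a → pair (λ b → pair (λ c → L (monoMul b c)) (g a)) q) p
    ≡⟨ pair-swap (λ a b → pair (λ c → L (monoMul b c)) (g a)) p q ⟩
  pair (λ b → pair (λ a → pair (λ c → L (monoMul b c)) (g a)) p) q
    ≡⟨ pair-cong (λ b → pair-lift (λ c → L (monoMul b c)) g p) q ⟨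
  pair (λ b → pair (λ c → L (monoMul b c)) (lift g p)) q         ≡⟨ pair-* L q (lift g p) ⟨
  pair L (q *ₚ lift g p)                                         ∎
  where open ≡.≡-Reasoning

lift-sub : ∀ g h p → lift (λ a → g a -ₚ h a) p ≃ lift g p -ₚ lift h p
lift-sub g h p = mk λ L r → begin
  pair L (lift (λ a → g a -ₚ h a) p)                   ≡⟨ pair-lift L _ p ⟩
  pair (λ a → pair L (g a -ₚ h a)) p ≡⟨ pair-cong (λ a → pair-++ L (g a) (-ₚ h a)) p ⟩
  pair (λ a → pair L (g a) ℤ.+ pair L (-ₚ h a)) p      ≡⟨ pair-+ᴸ _ _ p ⟩
  pair (λ a → pair L (g a)) p ℤ.+ pair (λ a → pair L (-ₚ h a)) p
    ≡⟨ cong₂ ℤ._+_ (≡.sym (pair-lift L g p)) (≡.trans (pair-cong (λ a → pair-· L ℤ.-1ℤ (h a)) p)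
         (≡.trans (pair-*ᴸ ℤ.-1ℤ _ p) (≡.trans (cong (ℤ.-1ℤ ℤ.*_) (≡.sym (pair-lift L h p))) (≡.sym (pair-· L ℤ.-1ℤ (lift h p)))))) ⟩
  pair L (lift g p) ℤ.+ pair L (-ₚ lift h p)           ≡⟨ pair-++ L (lift g p) (-ₚ lift h p) ⟨
  pair L (lift g p -ₚ lift h p)                        ∎
  where open ≡.≡-Reasoning

lift-sₚ : ∀ g i p → lift g (sₚ i p) ≃ lift (g ∘ swapAt i) p
lift-sₚ g i p = mk λ L r → ≡.trans (pair-lift L g (sₚ i p)) (≡.trans (pair-sₚ _ i p) (≡.sym (pair-lift L _ p)))

sw-≋ : ∀ i {a b} → a ≋ b → swapAt (suc i) a ≋ swapAt (suc i) b
sw-≋ i {a} {b} a≋b = repl-≋ i a (swapAt (suc i) b)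
  (≡.trans (ix≡ a≋b (suc i)) (≡.sym (ix-repl-i i b _ _))) (≡.trans (ix≡ a≋b i) (≡.sym (ix-repl-si i b (ix b (suc i)) _)))
  (λ j ne ne′ → ≡.trans (ix≡ a≋b j) (≡.sym (repl-off i b _ _ j ne ne′)))

sw-i : ∀ i a → ix (swapAt (suc i) a) i ≡ ix a (suc i)
sw-i i a = ix-repl-i i a _ _

sw-si : ∀ i a → ix (swapAt (suc i) a) (suc i) ≡ ix a i
sw-si i a = ix-repl-si i a (ix a (suc i)) _

sw-off : ∀ i a → Off i (swapAt (suc i) a) a
sw-off i a = repl-off i a _ _

sw-sw : ∀ i a → swapAt (suc i) (swapAt (suc i) a) ≋ a
sw-sw i a = repl-≋ i (swapAt (suc i) a) a (sw-si i a) (sw-i i a) (sw-off i a)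

sw-monoMul : ∀ i a b → swapAt (suc i) (monoMul a b) ≋ monoMul (swapAt (suc i) a) (swapAt (suc i) b)
sw-monoMul i a b = repl-≋ i (monoMul a b) (monoMul (swapAt (suc i) a) (swapAt (suc i) b))
  (≡.trans (ix-monoMul a b (suc i)) (≡.sym (≡.trans (ix-monoMul (swapAt (suc i) a) (swapAt (suc i) b) i) (cong₂ _+_ (sw-i i a) (sw-i i b)))))
  (≡.trans (ix-monoMul a b i) (≡.sym (≡.trans (ix-monoMul (swapAt (suc i) a) (swapAt (suc i) b) (suc i)) (cong₂ _+_ (sw-si i a) (sw-si i b)))))
  (λ j ne ne′ → ≡.trans (ix-monoMul a b j) (≡.sym (≡.trans (ix-monoMul (swapAt (suc i) a) (swapAt (suc i) b) j)
     (cong₂ _+_ (sw-off i a j ne ne′) (sw-off i b j ne ne′)))))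

sw-cong : ∀ i {p q} → p ≃ q → sw i p ≃ sw i q
sw-cong i {p} {q} eq = mk λ L r → ≡.trans (pair-sₚ L (suc i) p)
  (≡.trans (pair-≡ eq _ (λ a≋b → r (sw-≋ i a≋b))) (≡.sym (pair-sₚ L (suc i) q)))

sw-+ : ∀ i p q → sw i (p +ₚ q) ≃ sw i p +ₚ sw i q
sw-+ i p q = ≡⇒≃ (LP.map-++ _ p q)

sw-· : ∀ i k p → sw i (k ·ₚ p) ≃ k ·ₚ sw i p
sw-· i k p = mk λ L r → ≡.trans (pair-sₚ L (suc i) (k ·ₚ p)) (≡.trans (pair-· _ k p)
  (≡.trans (cong (k ℤ.*_) (≡.sym (pair-sₚ L (suc i) p))) (≡.sym (pair-· L k (sw i p)))))

sw-sub : ∀ i p q → sw i (p -ₚ q) ≃ sw i p -ₚ sw i q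
sw-sub i p q = ≃-trans (sw-+ i p (-ₚ q)) (+ₚ-right (sw i p) (sw-· i ℤ.-1ℤ q))

sw-* : ∀ i p q → sw i (p *ₚ q) ≃ sw i p *ₚ sw i q
sw-* i p q = mk λ L r → begin
  pair L (sw i (p *ₚ q))                                          ≡⟨ pair-sₚ L (suc i) (p *ₚ q) ⟩
  pair (L ∘ swapAt (suc i)) (p *ₚ q)                              ≡⟨ pair-* _ p q ⟩
  pair (λ a → pair (λ b → L (swapAt (suc i) (monoMul a b))) q) p
    ≡⟨ pair-cong (λ a → pair-cong (λ b → r (sw-monoMul i a b)) q) p ⟩
  pair (λ a → pair (λ b → L (monoMul (swapAt (suc i) a) (swapAt (suc i) b))) q) p
    ≡⟨ pair-cong (λ a → pair-sₚ (λ b → L (monoMul (swapAt (suc i) a) b)) (suc i) q) p ⟨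
  pair (λ a → pair (λ b → L (monoMul (swapAt (suc i) a) b)) (sw i q)) p
    ≡⟨ pair-sₚ (λ a → pair (λ b → L (monoMul a b)) (sw i q)) (suc i) p ⟨
  pair (λ a → pair (λ b → L (monoMul a b)) (sw i q)) (sw i p)     ≡⟨ pair-* L (sw i p) (sw i q) ⟨
  pair L (sw i p *ₚ sw i q)                                       ∎
  where open ≡.≡-Reasoning

sw-inv : ∀ i p → sw i (sw i p) ≃ p
sw-inv i p = mk λ L r → ≡.trans (pair-sₚ L (suc i) (sw i p)) (≡.trans (pair-sₚ _ (suc i) p)
  (pair-cong (λ a → r (sw-sw i a)) p))

sw-x-i : ∀ i → sw i (x̂ i) ≃ x̂ (suc i)
sw-x-i i = mono-cong (repl-≋ i (e i) (e (suc i))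
  (≡.trans (ix-e-other i (suc i) i≢si) (≡.sym (ix-e-other (suc i) i (λ ()))))
  (≡.trans (ix-e-same i) (≡.sym (ix-e-same (suc i))))
  (λ j ne ne′ → ≡.trans (ix-e-other i j ne) (≡.sym (ix-e-other (suc i) j ne′))))

sw-x-si : ∀ i → sw i (x̂ (suc i)) ≃ x̂ i
sw-x-si i = ≃-trans (sw-cong i (≃-sym (sw-x-i i))) (sw-inv i (x̂ i))

sw-y : ∀ i → sw i (y i) ≃ (-ₚ y i)
sw-y i = ≃-trans (sw-sub i (x̂ i) (x̂ (suc i))) (≃-trans (-ₚ-cong₂ (sw-x-i i) (sw-x-si i))
  (solveₚ 2 (λ a b → b PS.:- a :≃ PS.:- (a PS.:- b)) ≃-refl (x̂ i) (x̂ (suc i))))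

W-y : ∀ i p → lift (W i) (y i *ₚ p) ≃ p
W-y i p = mk λ L r → begin
  pair L (lift (W i) (y i *ₚ p))                        ≡⟨ pair-lift L (W i) (y i *ₚ p) ⟩
  pair (K L) (y i *ₚ p)
    ≡⟨ pair-≡ (solveₚ 3 (λ a b p → (a PS.:- b) PS.:* p :≃ a PS.:* p PS.:- b PS.:* p) ≃-refl (x̂ i) (x̂ (suc i)) p)
         (K L) (λ a≋b → pair-≡ (W-cong i a≋b) L r) ⟩
  pair (K L) ((x̂ i *ₚ p) -ₚ (x̂ (suc i) *ₚ p)) ≡⟨ pair-sub (K L) (x̂ i *ₚ p) (x̂ (suc i) *ₚ p) ⟩
  pair (K L) (x̂ i *ₚ p) ℤ.- pair (K L) (x̂ (suc i) *ₚ p)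
    ≡⟨ cong₂ ℤ._-_ (pair-mono* (K L) (e i) p) (pair-mono* (K L) (e (suc i)) p) ⟩
  pair (λ a → K L (monoMul (e i) a)) p ℤ.- z L
    ≡⟨ cong (ℤ._- z L) (pair-cong (λ a → ≡.trans (pair-≡ (W-e i a) L r) (≡.trans (pair-++ L (mono a) (W i (monoMul (e (suc i)) a)))
         (cong (ℤ._+ K L (monoMul (e (suc i)) a)) (pair-mono L a)))) p) ⟩
  pair (λ a → L a ℤ.+ K L (monoMul (e (suc i)) a)) p ℤ.- z L  ≡⟨ cong (ℤ._- z L) (pair-+ᴸ L _ p) ⟩
  (pair L p ℤ.+ z L) ℤ.- z L ≡⟨ ℤP.+-assoc (pair L p) (z L) (ℤ.- z L) ⟩
  pair L p ℤ.+ (z L ℤ.- z L) ≡⟨ cong (λ w → pair L p ℤ.+ w) (ℤP.+-inverseʳ (z L)) ⟩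
  pair L p ℤ.+ 0ℤ                                             ≡⟨ ℤP.+-identityʳ _ ⟩
  pair L p                                                    ∎
  where
  open ≡.≡-Reasoning
  K : (Mono → ℤ) → Mono → ℤ
  K L a = pair L (W i a)
  z : (Mono → ℤ) → ℤ
  z L = pair (λ a → K L (monoMul (e (suc i)) a)) p

-- The left inverse `W i` replaces an argument that polynomials form a domain. Identities for `∂ i`
-- are proved after multiplication by `y i`.
y-cancel : ∀ i {p q} → y i *ₚ p ≃ y i *ₚ q → p ≃ q
y-cancel i {p} {q} eq = ≃-trans (≃-sym (W-y i p)) (≃-trans (lift-cong (W-cong i) eq) (W-y i q))

private
  -- The substitution x_i ↦ x_{i+1}, that is, the remainder of division by x_i - x_{i+1}. It takes
  -- the same value on p and s_i p, so `W i` divides p - s_i p exactly.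
  merge : ℕ → Mono → Poly
  merge i a = mono (repl i a 0 (ix a i + ix a (suc i)))

  y-W : ∀ i p → y i *ₚ lift (W i) p ≃ p -ₚ lift (merge i) p
  y-W i p = begin
    y i *ₚ lift (W i) p                    ≈⟨ lift-* (W i) (y i) p ⟨
    lift (λ a → y i *ₚ W i a) p
      ≈⟨ lift-ext (λ a → ≃-trans (T-y i a (ix a i) (ix a (suc i)))
           (-ₚ-left (merge i a) (mono-cong (repl-≋ i a a refl refl (λ _ _ _ → refl))))) p ⟩
    lift (λ a → mono a -ₚ merge i a) p     ≈⟨ lift-sub mono (merge i) p ⟩
    lift mono p -ₚ lift (merge i) p        ≈⟨ -ₚ-left (lift (merge i) p) (lift-id p) ⟩
    p -ₚ lift (merge i) p                  ∎
    where open SetoidReasoning P.setoid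

  merge-sw : ∀ i p → lift (merge i) (sw i p) ≃ lift (merge i) p
  merge-sw i p = ≃-trans (lift-sₚ (merge i) (suc i) p) (lift-ext (λ a → mono-cong (repl-≋ i (swapAt (suc i) a) (repl i a 0 (ix a i + ix a (suc i)))
    (≡.sym (ix-repl-i i a 0 (ix a i + ix a (suc i))))
    (≡.trans (cong₂ _+_ (sw-i i a) (sw-si i a)) (≡.trans (ℕP.+-comm (ix a (suc i)) (ix a i)) (≡.sym (ix-repl-si i a 0 (ix a i + ix a (suc i))))))
    (λ j ne ne′ → ≡.trans (sw-off i a j ne ne′) (≡.sym (repl-off i a 0 (ix a i + ix a (suc i)) j ne ne′))))) p)

∂ : ℕ → Poly → Poly
∂ i p = lift (W i) (p -ₚ sw i p)

∂-cong : ∀ i {p q} → p ≃ q → ∂ i p ≃ ∂ i q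
∂-cong i eq = lift-cong (W-cong i) (-ₚ-cong₂ eq (sw-cong i eq))

y-∂ : ∀ i p → y i *ₚ ∂ i p ≃ p -ₚ sw i p
y-∂ i p = begin
  y i *ₚ ∂ i p                                             ≈⟨ y-W i (p -ₚ sw i p) ⟩
  (p -ₚ sw i p) -ₚ lift (merge i) (p -ₚ sw i p)
    ≈⟨ -ₚ-right (p -ₚ sw i p) (≃-trans (lift-diff (merge i) p (sw i p)) (-ₚ-right (lift (merge i) p) (merge-sw i p))) ⟩
  (p -ₚ sw i p) -ₚ (lift (merge i) p -ₚ lift (merge i) p)
    ≈⟨ solveₚ 2 (λ a b → a PS.:- (b PS.:- b) :≃ a) ≃-refl (p -ₚ sw i p) (lift (merge i) p) ⟩
  p -ₚ sw i p ∎
  where open SetoidReasoning P.setoid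

-- Ties `∂ i` to the hypothesis on 𝔖, which states ∂_i after multiplication by x_i - x_{i+1}.
∂-unique : ∀ i g f → y i *ₚ g ≃ f -ₚ sw i f → g ≃ ∂ i f
∂-unique i g f eq = y-cancel i (≃-trans eq (≃-sym (y-∂ i f)))

∂-+ : ∀ i p q → ∂ i (p +ₚ q) ≃ ∂ i p +ₚ ∂ i q
∂-+ i p q = ≃-sym (∂-unique i (∂ i p +ₚ ∂ i q) (p +ₚ q) (begin
  y i *ₚ (∂ i p +ₚ ∂ i q)                       ≈⟨ P.distribˡ (y i) (∂ i p) (∂ i q) ⟩
  (y i *ₚ ∂ i p) +ₚ (y i *ₚ ∂ i q)              ≈⟨ +ₚ-cong (y-∂ i p) (y-∂ i q) ⟩
  (p -ₚ sw i p) +ₚ (q -ₚ sw i q)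
    ≈⟨ solveₚ 4 (λ p p′ q q′ → (p PS.:- p′) PS.:+ (q PS.:- q′) :≃ (p PS.:+ q) PS.:- (p′ PS.:+ q′)) ≃-refl p (sw i p) q (sw i q) ⟩
  (p +ₚ q) -ₚ (sw i p +ₚ sw i q)                ≈⟨ -ₚ-right (p +ₚ q) (≃-sym (sw-+ i p q)) ⟩
  (p +ₚ q) -ₚ sw i (p +ₚ q)                     ∎))
  where open SetoidReasoning P.setoid

∂-· : ∀ i k p → ∂ i (k ·ₚ p) ≃ k ·ₚ ∂ i p
∂-· i k p = ≃-trans (lift-cong (W-cong i) sub-·) (lift-· (W i) k (p -ₚ sw i p))
  where
  open ≡.≡-Reasoning
  sub-· : (k ·ₚ p) -ₚ sw i (k ·ₚ p) ≃ k ·ₚ (p -ₚ sw i p)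
  sub-· = mk λ L r → begin
    pair L ((k ·ₚ p) -ₚ sw i (k ·ₚ p))            ≡⟨ pair-sub L (k ·ₚ p) (sw i (k ·ₚ p)) ⟩
    pair L (k ·ₚ p) ℤ.- pair L (sw i (k ·ₚ p))
      ≡⟨ cong₂ ℤ._-_ (pair-· L k p) (≡.trans (pair-≡ (sw-· i k p) L r) (pair-· L k (sw i p))) ⟩
    k ℤ.* pair L p ℤ.- k ℤ.* pair L (sw i p)
      ≡⟨ ℤ-Solver.solve 3 (λ k a b → k ℤ-Solver.:* a ℤ-Solver.:- k ℤ-Solver.:* b ℤ-Solver.:= k ℤ-Solver.:* (a ℤ-Solver.:- b)) refl
           k (pair L p) (pair L (sw i p)) ⟩
    k ℤ.* (pair L p ℤ.- pair L (sw i p))          ≡⟨ cong (k ℤ.*_) (pair-sub L p (sw i p)) ⟨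
    k ℤ.* pair L (p -ₚ sw i p)                    ≡⟨ pair-· L k (p -ₚ sw i p) ⟨
    pair L (k ·ₚ (p -ₚ sw i p))                   ∎

∂-leibniz : ∀ i f g → ∂ i (f *ₚ g) ≃ (∂ i f *ₚ g) +ₚ (sw i f *ₚ ∂ i g)
∂-leibniz i f g = ≃-sym (∂-unique i ((∂ i f *ₚ g) +ₚ (sw i f *ₚ ∂ i g)) (f *ₚ g) (begin
  y i *ₚ ((∂ i f *ₚ g) +ₚ (sw i f *ₚ ∂ i g))
    ≈⟨ solveₚ 5 (λ y df g f′ dg → y PS.:* (df PS.:* g PS.:+ f′ PS.:* dg) :≃ (y PS.:* df) PS.:* g PS.:+ f′ PS.:* (y PS.:* dg)) ≃-refl
         (y i) (∂ i f) g (sw i f) (∂ i g) ⟩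
  ((y i *ₚ ∂ i f) *ₚ g) +ₚ (sw i f *ₚ (y i *ₚ ∂ i g))
    ≈⟨ +ₚ-cong (*ₚ-left g (y-∂ i f)) (*ₚ-right (sw i f) (y-∂ i g)) ⟩
  ((f -ₚ sw i f) *ₚ g) +ₚ (sw i f *ₚ (g -ₚ sw i g))
    ≈⟨ solveₚ 4 (λ f f′ g g′ → (f PS.:- f′) PS.:* g PS.:+ f′ PS.:* (g PS.:- g′) :≃ f PS.:* g PS.:- f′ PS.:* g′) ≃-refl
         f (sw i f) g (sw i g) ⟩
  (f *ₚ g) -ₚ (sw i f *ₚ sw i g)   ≈⟨ -ₚ-right (f *ₚ g) (≃-sym (sw-* i f g)) ⟩
  (f *ₚ g) -ₚ sw i (f *ₚ g)        ∎))
  where open SetoidReasoning P.setoid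

∂-0 : ∀ i {p} → sw i p ≃ p → ∂ i p ≃ []
∂-0 i {p} inv = ≃-trans (lift-cong (W-cong i) (≃-trans (-ₚ-right p inv) (P.-‿inverseʳ p))) ≃-refl

∂-linear : ∀ i f g → sw i f ≃ f → ∂ i (f *ₚ g) ≃ f *ₚ ∂ i g
∂-linear i f g inv = ≃-trans (∂-leibniz i f g) (≃-trans
  (+ₚ-cong (*ₚ-left g (∂-0 i inv)) (*ₚ-left (∂ i g) inv)) ≃-refl)

sw-∂ : ∀ i p → sw i (∂ i p) ≃ ∂ i p
sw-∂ i p = y-cancel i (begin
  y i *ₚ sw i (∂ i p)
    ≈⟨ solveₚ 2 (λ y d → y PS.:* d :≃ PS.:- ((PS.:- y) PS.:* d)) ≃-refl (y i) (sw i (∂ i p)) ⟩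
  -ₚ ((-ₚ y i) *ₚ sw i (∂ i p))    ≈⟨ -ₚ-cong (*ₚ-left (sw i (∂ i p)) (sw-y i)) ⟨
  -ₚ (sw i (y i) *ₚ sw i (∂ i p))  ≈⟨ -ₚ-cong (sw-* i (y i) (∂ i p)) ⟨
  -ₚ sw i (y i *ₚ ∂ i p)           ≈⟨ -ₚ-cong (sw-cong i (y-∂ i p)) ⟩
  -ₚ sw i (p -ₚ sw i p) ≈⟨ -ₚ-cong (≃-trans (sw-sub i p (sw i p)) (-ₚ-right (sw i p) (sw-inv i p))) ⟩
  -ₚ (sw i p -ₚ p) ≈⟨ solveₚ 2 (λ a b → PS.:- (b PS.:- a) :≃ a PS.:- b) ≃-refl p (sw i p) ⟩
  p -ₚ sw i p                      ≈⟨ y-∂ i p ⟨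
  y i *ₚ ∂ i p                     ∎)
  where open SetoidReasoning P.setoid

∂-∂ : ∀ i p → ∂ i (∂ i p) ≃ []
∂-∂ i p = ∂-0 i (sw-∂ i p)

∂-x : ∀ i → ∂ i (x̂ i) ≃ mono []
∂-x i = ≃-sym (∂-unique i (mono []) (x̂ i) (≃-trans (P.*-identityʳ (y i)) (-ₚ-right (x̂ i) (≃-sym (sw-x-i i)))))

-- Lehmer codes and permutations

count : ℕ → List ℕ → ℕ
count x l = length (filter (_<? x) l)

count-accept : ∀ {x v} l → v < x → count x (v ∷ l) ≡ suc (count x l)
count-accept {x} l v<x = cong length (LP.filter-accept (_<? x) v<x)

count-reject : ∀ {x v} l → ¬ v < x → count x (v ∷ l) ≡ count x l
count-reject {x} l v≮x = cong length (LP.filter-reject (_<? x) v≮x)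

count-map : ∀ f x x′ → (∀ v → f v < x′ → v < x) → (∀ v → v < x → f v < x′) → ∀ l → count x′ (map f l) ≡ count x l
count-map f x x′ to from [] = refl
count-map f x x′ to from (v ∷ l) with v <? x
... | yes v<x = ≡.trans (count-accept (map f l) (from v v<x))
                  (≡.trans (cong suc (count-map f x x′ to from l)) (≡.sym (count-accept l v<x)))
... | no  v≮x = ≡.trans (count-reject (map f l) (v≮x ∘ to v))
                  (≡.trans (count-map f x x′ to from l) (≡.sym (count-reject l v≮x)))

count-↭ : ∀ x {l l′} → l ↭ l′ → count x l ≡ count x l′
count-↭ x p = PermP.↭-length (PermP.filter-↭ (_<? x) p)

count-mono : ∀ {x x′} → x ≤ x′ → ∀ l → count x l ≤ count x′ l
count-mono le [] = z≤n
count-mono {x} {x′} le (v ∷ l) with v <? x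
... | yes v<x rewrite count-accept l v<x | count-accept l (ℕP.<-≤-trans v<x le) = s≤s (count-mono le l)
... | no  v≮x rewrite count-reject l v≮x with v <? x′
...   | yes v<x′ rewrite count-accept l v<x′ = ℕP.m≤n⇒m≤1+n (count-mono le l)
...   | no  v≮x′ rewrite count-reject l v≮x′ = count-mono le l

-- The increasing map that skips the value c + 1.
bump : ℕ → ℕ → ℕ
bump c v with v ≤? c
... | yes _ = v
... | no  _ = suc v

bump-≤ : ∀ {c v} → v ≤ c → bump c v ≡ v
bump-≤ {c} {v} v≤c with v ≤? c
... | yes _ = refl
... | no v≰c = ⊥-elim (v≰c v≤c)

bump-> : ∀ {c v} → c < v → bump c v ≡ suc v
bump-> {c} {v} c<v with v ≤? c
... | yes v≤c = ⊥-elim (ℕP.<⇒≱ c<v v≤c)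
... | no _    = refl

bump-mono-< : ∀ c {u v} → u < v → bump c u < bump c v
bump-mono-< c {u} {v} u<v with u ≤? c | v ≤? c
... | yes _   | yes _   = u<v
... | yes _   | no _    = ℕP.m≤n⇒m≤1+n u<v
... | no u≰c  | yes v≤c = ⊥-elim (u≰c (ℕP.≤-trans (ℕP.<⇒≤ u<v) v≤c))
... | no _    | no _    = s≤s u<v

bump-cancel-< : ∀ c {u v} → bump c u < bump c v → u < v
bump-cancel-< c {u} {v} lt with u <? v
... | yes u<v = u<v
... | no  u≮v with ℕP.m≤n⇒m<n∨m≡n (ℕP.≮⇒≥ u≮v)
...   | inj₁ v<u  = ⊥-elim (ℕP.<-asym lt (bump-mono-< c v<u))
...   | inj₂ refl = ⊥-elim (ℕP.<-irrefl refl lt)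

bump<⇒< : ∀ c v → bump c v < suc c → v < suc c
bump<⇒< c v lt with v ≤? c
... | yes v≤c = s≤s v≤c
... | no  _   = ℕP.<-trans (ℕP.n<1+n v) lt

<⇒bump< : ∀ c v → v < suc c → bump c v < suc c
<⇒bump< c v (s≤s v≤c) rewrite bump-≤ v≤c = s≤s v≤c

bump-avoids : ∀ c v → suc c ≢ bump c v
bump-avoids c v eq with v ≤? c
... | yes v≤c = ℕP.<⇒≢ (s≤s v≤c) (≡.sym eq)
... | no  v≰c = v≰c (ℕP.≤-reflexive (≡.sym (ℕP.suc-injective eq)))

bump-injective : ∀ c {u v} → bump c u ≡ bump c v → u ≡ v
bump-injective c {u} {v} eq with ℕP.<-cmp u v
... | tri< u<v _ _ = ⊥-elim (ℕP.<⇒≢ (bump-mono-< c u<v) eq)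
... | tri≈ _ u≡v _ = u≡v
... | tri> _ _ v<u = ⊥-elim (ℕP.<⇒≢ (bump-mono-< c v<u) (≡.sym eq))

-- A right inverse of `lehmer` on lists that satisfy `Fits`: a head with code c takes the (c+1)-st
-- smallest value, and `bump c` makes room for it.
decode : List ℕ → List ℕ
decode []       = []
decode (c ∷ cs) = suc c ∷ map (bump c) (decode cs)

data Fits : List ℕ → Set where
  []  : Fits []
  _∷_ : ∀ {c cs} → c ≤ length cs → Fits cs → Fits (c ∷ cs)

private
  count-run : ∀ (f : ℕ → ℕ) k c m → (∀ i → f i ≡ k + i) → c ≤ m → count (k + c) (applyUpTo f m) ≡ c
  count-run f k zero m e le = cong length (LP.filter-none (_<? (k + 0)) (AllP.applyUpTo⁺₂ f m
    (λ i lt → ℕP.<⇒≱ lt (subst (k + 0 ≤_) (≡.sym (e i)) (ℕP.+-monoʳ-≤ k z≤n)))))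
  count-run f k (suc c) (suc m) e (s≤s le) = ≡.trans
    (count-accept (applyUpTo (f ∘ suc) m) (subst (_< k + suc c) (≡.sym (≡.trans (e 0) (ℕP.+-identityʳ k))) (ℕP.m<m+n k (s≤s z≤n))))
    (cong suc (≡.trans (cong (λ z → count z (applyUpTo (f ∘ suc) m)) (ℕP.+-suc k c))
      (count-run (f ∘ suc) (suc k) c m (λ i → ≡.trans (e (suc i)) (ℕP.+-suc k i)) le)))

  -- Induction on c: the new head is exchanged with the smallest entry of the run, which `bump`
  -- fixes when c > 0. For c = 0 the whole run moves up by one.
  bump-run : ∀ (f g : ℕ → ℕ) k c m → (∀ i → f i ≡ suc k + i) → (∀ i → g i ≡ suc k + i) → c ≤ m →
             suc (k + c) ∷ map (bump (k + c)) (applyUpTo f m) ↭ applyUpTo g (suc m)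
  bump-run f g k zero m ef eg le = Perm.↭-reflexive (cong₂ _∷_ (≡.sym (eg 0)) (all-bumped m f (g ∘ suc) ef (λ i → eg (suc i)) ))
    where
    all-bumped : ∀ m (f g : ℕ → ℕ) → (∀ i → f i ≡ suc k + i) → (∀ i → g i ≡ suc k + suc i) →
                 map (bump (k + 0)) (applyUpTo f m) ≡ applyUpTo g m
    all-bumped m f g ef eg = ≡.trans (LP.map-applyUpTo f (bump (k + 0)) m) (ext m (λ i → ≡.trans
      (bump-> (subst (k + 0 <_) (≡.sym (ef i)) (s≤s (ℕP.+-monoʳ-≤ k z≤n))))
      (≡.trans (cong suc (ef i)) (≡.sym (≡.trans (eg i) (ℕP.+-suc (suc k) i))))))
      where
      ext : ∀ m {f g : ℕ → ℕ} → (∀ i → f i ≡ g i) → applyUpTo f m ≡ applyUpTo g m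
      ext zero    e = refl
      ext (suc m) e = cong₂ _∷_ (e 0) (ext m (λ i → e (suc i)))
  bump-run f g k (suc c) (suc m) ef eg (s≤s le) = Perm.trans
    (Perm.↭-reflexive (cong (suc (k + suc c) ∷_) (cong (_∷ map (bump (k + suc c)) (applyUpTo (f ∘ suc) m)) head-kept)))
    (Perm.trans (Perm.swap _ _ Perm.refl)
      (Perm.prep (g 0) (subst (λ z → suc z ∷ map (bump z) (applyUpTo (f ∘ suc) m) ↭ applyUpTo (g ∘ suc) (suc m)) (≡.sym (ℕP.+-suc k c))
        (bump-run (f ∘ suc) (g ∘ suc) (suc k) c m (λ i → ≡.trans (ef (suc i)) (ℕP.+-suc (suc k) i))
                                                  (λ i → ≡.trans (eg (suc i)) (ℕP.+-suc (suc k) i)) le))))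
    where
    head-kept : bump (k + suc c) (f 0) ≡ g 0
    head-kept = ≡.trans (bump-≤ (subst (_≤ k + suc c) (≡.sym (≡.trans (ef 0) (ℕP.+-identityʳ (suc k))))
      (subst (suc k ≤_) (≡.sym (ℕP.+-suc k c)) (s≤s (ℕP.m≤m+n k c))))) (≡.trans (ef 0) (≡.sym (eg 0)))

decode-perm : ∀ {cs} → Fits cs → IsPerm (length cs) (decode cs)
decode-perm []                      = Perm.refl
decode-perm {c ∷ cs} (le ∷ fits) = Perm.trans (Perm.prep (suc c) (PermP.map⁺ (bump c) (decode-perm fits)))
  (subst (λ z → suc c ∷ map (bump c) z ↭ range (suc m)) (≡.sym (LP.map-upTo suc m))
    (subst (suc c ∷ map (bump c) (applyUpTo suc m) ↭_) (≡.sym (LP.map-upTo suc (suc m)))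
      (bump-run suc suc 0 c m (λ i → refl) (λ i → refl) le)))
  where m = length cs

lehmer-map-bump : ∀ c l → lehmer (map (bump c) l) ≡ lehmer l
lehmer-map-bump c []      = refl
lehmer-map-bump c (x ∷ l) = cong₂ _∷_
  (count-map (bump c) x (bump c x) (λ v → bump-cancel-< c) (λ v → bump-mono-< c) l) (lehmer-map-bump c l)

lehmer-decode : ∀ {cs} → Fits cs → lehmer (decode cs) ≡ cs
lehmer-decode []                    = refl
lehmer-decode {c ∷ cs} (le ∷ fits) = cong₂ _∷_
  (begin
    count (suc c) (map (bump c) (decode cs)) ≡⟨ count-map (bump c) (suc c) (suc c) (bump<⇒< c) (<⇒bump< c) (decode cs) ⟩
    count (suc c) (decode cs)                 ≡⟨ count-↭ (suc c) (decode-perm fits) ⟩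
    count (suc c) (range (length cs)) ≡⟨ cong (count (suc c)) (LP.map-upTo suc (length cs)) ⟩
    count (1 + c) (applyUpTo suc (length cs)) ≡⟨ count-run suc 1 c (length cs) (λ i → refl) le ⟩
    c                                         ∎)
  (≡.trans (lehmer-map-bump c (decode cs)) (lehmer-decode fits))
  where open ≡.≡-Reasoning

decode-unique : ∀ cs → Unique (decode cs)
decode-unique []       = []
decode-unique (c ∷ cs) = AllP.map⁺ (All.universal (bump-avoids c) (decode cs)) ∷ UniqueP.map⁺ (bump-injective c) (decode-unique cs)

-- If w(i) > w(i+1), then w(i+1) itself and every later value below it count for w(i), so the code
-- drops strictly at i.
at-ordered : ∀ i w → Unique w → suc i < length w → ix (lehmer w) i ≤ ix (lehmer w) (suc i) → ix w i < ix w (suc i)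
at-ordered zero (a ∷ []) _ (s≤s ())
at-ordered zero (a ∷ b ∷ l) ((a≢b ∷ _) ∷ _) lt le with ℕP.<-cmp a b
... | tri< a<b _ _ = a<b
... | tri≈ _ a≡b _ = ⊥-elim (a≢b a≡b)
... | tri> _ _ b<a = ⊥-elim (ℕP.<⇒≱ (subst (count b l <_) (≡.sym (count-accept l b<a)) (s≤s (count-mono (ℕP.<⇒≤ b<a) l))) le)
at-ordered (suc i) (a ∷ w) (_ ∷ uniq) (s≤s lt) le = at-ordered i w uniq lt le

swapAt-↭ : ∀ i w → suc i < length w → swapAt (suc i) w ↭ w
swapAt-↭ zero    (a ∷ [])    (s≤s ())
swapAt-↭ zero    (a ∷ b ∷ l) lt       = Perm.swap b a Perm.refl
swapAt-↭ (suc i) (a ∷ w)     (s≤s lt) = Perm.prep a (swapAt-↭ i w lt)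

lehmer-swapAt : ∀ i w → suc i < length w → ix w i < ix w (suc i) →
                lehmer (swapAt (suc i) w) ≡ repl i (lehmer w) (suc (ix (lehmer w) (suc i))) (ix (lehmer w) i)
lehmer-swapAt zero (a ∷ []) (s≤s ())
lehmer-swapAt zero (a ∷ b ∷ l) lt a<b = cong₂ (λ u v → u ∷ v ∷ lehmer l) (count-accept l a<b) (≡.sym (count-reject l (ℕP.<-asym a<b)))
lehmer-swapAt (suc i) (a ∷ w) (s≤s lt) a<b = cong₂ _∷_ (count-↭ a (swapAt-↭ i w lt)) (lehmer-swapAt i w lt a<b)

pad : ℕ → List ℕ → List ℕ
pad K c = c ++ replicate K 0

pad-≋ : ∀ K c → pad K c ≋ c
pad-≋ K c = eqv (go c)
  where
  zeros : ∀ K i → ix (replicate K 0) i ≡ 0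
  zeros zero    i       = refl
  zeros (suc K) zero    = refl
  zeros (suc K) (suc i) = zeros K i
  go : ∀ c i → ix (pad K c) i ≡ ix c i
  go []      i       = zeros K i
  go (a ∷ c) zero    = refl
  go (a ∷ c) (suc i) = go c i

length-pad : ∀ K c → length (pad K c) ≡ length c + K
length-pad K c = ≡.trans (LP.length-++ c) (cong (λ z → length c + z) (LP.length-replicate K))

pad-fits : ∀ K c → sum c ≤ K → Fits (pad K c)
pad-fits zero    []      le = []
pad-fits (suc K) []      le = z≤n ∷ pad-fits K [] z≤n
pad-fits K       (a ∷ c) le =
  subst (a ≤_) (≡.sym (length-pad K c)) (ℕP.≤-trans (ℕP.≤-trans (ℕP.m≤m+n a (sum c)) le) (ℕP.m≤n+m K (length c)))
  ∷ pad-fits K c (ℕP.≤-trans (ℕP.m≤n+m (sum c) a) le)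

record CodePerm (c : List ℕ) (n : ℕ) : Set where
  field
    w      : List ℕ
    isPerm : IsPerm n w
    unique : Unique w
    codes  : lehmer w ≋ c

-- K is left free above sum c: `S-step` needs room for two positions, and `coefficient` needs two
-- permutations in the same S_n.
codePerm : ∀ c K → sum c ≤ K → CodePerm c (length c + K)
codePerm c K le = record
  { w = decode (pad K c) ; isPerm = subst (λ n → IsPerm n (decode (pad K c))) (length-pad K c) (decode-perm fits)
  ; unique = decode-unique (pad K c) ; codes = subst (_≋ c) (≡.sym (lehmer-decode fits)) (pad-≋ K c) }
  where
  fits = pad-fits K c le

up : ℕ → Mono → Mono
up i c = repl i c (suc (ix c (suc i))) (ix c i)

up-cong : ∀ i {a b} → a ≋ b → up i a ≋ up i b
up-cong i {a} {b} eq = repl-≋ i a (up i b)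
  (≡.trans (cong suc (ix≡ eq (suc i))) (≡.sym (ix-repl-i i b (suc (ix b (suc i))) (ix b i))))
  (≡.trans (ix≡ eq i) (≡.sym (ix-repl-si i b (suc (ix b (suc i))) (ix b i))))
  (λ j ne ne′ → ≡.trans (ix≡ eq j) (≡.sym (repl-off i b (suc (ix b (suc i))) (ix b i) j ne ne′)))

lehmer-length : ∀ w → length (lehmer w) ≡ length w
lehmer-length []      = refl
lehmer-length (x ∷ w) = cong suc (lehmer-length w)

perm-length : ∀ {n w} → IsPerm n w → length w ≡ n
perm-length {n} p = ≡.trans (PermP.↭-length p) (≡.trans (LP.length-map suc (upTo n)) (LP.length-upTo n))

lehmer-w₀ : ∀ n → lehmer (w₀ n) ≡ reverse (upTo n)
lehmer-w₀ n = begin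
  lehmer (reverse (map suc (upTo n)))         ≡⟨ cong lehmer (LP.reverse-map suc (upTo n)) ⟨
  lehmer (map suc (reverse (upTo n)))         ≡⟨ cong (lehmer ∘ map suc) (LP.reverse-upTo n) ⟩
  lehmer (map suc (downFrom n))     ≡⟨ go n ⟩
  downFrom n                        ≡⟨ LP.reverse-upTo n ⟨
  reverse (upTo n)                            ∎
  where
  open ≡.≡-Reasoning
  below : ∀ m n → m ≤ n → All (_< suc n) (map suc (downFrom m))
  below zero    n le = []
  below (suc m) n le = s≤s le ∷ below m n (ℕP.<⇒≤ le)
  go : ∀ n → lehmer (map suc (downFrom n)) ≡ downFrom n
  go zero    = refl
  go (suc n) = cong₂ _∷_ (≡.trans (cong length (LP.filter-all (_<? suc n) (below n n ℕP.≤-refl)))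
    (≡.trans (LP.length-map suc (downFrom n)) (LP.length-downFrom n))) (go n)

module Schubert (𝔖 : Key → Poly) (isSchubert : IsSchubert 𝔖) where

  S : List ℕ → Poly
  S c = 𝔖 (stripZeros c)

  S-cong : ∀ {c d} → c ≋ d → S c ≃ S d
  S-cong eq = ≡⇒≃ (cong 𝔖 (stripZeros-≋ eq))

  S-step : ∀ c i → ix c i ≤ ix c (suc i) → S c ≃ ∂ i (S (up i c))
  S-step c i le = begin
    S c                           ≈⟨ S-cong codes ⟨
    𝔖 (key w)                     ≈⟨ ∂-unique i (𝔖 (key w)) (𝔖 (key (swapAt (suc i) w)))
                                       (≈ₚ⇒≃ (proj₂ isSchubert n w (suc i) isPerm (s≤s z≤n) i<n w-ordered)) ⟩
    ∂ i (𝔖 (key (swapAt (suc i) w))) ≡⟨ cong (λ z → ∂ i (S z)) (lehmer-swapAt i w i<len w-ordered) ⟩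
    ∂ i (S (up i (lehmer w)))     ≈⟨ ∂-cong i (S-cong (up-cong i codes)) ⟩
    ∂ i (S (up i c))              ∎
    where
    open SetoidReasoning P.setoid
    -- The extra 2 + i zeros make positions i and i + 1 exist in w even when they lie beyond the
    -- list c.
    K = sum c + (2 + i)
    n = length c + K
    open CodePerm (codePerm c K (ℕP.m≤m+n (sum c) (2 + i)))
    i<n : suc i < n
    i<n = ℕP.≤-trans (ℕP.m≤n+m (2 + i) (sum c)) (ℕP.m≤n+m K (length c))
    i<len : suc i < length w
    i<len = subst (suc i <_) (≡.sym (perm-length isPerm)) i<n
    w-ordered : ix w i < ix w (suc i)
    w-ordered = at-ordered i w unique i<len (≡.subst₂ _≤_ (≡.sym (ix≡ codes i)) (≡.sym (ix≡ codes (suc i))) le)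

  Good : List ℕ → Set
  Good c = S c ≃ mono c

  good-staircase : ∀ n → Good (reverse (upTo n))
  good-staircase n = ≃-trans (S-cong (subst (reverse (upTo n) ≋_) (≡.sym (lehmer-w₀ n)) ≋-refl)) (≈ₚ⇒≃ (proj₁ isSchubert n))

-- Supports, sorting of codes, eventually affine entries

repl-++ : ∀ pre a b post u v → repl (length pre) (pre ++ a ∷ b ∷ post) u v ≡ pre ++ u ∷ v ∷ post
repl-++ []        a b post u v = refl
repl-++ (x ∷ pre) a b post u v = cong (x ∷_) (repl-++ pre a b post u v)

ix-++₀ : ∀ pre a post → ix (pre ++ a ∷ post) (length pre) ≡ a
ix-++₀ []        a post = refl
ix-++₀ (x ∷ pre) a post = ix-++₀ pre a post

ix-++₁ : ∀ pre a b post → ix (pre ++ a ∷ b ∷ post) (suc (length pre)) ≡ b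
ix-++₁ []        a b post = refl
ix-++₁ (x ∷ pre) a b post = ix-++₁ pre a b post

up-++ : ∀ pre a b post → up (length pre) (pre ++ a ∷ b ∷ post) ≡ pre ++ suc b ∷ a ∷ post
up-++ pre a b post = ≡.trans (repl-++ pre a b post _ _)
  (cong₂ (λ u v → pre ++ suc u ∷ v ∷ post) (ix-++₁ pre a b post) (ix-++₀ pre a (b ∷ post)))

-- `W` of b and of its swap are geometric sums with a + 1 and a terms; everything but the first term
-- of the former cancels.
∂-adjacent : ∀ i b a → ix b i ≡ suc a → ix b (suc i) ≡ a → ∂ i (mono b) ≃ mono (repl i b a a)
∂-adjacent i b a e₀ e₁ = begin
  ∂ i (mono b)                              ≈⟨ lift-diff (W i) (mono b) (mono b′) ⟩
  lift (W i) (mono b) -ₚ lift (W i) (mono b′) ≈⟨ -ₚ-cong₂ (lift-mono (W i) b) (lift-mono (W i) b′) ⟩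
  W i b -ₚ W i b′
    ≡⟨ cong₂ _-ₚ_ (W-≡ i b e₀ e₁) (W-≡ i b′ (≡.trans (sw-i i b) e₁) (≡.trans (sw-si i b) e₀)) ⟩
  (m +ₚ T i b a (suc a)) -ₚ T i b′ a (suc a)
    ≈⟨ -ₚ-right (m +ₚ T i b a (suc a)) (T-cong i b′ b (sw-off i b) a (suc a)) ⟩
  (m +ₚ T i b a (suc a)) -ₚ T i b a (suc a)
    ≈⟨ solveₚ 2 (λ m t → (m PS.:+ t) PS.:- t :≃ m) ≃-refl m (T i b a (suc a)) ⟩
  m ∎
  where
  open SetoidReasoning P.setoid
  b′ = swapAt (suc i) b
  m = mono (repl i b a a)

-- A notion of support that is invariant under ≃: functionals applied to p only see monomials in Z.
Supp : (Mono → Set) → Poly → Set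
Supp Z p = ∀ L L′ → Resp L → Resp L′ → (∀ a → Z a → L a ≡ L′ a) → pair L p ≡ pair L′ p

supp-cong : ∀ {Z p q} → p ≃ q → Supp Z p → Supp Z q
supp-cong eq s L L′ r r′ ag = ≡.trans (≡.sym (pair-≡ eq L r)) (≡.trans (s L L′ r r′ ag) (pair-≡ eq L′ r′))

supp-mono : ∀ {Z : Mono → Set} {a} → Z a → Supp Z (mono a)
supp-mono {a = a} z L L′ r r′ ag = ≡.trans (pair-mono L a) (≡.trans (ag a z) (≡.sym (pair-mono L′ a)))

supp-0 : ∀ {Z} → Supp Z []
supp-0 L L′ r r′ ag = refl

supp-+ : ∀ {Z p q} → Supp Z p → Supp Z q → Supp Z (p +ₚ q)
supp-+ {Z} {p} {q} s t L L′ r r′ ag = ≡.trans (pair-++ L p q)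
  (≡.trans (cong₂ ℤ._+_ (s L L′ r r′ ag) (t L L′ r r′ ag)) (≡.sym (pair-++ L′ p q)))

supp-· : ∀ {Z} k {p} → Supp Z p → Supp Z (k ·ₚ p)
supp-· k {p} s L L′ r r′ ag = ≡.trans (pair-· L k p)
  (≡.trans (cong (k ℤ.*_) (s L L′ r r′ ag)) (≡.sym (pair-· L′ k p)))

supp-sub : ∀ {Z p q} → Supp Z p → Supp Z q → Supp Z (p -ₚ q)
supp-sub {Z} {p} {q} s t = supp-+ {Z} {p} {_} s (supp-· {Z} ℤ.-1ℤ {q} t)

supp-lift : ∀ {Z Z′} g → (∀ {a b} → a ≋ b → g a ≃ g b) → (∀ a → Z a → Supp Z′ (g a)) →
            ∀ {p} → Supp Z p → Supp Z′ (lift g p)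
supp-lift g rg sg {p} s L L′ r r′ ag = ≡.trans (pair-lift L g p)
  (≡.trans (s _ _ (λ eq → pair-≡ (rg eq) L r) (λ eq → pair-≡ (rg eq) L′ r′) (λ a za → sg a za L L′ r r′ ag))
           (≡.sym (pair-lift L′ g p)))

supp-* : ∀ {Z Z′ Z″} → (∀ a b → Z a → Z′ b → Z″ (monoMul a b)) →
         ∀ {p q} → Supp Z p → Supp Z′ q → Supp Z″ (p *ₚ q)
supp-* mul {p} {q} s t L L′ r r′ ag = ≡.trans (pair-* L p q)
  (≡.trans (s _ _ (λ {a} {a′} eq → pair-cong (λ b → r (monoMul-cong eq (≋-refl {b}))) q)
                  (λ {a} {a′} eq → pair-cong (λ b → r′ (monoMul-cong eq (≋-refl {b}))) q)
                  (λ a za → t _ _ (λ eq → r (monoMul-cong (≋-refl {a}) eq)) (λ eq → r′ (monoMul-cong (≋-refl {a}) eq))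
                                  (λ b zb → ag _ (mul a b za zb))))
           (≡.sym (pair-* L′ p q)))

supp-sw : ∀ {Z} i → (∀ a → Z a → Z (swapAt (suc i) a)) → ∀ {p} → Supp Z p → Supp Z (sw i p)
supp-sw i zsw {p} s L L′ r r′ ag = ≡.trans (pair-sₚ L (suc i) p)
  (≡.trans (s _ _ (λ eq → r (sw-≋ i eq)) (λ eq → r′ (sw-≋ i eq)) (λ a za → ag _ (zsw a za)))
           (≡.sym (pair-sₚ L′ (suc i) p)))

supp-∂ : ∀ {Z Z′} i → (∀ a → Z a → Z (swapAt (suc i) a)) →
         (∀ a → Z a → ∀ u v → suc (u + v) ≡ ix a i + ix a (suc i) → Z′ (repl i a u v)) →
         ∀ {p} → Supp Z p → Supp Z′ (∂ i p)
supp-∂ {Z} {Z′} i zsw zrepl {p} s = supp-lift (W i) (W-cong i) (λ a za → geometric a za (ix a i) (ix a (suc i)) refl)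
  {p = p -ₚ sw i p} (supp-sub {Z} {p} {sw i p} s (supp-sw {Z} i zsw {p} s))
  where
  geometric : ∀ a → Z a → ∀ u v → u + v ≡ ix a i + ix a (suc i) → Supp Z′ (T i a u v)
  geometric a za zero    v eq = supp-0 {Z′}
  geometric a za (suc u) v eq = supp-+ {Z′} {mono (repl i a u v)} {T i a u (suc v)}
    (supp-mono {Z′} (zrepl a za u v eq)) (geometric a za u (suc v) (≡.trans (ℕP.+-suc u v) eq))

Vars : ℕ → Mono → Set
Vars k a = ∀ i → k ≤ i → ix a i ≡ 0

VarsDeg : ℕ → ℕ → Mono → Set
VarsDeg k d a = Vars k a × sum a ≡ d

vars-repl : ∀ {k} i a u v → suc i < k → Vars k a → Vars k (repl i a u v)
vars-repl i a u v lt va j le = ≡.trans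
  (repl-off i a u v j (ℕP.<⇒≢ (ℕP.<-≤-trans (ℕP.<-trans (ℕP.n<1+n i) lt) le)) (ℕP.<⇒≢ (ℕP.<-≤-trans lt le))) (va j le)

vars-monoMul : ∀ {k} a b → Vars k a → Vars k b → Vars k (monoMul a b)
vars-monoMul a b va vb i le rewrite ix-monoMul a b i | va i le | vb i le = refl

sum-put : ∀ a i v → sum (put a i v) + ix a i ≡ sum a + v
sum-put []      zero    v = ≡.trans (ℕP.+-identityʳ _) (ℕP.+-identityʳ v)
sum-put []      (suc i) v = sum-put [] i v
sum-put (x ∷ a) zero    v = ≡.trans (ℕP.+-comm (v + sum a) x)
  (≡.trans (cong (λ z → x + z) (ℕP.+-comm v (sum a))) (≡.sym (ℕP.+-assoc x (sum a) v)))
sum-put (x ∷ a) (suc i) v = ≡.trans (ℕP.+-assoc x _ _) (≡.trans (cong (λ z → x + z) (sum-put a i v)) (≡.sym (ℕP.+-assoc x _ _)))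

sum-repl : ∀ i a u v → sum (repl i a u v) + (ix a i + ix a (suc i)) ≡ sum a + (u + v)
sum-repl i a u v = begin
  sum (repl i a u v) + (p + q) ≡⟨ cong (λ z → sum (repl i a u v) + z) (ℕP.+-comm p q) ⟩
  sum (repl i a u v) + (q + p)                 ≡⟨ ℕP.+-assoc (sum (repl i a u v)) q p ⟨
  (sum (repl i a u v) + q) + p ≡⟨ cong (λ z → sum (repl i a u v) + z + p) (ix-put-other a i (suc i) u i≢si) ⟨
  (sum (repl i a u v) + ix (put a i u) (suc i)) + p ≡⟨ cong (_+ p) (sum-put (put a i u) (suc i) v) ⟩
  (sum (put a i u) + v) + p                    ≡⟨ ℕP.+-assoc (sum (put a i u)) v p ⟩
  sum (put a i u) + (v + p)                    ≡⟨ cong (λ z → sum (put a i u) + z) (ℕP.+-comm v p) ⟩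
  sum (put a i u) + (p + v)                    ≡⟨ ℕP.+-assoc (sum (put a i u)) p v ⟨
  (sum (put a i u) + p) + v                    ≡⟨ cong (_+ v) (sum-put a i u) ⟩
  (sum a + u) + v                              ≡⟨ ℕP.+-assoc (sum a) u v ⟩
  sum a + (u + v)                              ∎
  where
  open ≡.≡-Reasoning
  p = ix a i
  q = ix a (suc i)

varsDeg-∂ : ∀ {k d} i → suc i < k → ∀ {p} → Supp (VarsDeg k (suc d)) p → Supp (VarsDeg k d) (∂ i p)
varsDeg-∂ {k} {d} i lt {p} = supp-∂ {VarsDeg k (suc d)} {VarsDeg k d} i
  (λ a (va , da) → vars-repl i a _ _ lt va ,
     ≡.trans (ℕP.+-cancelʳ-≡ (ix a i + ix a (suc i)) (sum (swapAt (suc i) a)) (sum a) (≡.trans (sum-repl i a _ _)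
       (cong (λ z → sum a + z) (ℕP.+-comm (ix a (suc i)) (ix a i))))) da)
  (λ a (va , da) u v eq → vars-repl i a u v lt va ,
     ℕP.suc-injective (≡.trans (ℕP.+-cancelʳ-≡ (u + v) (suc (sum (repl i a u v))) (sum a)
       (≡.trans (≡.sym (ℕP.+-suc (sum (repl i a u v)) (u + v))) (≡.trans (cong (λ z → sum (repl i a u v) + z) eq) (sum-repl i a u v)))) da))
  {p}

vars-∂ : ∀ {k} i → suc i < k → ∀ {p} → Supp (Vars k) p → Supp (Vars k) (∂ i p)
vars-∂ {k} i lt {p} = supp-∂ {Vars k} {Vars k} i (λ a va → vars-repl i a _ _ lt va) (λ a va u v _ → vars-repl i a u v lt va) {p}

linked-tail : ∀ {X : Set} {_~_ : X → X → Set} {x : X} {l} → Linked _~_ (x ∷ l) → Linked _~_ l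
linked-tail [-]     = []
linked-tail (_ ∷ l) = l

-- Insertion sort into strictly decreasing order by the moves (a , b) ↦ (b + 1 , a) for a ≤ b, which is how the
-- Lehmer code changes from w to w s_i at an ascent i.
module UpSort {X : Set} (up : X → X) (_⊑_ _⊏_ : X → X → Set) (cmp : ∀ a b → a ⊑ b ⊎ b ⊏ a)
              (⊑⇒⊏up : ∀ {a b} → a ⊑ b → a ⊏ up b) (up-⊏ : ∀ {a b} → a ⊏ b → up a ⊏ up b) where

  insert : X → List X → List X
  insert c []      = c ∷ []
  insert c (d ∷ D) with cmp c d
  ... | inj₁ _ = up d ∷ insert c D
  ... | inj₂ _ = c ∷ d ∷ D

  sort : List X → List X
  sort []      = []
  sort (c ∷ C) = insert c (sort C)

  Decreasing : List X → Set
  Decreasing = Linked (λ a b → b ⊏ a)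

  up-below : ∀ {d D} → Decreasing (d ∷ D) → ∀ {d′ D′} → D ≡ d′ ∷ D′ → up d′ ⊏ up d
  up-below (d′⊏d ∷ _) refl = up-⊏ d′⊏d

  -- The result of the insertion starts with c or with the raised head of D, so both have to lie
  -- below h.
  insert-below : ∀ h c D → c ⊏ h → (∀ {d D′} → D ≡ d ∷ D′ → up d ⊏ h) → Decreasing D → Decreasing (h ∷ insert c D)
  insert-below h c []      c⊏h d⊏h dec = c⊏h ∷ [-]
  insert-below h c (d ∷ D) c⊏h d⊏h dec with cmp c d
  ... | inj₂ d⊏c = c⊏h ∷ d⊏c ∷ dec
  ... | inj₁ c⊑d = d⊏h refl ∷ insert-below (up d) c D (⊑⇒⊏up c⊑d) (up-below dec) (linked-tail dec)

  insert-decreasing : ∀ c D → Decreasing D → Decreasing (insert c D)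
  insert-decreasing c []      dec = [-]
  insert-decreasing c (d ∷ D) dec with cmp c d
  ... | inj₂ d⊏c = d⊏c ∷ dec
  ... | inj₁ c⊑d = insert-below (up d) c D (⊑⇒⊏up c⊑d) (up-below dec) (linked-tail dec)

  sort-decreasing : ∀ C → Decreasing (sort C)
  sort-decreasing []      = []
  sort-decreasing (c ∷ C) = insert-decreasing c (sort C) (sort-decreasing C)

  -- Every comparison won by the larger entry is one move on adjacent entries. A property that can
  -- be pulled back along single moves can hence be pulled back from the sorted list to the original
  -- one.
  module _ (Q : List X → Set) (step : ∀ pre a b post → a ⊑ b → Q (pre ++ up b ∷ a ∷ post) → Q (pre ++ a ∷ b ∷ post)) where

    insert-Q : ∀ pre c D → Q (pre ++ insert c D) → Q (pre ++ c ∷ D)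
    insert-Q pre c []      q = q
    insert-Q pre c (d ∷ D) q with cmp c d
    ... | inj₂ _   = q
    ... | inj₁ c⊑d = step pre c d D c⊑d (subst Q (LP.++-assoc pre _ _)
                       (insert-Q (pre ∷ʳ up d) c D (subst Q (≡.sym (LP.++-assoc pre _ _)) q)))

    sort-Q : ∀ pre C → Q (pre ++ sort C) → Q (pre ++ C)
    sort-Q pre []      q = q
    sort-Q pre (c ∷ C) q = subst Q (LP.++-assoc pre _ _) (sort-Q (pre ∷ʳ c) C
      (subst Q (≡.sym (LP.++-assoc pre _ _)) (insert-Q pre c (sort C) q)))

    sort-induction : (∀ D → Decreasing D → Q D) → ∀ C → Q C
    sort-induction base C = sort-Q [] C (base (sort C) (sort-decreasing C))

-- Entries N k change by one during sorting, and `pred` truncates for small N, so linearity is asked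
-- for only from some point on.
record Lin : Set where
  field
    val    : ℕ → ℕ
    slope  : ℕ
    from   : ℕ
    linear : ∀ N → from ≤ N → val (suc N) ≡ slope + val N
open Lin

infix 4 _⊑_ _⊏_
_⊑_ _⊏_ : Lin → Lin → Set
a ⊑ b = Σ ℕ λ M → ∀ N → M ≤ N → val a N ≤ val b N
a ⊏ b = Σ ℕ λ M → ∀ N → M ≤ N → val a N < val b N

lin-at : ∀ a M → from a ≤ M → ∀ j → val a (j + M) ≡ j * slope a + val a M
lin-at a M le zero    = refl
lin-at a M le (suc j) = ≡.trans (linear a (j + M) (ℕP.≤-trans le (ℕP.m≤n+m M j)))
  (≡.trans (cong (λ z → slope a + z) (lin-at a M le j)) (≡.sym (ℕP.+-assoc (slope a) _ _)))

private
  steeper : ∀ a b → slope a < slope b → a ⊏ b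
  -- From M on, b gains at least 1 on a in each step, so after more than `val a M` steps it has
  -- overtaken a.
  steeper a b lt = M + suc (val a M) , λ N le → subst (λ z → val a z < val b z) (split N le) (go (N ∸ M) (enough N le))
    where
    M = from a + from b
    split : ∀ N → M + suc (val a M) ≤ N → N ∸ M + M ≡ N
    split N le = ℕP.m∸n+n≡m (ℕP.≤-trans (ℕP.m≤m+n M _) le)
    enough : ∀ N → M + suc (val a M) ≤ N → suc (val a M) ≤ N ∸ M
    enough N le = subst (_≤ N ∸ M) (ℕP.m+n∸m≡n M (suc (val a M))) (ℕP.∸-monoˡ-≤ M le)
    go : ∀ j → suc (val a M) ≤ j → val a (j + M) < val b (j + M)
    go j le = begin-strict
      val a (j + M)               ≡⟨ lin-at a M (ℕP.m≤m+n (from a) (from b)) j ⟩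
      j * slope a + val a M       <⟨ ℕP.+-monoʳ-< (j * slope a) le ⟩
      j * slope a + j             ≡⟨ ℕP.+-comm (j * slope a) j ⟩
      j + j * slope a             ≡⟨ ℕP.*-suc j (slope a) ⟨
      j * suc (slope a)           ≤⟨ ℕP.*-monoʳ-≤ j lt ⟩
      j * slope b                 ≤⟨ ℕP.m≤m+n (j * slope b) (val b M) ⟩
      j * slope b + val b M       ≡⟨ lin-at b M (ℕP.m≤n+m (from b) (from a)) j ⟨
      val b (j + M)               ∎
      where open ℕP.≤-Reasoning

⊏⇒⊑ : ∀ {a b} → a ⊏ b → a ⊑ b
⊏⇒⊑ (M , lt) = M , λ N le → ℕP.<⇒≤ (lt N le)

-- The larger slope wins eventually; for equal slopes one comparison beyond both starting points
-- decides. Thus one choice of moves sorts the whole family of codes for all large N.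
lin-cmp : ∀ a b → a ⊑ b ⊎ b ⊏ a
lin-cmp a b with ℕP.<-cmp (slope a) (slope b)
... | tri< lt _ _ = inj₁ (⊏⇒⊑ {a} {b} (steeper a b lt))
... | tri> _ _ gt = inj₂ (steeper b a gt)
... | tri≈ _ eq _ with val a (from a + from b) ≤? val b (from a + from b)
...   | yes le = inj₁ (from a + from b , λ N leN → parallel N leN (ℕP.+-monoʳ-≤ _ le))
  where
  parallel : ∀ N → from a + from b ≤ N → (N ∸ (from a + from b)) * slope a + val a (from a + from b) ≤ (N ∸ (from a + from b)) * slope a + val b (from a + from b) → val a N ≤ val b N
  parallel N leN h = ≡.subst₂ _≤_
    (≡.trans (≡.sym (lin-at a M (ℕP.m≤m+n (from a) (from b)) (N ∸ M))) (cong (val a) (ℕP.m∸n+n≡m leN)))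
    (≡.trans (cong (λ z → (N ∸ M) * z + val b M) eq)
      (≡.trans (≡.sym (lin-at b M (ℕP.m≤n+m (from b) (from a)) (N ∸ M))) (cong (val b) (ℕP.m∸n+n≡m leN)))) h
    where M = from a + from b
...   | no ¬le = inj₂ (from a + from b , λ N leN → ≡.subst₂ _<_
    (≡.trans (cong (λ z → (N ∸ M) * z + val b M) eq)
      (≡.trans (≡.sym (lin-at b M (ℕP.m≤n+m (from b) (from a)) (N ∸ M))) (cong (val b) (ℕP.m∸n+n≡m leN))))
    (≡.trans (≡.sym (lin-at a M (ℕP.m≤m+n (from a) (from b)) (N ∸ M))) (cong (val a) (ℕP.m∸n+n≡m leN)))
    (ℕP.+-monoʳ-< ((N ∸ M) * slope a) (ℕP.≰⇒> ¬le)))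
  where M = from a + from b

lin-suc : Lin → Lin
lin-suc a = record { val = suc ∘ val a ; slope = slope a ; from = from a
  ; linear = λ N le → ≡.trans (cong suc (linear a N le)) (≡.sym (ℕP.+-suc (slope a) (val a N))) }

⊑⇒⊏suc : ∀ {a b} → a ⊑ b → a ⊏ lin-suc b
⊑⇒⊏suc (M , le) = M , λ N leN → s≤s (le N leN)

suc-⊏ : ∀ {a b} → a ⊏ b → lin-suc a ⊏ lin-suc b
suc-⊏ (M , lt) = M , λ N leN → s≤s (lt N leN)

vals : List Lin → ℕ → List ℕ
vals C N = map (λ a → val a N) C

-- Schubert polynomials along families of codes

module SP = Series polyRing monoMul mono mono-*

sh-sw : ∀ i m F N → sw i (SP.sh m F N) ≃ SP.sh m (λ n → sw i (F n)) N
sh-sw i zero    F N       = ≃-refl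
sh-sw i (suc m) F zero    = ≃-refl
sh-sw i (suc m) F (suc N) = sh-sw i m F N

killed-sw : ∀ i xs {F} → SP.Killed (SP.Simple xs) F → SP.Killed (SP.Simple (map (swapAt (suc i)) xs)) (λ n → sw i (F n))
killed-sw i xs {F} (M , z) = M , λ N le → ≃-trans (≃-sym (commute xs F N)) (sw-cong i (z N le))
  where
  commute : ∀ xs F N → sw i (SP.Dels (SP.Simple xs) F N) ≃ SP.Dels (SP.Simple (map (swapAt (suc i)) xs)) (λ n → sw i (F n)) N
  commute []       F N = ≃-refl
  commute (x ∷ xs) F N = ≃-trans (commute xs (SP.Del (0 , x) F) N) (SP.Dels-cong (SP.Simple (map (swapAt (suc i)) xs))
    (λ n → ≃-trans (sw-sub i (F n) (mono x *ₚ SP.sh 1 F n)) (-ₚ-right (sw i (F n))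
      (≃-trans (sw-* i (mono x) (SP.sh 1 F n)) (*ₚ-right (sw i (mono x)) (sh-sw i 1 F n))))) N)

-- `∂ i` does not commute with 1 - t x^ν unless x^ν is symmetric in x_i and x_{i+1}. But y_i ∂_i F =
-- F - s_i F, where s_i F is killed by the swapped factors, and y_i can be cancelled at the end.
rat₁-∂ : ∀ i {F} → SP.Rat₁ F → SP.Rat₁ (λ n → ∂ i (F n))
rat₁-∂ i {F} (xs , k) = zs , proj₁ killedDiff , λ N le → y-cancel i (begin
  y i *ₚ SP.Dels (SP.Simple zs) (λ n → ∂ i (F n)) N ≈⟨ SP.Dels-scale (SP.Simple zs) (y i) (λ n → ∂ i (F n)) N ⟨
  SP.Dels (SP.Simple zs) (λ n → y i *ₚ ∂ i (F n)) N       ≈⟨ SP.Dels-cong (SP.Simple zs) diff N ⟩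
  SP.Dels (SP.Simple zs) (λ n → F n +ₚ (minusOne *ₚ sw i (F n))) N   ≈⟨ proj₂ killedDiff N le ⟩
  []                                                       ≈⟨ P.zeroʳ (y i) ⟨
  y i *ₚ []                                                ∎)
  where
  open SetoidReasoning P.setoid
  minusOne = -ₚ (mono [])
  ratDiff = SP.rat₁-⊕ {F} {λ n → minusOne *ₚ sw i (F n)} (xs , k)
              (map (swapAt (suc i)) xs , SP.killed-scale (SP.Simple (map (swapAt (suc i)) xs)) minusOne {λ n → sw i (F n)} (killed-sw i xs k))
  zs = proj₁ ratDiff
  killedDiff = proj₂ ratDiff
  diff : ∀ n → y i *ₚ ∂ i (F n) ≃ F n +ₚ (minusOne *ₚ sw i (F n))
  diff n = ≃-trans (y-∂ i (F n)) (+ₚ-right (F n) (≃-sym (-1*x≈-x (sw i (F n)))))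
    where open RingProperties P.ring using (-1*x≈-x)

-- Dominant codes and expansion of stretched Schubert polynomials

staircase : ℕ → ℕ → List ℕ
staircase zero    s = []
staircase (suc m) s = staircase m (suc s) ∷ʳ s

staircase-∷ : ∀ m s → staircase (suc m) s ≡ s + m ∷ staircase m s
staircase-∷ zero    s = cong (_∷ []) (≡.sym (ℕP.+-identityʳ s))
staircase-∷ (suc m) s = ≡.trans (cong (_∷ʳ s) (staircase-∷ m (suc s))) (cong (_∷ staircase (suc m) s) (≡.sym (ℕP.+-suc s m)))

staircase-0 : ∀ m → staircase m 0 ≡ reverse (upTo m)
staircase-0 m = ≡.trans (go m) (≡.sym (LP.reverse-upTo m))
  where
  go : ∀ m → staircase m 0 ≡ downFrom m
  go zero    = refl
  go (suc m) = ≡.trans (staircase-∷ m 0) (cong (m ∷_) (go m))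

-- Removes the first column and the last row of a diagram inside a staircase.
predInit : List ℕ → List ℕ
predInit []          = []
predInit (x ∷ [])    = []
predInit (x ∷ y ∷ l) = pred x ∷ predInit (y ∷ l)

WeaklyDecreasing : List ℕ → Set
WeaklyDecreasing = Linked (λ a b → b ≤ a)

predInit-length : ∀ x l → length (predInit (x ∷ l)) ≡ length l
predInit-length x []      = refl
predInit-length x (y ∷ l) = cong suc (predInit-length y l)

predInit-fits : ∀ {l} → Fits l → Fits (predInit l)
predInit-fits []                            = []
predInit-fits (le ∷ [])                     = []
predInit-fits {x ∷ y ∷ l} (le ∷ fits@(_ ∷ _)) =
  subst (pred x ≤_) (≡.sym (predInit-length y l)) (ℕP.pred-mono-≤ le) ∷ predInit-fits fits

predInit-decreasing : ∀ {l} → WeaklyDecreasing l → WeaklyDecreasing (predInit l)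
predInit-decreasing []                     = []
predInit-decreasing [-]                    = []
predInit-decreasing (le ∷ [-])             = [-]
predInit-decreasing (le ∷ dec@(_ ∷ _))     = ℕP.pred-mono-≤ le ∷ predInit-decreasing dec

pad-decreasing : ∀ K {l} → WeaklyDecreasing l → WeaklyDecreasing (pad K l)
pad-decreasing zero          []         = []
pad-decreasing (suc zero)    []         = [-]
pad-decreasing (suc (suc K)) []         = z≤n ∷ pad-decreasing (suc K) []
pad-decreasing zero          [-]        = [-]
pad-decreasing (suc K)       [-]        = z≤n ∷ pad-decreasing (suc K) []
pad-decreasing K             (le ∷ dec) = le ∷ pad-decreasing K dec

module ℕSort = UpSort suc _≤_ _<_ ℕP.≤-<-connex s≤s s≤s
module LinSort = UpSort lin-suc _⊑_ _⊏_ lin-cmp (λ {a} {b} → ⊑⇒⊏suc {a} {b}) (λ {a} {b} → suc-⊏ {a} {b})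

module SchubertExpansion (𝔖 : Key → Poly) (isSchubert : IsSchubert 𝔖) where
  open Schubert 𝔖 isSchubert public

  S-step-++ : ∀ pre a b post → a ≤ b → S (pre ++ a ∷ b ∷ post) ≃ ∂ (length pre) (S (pre ++ suc b ∷ a ∷ post))
  S-step-++ pre a b post le = ≃-trans
    (S-step c (length pre) (≡.subst₂ _≤_ (≡.sym (ix-++₀ pre a (b ∷ post))) (≡.sym (ix-++₁ pre a b post)) le))
    (≡⇒≃ (cong (λ z → ∂ (length pre) (S z)) (up-++ pre a b post)))
    where c = pre ++ a ∷ b ∷ post

  good-step : ∀ pre a post → Good (pre ++ suc a ∷ a ∷ post) → Good (pre ++ a ∷ a ∷ post)
  good-step pre a post good = begin
    S (pre ++ a ∷ a ∷ post)                          ≈⟨ S-step-++ pre a a post ℕP.≤-refl ⟩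
    ∂ (length pre) (S b)                             ≈⟨ ∂-cong (length pre) good ⟩
    ∂ (length pre) (mono b)
      ≈⟨ ∂-adjacent (length pre) b a (ix-++₀ pre (suc a) (a ∷ post)) (ix-++₁ pre (suc a) a post) ⟩
    mono (repl (length pre) b a a)                   ≡⟨ cong mono (repl-++ pre (suc a) a post a a) ⟩
    mono (pre ++ a ∷ a ∷ post)                       ∎
    where
    open SetoidReasoning P.setoid
    b = pre ++ suc a ∷ a ∷ post

  -- Turns the zeros of a diagram, except the last, into ones.
  good-raise : ∀ s pre post x l → WeaklyDecreasing (x ∷ l) → Fits (x ∷ l) →
               Good (pre ++ map (λ v → s + suc v) (predInit (x ∷ l)) ++ s ∷ post) →
               Good (pre ++ map (λ v → s + v) (x ∷ l) ++ post)
  good-raise s pre post x [] dec (z≤n ∷ []) good = subst (λ z → Good (pre ++ z ∷ post)) (≡.sym (ℕP.+-identityʳ s)) good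
  good-raise s pre post (suc x) (y ∷ l) (_ ∷ dec) (_ ∷ fits) good = subst Good (LP.++-assoc pre _ _)
    (good-raise s (pre ∷ʳ (s + suc x)) post y l dec fits (subst Good (≡.sym (LP.++-assoc pre _ _)) good))
  good-raise s pre post zero (zero ∷ l) (z≤n ∷ dec) (_ ∷ fits) good = good-step pre (s + 0) _
    (subst Good (≡.trans (LP.++-assoc pre _ _) (cong (λ z → pre ++ z ∷ s + 0 ∷ map (λ v → s + v) l ++ post) (ℕP.+-suc s 0)))
      (good-raise s (pre ∷ʳ (s + 1)) post zero l dec fits (subst Good (≡.sym (LP.++-assoc pre _ _)) good)))

  -- `Fits` puts the diagram inside a staircase and forces its last row to be empty. The other rows
  -- without their first column fit the next smaller staircase, based at s + 1; `good-raise` then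
  -- lowers the rows that ought to be empty.
  good-climb : ∀ m s post l → length l ≡ m → WeaklyDecreasing l → Fits l →
               Good (staircase m s ++ post) → Good (map (λ v → s + v) l ++ post)
  good-climb zero    s post []      refl dec fits good = good
  good-climb (suc m) s post (x ∷ l) eq dec fits good = good-raise s [] post x l dec fits
    (subst (λ z → Good (z ++ s ∷ post)) (≡.sym (LP.map-cong (λ v → ℕP.+-suc s v) (predInit (x ∷ l))))
      (good-climb m (suc s) (s ∷ post) (predInit (x ∷ l)) (≡.trans (predInit-length x l) (ℕP.suc-injective eq))
        (predInit-decreasing dec) (predInit-fits fits) (subst Good (LP.++-assoc (staircase m (suc s)) (s ∷ []) post) good)))

  -- The hypotheses provide a monomial only for staircases. Dominant codes are reached from these by
  -- removing boxes, each removal being an instance of `∂-adjacent`; padding with zeros makes the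
  -- diagram fit a staircase.
  S-dominant : ∀ l → WeaklyDecreasing l → S l ≃ mono l
  S-dominant l dec = ≃-trans (≃-sym (S-cong (pad-≋ K l))) (≃-trans padded (mono-cong (pad-≋ K l)))
    where
    K = sum l
    l⁺ = pad K l
    padded : Good l⁺
    padded = subst Good (≡.trans (LP.++-identityʳ _) (LP.map-id l⁺))
      (good-climb (length l⁺) 0 [] l⁺ refl (pad-decreasing K dec) (pad-fits K l ℕP.≤-refl)
        (subst Good (≡.sym (≡.trans (LP.++-identityʳ _) (staircase-0 (length l⁺)))) (good-staircase (length l⁺))))

  -- A sorting move raises the degree by one and its ∂ lowers it again, so the claim reduces to
  -- monomials. It bounds the variables to be extracted and makes ε dual to the empty code.
  S-varsDeg : ∀ c → Supp (VarsDeg (length c) (sum c)) (S c)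
  S-varsDeg = ℕSort.sort-induction (λ c → Supp (VarsDeg (length c) (sum c)) (S c))
    (λ pre a b post le s → supp-cong {VarsDeg (length (pre ++ a ∷ b ∷ post)) (sum (pre ++ a ∷ b ∷ post))}
        (≃-sym (S-step-++ pre a b post le))
        (varsDeg-∂ (length pre) (inside pre a b post) {S (pre ++ suc b ∷ a ∷ post)}
        (≡.subst₂ (λ k d → Supp (VarsDeg k d) (S (pre ++ suc b ∷ a ∷ post)))
          (≡.trans (LP.length-++ pre) (≡.sym (LP.length-++ pre))) (sum-up pre a b post) s)))
    (λ D dec → supp-cong {VarsDeg (length D) (sum D)} (≃-sym (S-dominant D (weaken dec))) (supp-mono {VarsDeg (length D) (sum D)} (beyond D , refl)))
    where
    weaken : ∀ {D} → Linked (λ a b → b < a) D → WeaklyDecreasing D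
    weaken []        = []
    weaken [-]       = [-]
    weaken (lt ∷ l)  = ℕP.<⇒≤ lt ∷ weaken l
    beyond : ∀ D → Vars (length D) D
    beyond []      i       le       = refl
    beyond (x ∷ D) (suc i) (s≤s le) = beyond D i le
    inside : ∀ pre (a b : ℕ) post → suc (length pre) < length (pre ++ a ∷ b ∷ post)
    inside []        a b post = s≤s (s≤s z≤n)
    inside (x ∷ pre) a b post = s≤s (inside pre a b post)
    sum-up : ∀ pre a b post → sum (pre ++ suc b ∷ a ∷ post) ≡ suc (sum (pre ++ a ∷ b ∷ post))
    sum-up [] a b post = cong suc (≡.trans (≡.sym (ℕP.+-assoc b a (sum post)))
      (≡.trans (cong (_+ sum post) (ℕP.+-comm b a)) (ℕP.+-assoc a b (sum post))))
    sum-up (x ∷ pre) a b post = ≡.trans (cong (λ z → x + z) (sum-up pre a b post)) (ℕP.+-suc x _)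

  S-rat₁ : ∀ C → SP.Rat₁ (λ N → S (vals C N))
  S-rat₁ = LinSort.sort-induction (λ C → SP.Rat₁ (λ N → S (vals C N)))
    (λ pre a b post (M , le) rat → SP.rat₁-ev M
      (λ N leN → ≃-sym (≃-trans (≡⇒≃ (cong S (LP.map-++ (λ a → val a N) pre (a ∷ b ∷ post))))
        (≃-trans (S-step-++ (vals pre N) (val a N) (val b N) (vals post N) (le N leN))
          (≡⇒≃ (cong₂ (λ i c → ∂ i (S c)) (LP.length-map (λ a → val a N) pre)
            (≡.sym (LP.map-++ (λ a → val a N) pre (lin-suc b ∷ a ∷ post))))))))
      (rat₁-∂ (length pre) rat))
    base
    where
    eventually : ∀ {D} → Linked (λ a b → b ⊏ a) D → Σ ℕ λ M → ∀ N → M ≤ N → WeaklyDecreasing (vals D N)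
    eventually []  = 0 , λ _ _ → []
    eventually [-] = 0 , λ _ _ → [-]
    eventually ((M , lt) ∷ l) = let M′ , dec = eventually l in M + M′ ,
      λ N le → ℕP.<⇒≤ (lt N (ℕP.≤-trans (ℕP.m≤m+n M M′) le)) ∷ dec N (ℕP.≤-trans (ℕP.m≤n+m M′ M) le)
    slopes : ∀ D → Σ ℕ λ M → ∀ N → M ≤ N → vals D (suc N) ≋ monoMul (map slope D) (vals D N)
    slopes []      = 0 , λ _ _ → ≋-refl
    slopes (a ∷ D) = let M , eq = slopes D in from a + M , λ N le → eqv λ where
      zero    → linear a N (ℕP.≤-trans (ℕP.m≤m+n (from a) M) le)
      (suc i) → ix≡ (eq N (ℕP.≤-trans (ℕP.m≤n+m M (from a)) le)) i
    base : ∀ D → Linked (λ a b → b ⊏ a) D → SP.Rat₁ (λ N → S (vals D N))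
    base D dec = let M , ev = eventually dec ; M′ , eq = slopes D in
      SP.rat₁-ev M (λ N le → ≃-sym (S-dominant (vals D N) (ev N le)))
        -- Consecutive monomials differ by the fixed factor x^slopes, so a single generator
        -- suffices; `suc` because `Del` at N + 1 looks back at N.
        (map slope D ∷ [] , suc M′ , λ where
          (suc N) (s≤s le) → ≃-trans
            (-ₚ-right (mono (vals D (suc N))) (≃-trans (≃-sym (mono-* (map slope D) (vals D N))) (mono-cong (≋-sym (eq N le)))))
            (P.-‿inverseʳ (mono (vals D (suc N)))))

-- Extraction of the coefficients of one variable

-- The exponent is an integer because passing a factor x^ν subtracts ν_j from it; when it becomes
-- negative, no monomial matches.
extract : ℕ → ℤ → Mono → Poly
extract j z a = if does (+ ix a j ℤ.≟ z) then mono (put a j 0) else []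

ext : ℕ → ℤ → Poly → Poly
ext j z = lift (extract j z)

put-cong : ∀ {a b} j v → a ≋ b → put a j v ≋ put b j v
put-cong {a} {b} j v eq = eqv go
  where
  go : ∀ i → ix (put a j v) i ≡ ix (put b j v) i
  go i with j ℕ.≟ i
  ... | yes refl = ≡.trans (ix-put-same a j v) (≡.sym (ix-put-same b j v))
  ... | no ne = ≡.trans (ix-put-other a j i v ne) (≡.trans (ix≡ eq i) (≡.sym (ix-put-other b j i v ne)))

extract-yes : ∀ j {z} a → + ix a j ≡ z → extract j z a ≡ mono (put a j 0)
extract-yes j {z} a eq with + ix a j ℤ.≟ z
... | yes _ = refl
... | no ne = ⊥-elim (ne eq)

extract-no : ∀ j {z} a → + ix a j ≢ z → extract j z a ≡ []
extract-no j {z} a ne with + ix a j ℤ.≟ z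
... | yes eq = ⊥-elim (ne eq)
... | no _   = refl

extract-cong : ∀ j z {a b} → a ≋ b → extract j z a ≃ extract j z b
extract-cong j z {a} {b} eq with + ix a j ℤ.≟ z
... | yes e = ≃-trans (mono-cong (put-cong j 0 eq)) (≡⇒≃ (≡.sym (extract-yes j b (≡.trans (cong (+_) (≡.sym (ix≡ eq j))) e))))
... | no ne = ≡⇒≃ (≡.sym (extract-no j b (λ e → ne (≡.trans (cong (+_) (ix≡ eq j)) e))))

ext-cong : ∀ j z {p q} → p ≃ q → ext j z p ≃ ext j z q
ext-cong j z = lift-cong (extract-cong j z)

put-monoMul : ∀ ν b j → put (monoMul ν b) j 0 ≋ monoMul (put ν j 0) (put b j 0)
put-monoMul ν b j = eqv go
  where
  go : ∀ i → ix (put (monoMul ν b) j 0) i ≡ ix (monoMul (put ν j 0) (put b j 0)) i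
  go i with j ℕ.≟ i
  ... | yes refl = ≡.trans (ix-put-same (monoMul ν b) j 0) (≡.sym (≡.trans (ix-monoMul (put ν j 0) (put b j 0) j)
                     (cong₂ _+_ (ix-put-same ν j 0) (ix-put-same b j 0))))
  ... | no ne = ≡.trans (ix-put-other (monoMul ν b) j i 0 ne) (≡.trans (ix-monoMul ν b i) (≡.sym
                  (≡.trans (ix-monoMul (put ν j 0) (put b j 0) i) (cong₂ _+_ (ix-put-other ν j i 0 ne) (ix-put-other b j i 0 ne)))))

extract-monoMul : ∀ j z ν b → extract j z (monoMul ν b) ≃ mono (put ν j 0) *ₚ extract j (z ℤ.- + ix ν j) b
extract-monoMul j z ν b with + ix b j ℤ.≟ z ℤ.- + ix ν j
... | yes eq = ≃-trans (≡⇒≃ (extract-yes j {z} (monoMul ν b) (begin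
    + ix (monoMul ν b) j              ≡⟨ cong (+_) (ix-monoMul ν b j) ⟩
    + ix ν j ℤ.+ + ix b j             ≡⟨ cong (λ w → + ix ν j ℤ.+ w) eq ⟩
    + ix ν j ℤ.+ (z ℤ.- + ix ν j)     ≡⟨ solve 2 (λ n z → n :+ (z :- n) := z) refl (+ ix ν j) z ⟩
    z                                 ∎)))
    (≃-trans (mono-cong (put-monoMul ν b j)) (mono-* (put ν j 0) (put b j 0)))
  where
  open ≡.≡-Reasoning
  open ℤ-Solver
... | no ne = ≃-trans (≡⇒≃ (extract-no j {z} (monoMul ν b) (λ eq → ne (begin
    + ix b j ≡⟨ solve 2 (λ n b → b := (n :+ b) :- n) refl (+ ix ν j) (+ ix b j) ⟩
    (+ ix ν j ℤ.+ + ix b j) ℤ.- + ix ν j ≡⟨ cong (λ w → + w ℤ.- + ix ν j) (ix-monoMul ν b j) ⟨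
    + ix (monoMul ν b) j ℤ.- + ix ν j              ≡⟨ cong (ℤ._- + ix ν j) eq ⟩
    z ℤ.- + ix ν j                                 ∎))))
    (≃-sym (P.zeroʳ (mono (put ν j 0))))
  where
  open ≡.≡-Reasoning
  open ℤ-Solver

ext-mono* : ∀ j z ν p → ext j z (mono ν *ₚ p) ≃ mono (put ν j 0) *ₚ ext j (z ℤ.- + ix ν j) p
ext-mono* j z ν p = mk λ L r → begin
  pair L (ext j z (mono ν *ₚ p)) ≡⟨ pair-lift L (extract j z) (mono ν *ₚ p) ⟩
  pair (λ a → pair L (extract j z a)) (mono ν *ₚ p)             ≡⟨ pair-mono* _ ν p ⟩
  pair (λ b → pair L (extract j z (monoMul ν b))) p ≡⟨ pair-cong (λ b → pair-≡ (extract-monoMul j z ν b) L r) p ⟩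
  pair (λ b → pair L (mono (put ν j 0) *ₚ extract j (z ℤ.- + ix ν j) b)) p ≡⟨ pair-lift L _ p ⟨
  pair L (lift (λ b → mono (put ν j 0) *ₚ extract j (z ℤ.- + ix ν j) b) p)
    ≡⟨ pair-≡ (lift-* (extract j (z ℤ.- + ix ν j)) (mono (put ν j 0)) p) L r ⟩
  pair L (mono (put ν j 0) *ₚ ext j (z ℤ.- + ix ν j) p)         ∎
  where open ≡.≡-Reasoning

ext-neg : ∀ j {z} → z ℤ.< 0ℤ → ∀ p → ext j z p ≃ []
ext-neg j {z} neg p = mk λ L r → ≡.trans (pair-lift L (extract j z) p)
  (≡.trans (pair-cong (λ a → cong (pair L) (extract-no j a (λ eq → ℤP.<⇒≱ neg (subst (0ℤ ℤ.≤_) eq (ℤ.+≤+ z≤n))))) p) (pair-0ᴸ p))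

topExp : ℕ → Poly → ℕ
topExp j []            = 0
topExp j ((a , k) ∷ p) = ix a j ⊔ topExp j p

ext-high : ∀ j {z} p → + topExp j p ℤ.< z → ext j z p ≃ []
ext-high j p lt = ≡⇒≃ (go p lt)
  where
  go : ∀ {z} p → + topExp j p ℤ.< z → ext j z p ≡ []
  go []            lt = refl
  go {z} ((a , k) ∷ p) lt
    rewrite extract-no j {z} a (λ eq → ℤP.<⇒≱ lt (subst (ℤ._≤ + topExp j ((a , k) ∷ p)) eq (ℤ.+≤+ (ℕP.m≤m⊔n (ix a j) (topExp j p))))) =
    go p (ℤP.≤-<-trans (ℤ.+≤+ (ℕP.m≤n⊔m (ix a j) (topExp j p))) lt)

nonneg-cases : ∀ z → 0ℤ ℤ.≤ z → z ≡ 0ℤ ⊎ 1ℤ ℤ.≤ z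
nonneg-cases (+ zero)  le = inj₁ refl
nonneg-cases (+ suc n) le = inj₂ (ℤ.+≤+ (s≤s z≤n))

-- X σ is the part of weight σ of a series. When all generators have nonnegative weight it vanishes for σ ≪ 0,
-- and X-split expresses it through parts of lower weight.
module Graded (X : ℤ → SP.Seq → SP.Seq)
              (X-cong : ∀ σ {F G} → F SP.≗ G → X σ F SP.≗ X σ G)
              (X-⊕ : ∀ σ F G N → X σ (λ n → F n +ₚ G n) N ≃ X σ F N +ₚ X σ G N)
              (wt : SP.Gen → ℤ) (red : SP.Gen → SP.Gen)
              (X-act : ∀ σ A F N → X σ (SP.act A F) N ≃ SP.act (red A) (X (σ ℤ.- wt A) F) N)
              (X-ev0 : ∀ σ {F} → SP.EventuallyZero F → SP.EventuallyZero (X σ F))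
              (X-bounded : ∀ {F} → SP.EventuallyZero F → Σ ℤ λ σ₀ → ∀ σ → σ ℤ.< σ₀ → ∀ N → X σ F N ≃ []) where

  X-split : ∀ σ A F N → X σ F N ≃ X σ (SP.Del A F) N +ₚ SP.act (red A) (X (σ ℤ.- wt A) F) N
  X-split σ A F N = ≃-trans (X-cong σ (λ n → solveₚ 2 (λ f a → f :≃ (f PS.:- a) PS.:+ a) ≃-refl (F n) (SP.act A F n)) N)
    (≃-trans (X-⊕ σ (SP.Del A F) (SP.act A F) N) (+ₚ-right (X σ (SP.Del A F) N) (X-act σ A F N)))

  act-0 : ∀ A N → SP.act A (λ _ → []) N ≃ []
  act-0 (m , x) N = ≃-trans (*ₚ-right (mono x) (≡⇒≃ (go (suc m) N))) (P.zeroʳ (mono x))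
    where
    go : ∀ m N → SP.sh m (λ _ → []) N ≡ []
    go zero    N       = refl
    go (suc m) zero    = refl
    go (suc m) (suc N) = go m N

  Bounded : SP.Seq → Set
  Bounded F = Σ ℤ λ σ₀ → ∀ σ → σ ℤ.< σ₀ → ∀ N → X σ F N ≃ []

  module Step (A : SP.Gen) (le : 0ℤ ℤ.≤ wt A) (F : SP.Seq) (σ₀ : ℤ)
              (vanish : ∀ σ → σ ℤ.< σ₀ → ∀ N → X σ (SP.Del A F) N ≃ []) (rat′ : ∀ σ → SP.Rat (X σ (SP.Del A F))) where

    step-< : ∀ σ τ → σ ℤ.< τ → σ ℤ.- wt A ℤ.< τ
    step-< σ τ lt = ℤP.≤-<-trans (subst (σ ℤ.- wt A ℤ.≤_) (ℤP.+-identityʳ σ) (ℤP.+-monoʳ-≤ σ (ℤP.neg-mono-≤ le))) lt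

    -- Induction on N: the delayed term has index σ - wt A, still below σ₀ because the weight is
    -- nonnegative.
    below-fuel : ∀ M σ → σ ℤ.< σ₀ → ∀ N → N < M → X σ F N ≃ []
    below-fuel (suc M) σ lt N (s≤s N≤M) = ≃-trans (X-split σ A F N) (+ₚ-cong {X σ (SP.Del A F) N} {[]} (vanish σ lt N)
        (≃-trans (SP.act-local (red A) {X (σ ℤ.- wt A) F} {λ _ → []} N
          (λ j j<N → below-fuel M (σ ℤ.- wt A) (step-< σ σ₀ lt) j (ℕP.<-≤-trans j<N N≤M))) (act-0 (red A) N)))

    below : ∀ σ → σ ℤ.< σ₀ → ∀ N → X σ F N ≃ []
    below σ lt N = below-fuel (suc N) σ lt N ℕP.≤-refl

    reach : ∀ σ → σ ℤ.< σ₀ ℤ.+ + suc ℤ.∣ σ ℤ.- σ₀ ∣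
    reach σ = begin-strict
      σ                                     ≡⟨ solve 2 (λ σ τ → σ := τ :+ (σ :- τ)) refl σ σ₀ ⟩
      σ₀ ℤ.+ (σ ℤ.- σ₀)                     ≤⟨ ℤP.+-monoʳ-≤ σ₀ (i≤∣i∣ (σ ℤ.- σ₀)) ⟩
      σ₀ ℤ.+ + ℤ.∣ σ ℤ.- σ₀ ∣               <⟨ ℤP.+-monoʳ-< σ₀ (ℤ.+<+ (ℕP.n<1+n _)) ⟩
      σ₀ ℤ.+ + suc ℤ.∣ σ ℤ.- σ₀ ∣           ∎
      where
      open ℤP.≤-Reasoning
      open ℤ-Solver
      i≤∣i∣ : ∀ i → i ℤ.≤ + ℤ.∣ i ∣
      i≤∣i∣ (+ n)    = ℤP.≤-refl
      i≤∣i∣ -[1+ n ] = ℤ.-≤+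

    -- With positive weight each use of `X-split` lowers σ by at least one, so finitely many steps
    -- reach vanishing parts. Such a generator contributes no factor to the denominator.
    climb : 1ℤ ℤ.≤ wt A → ∀ k σ → σ ℤ.< σ₀ ℤ.+ + k → SP.Rat (X σ F)
    climb 1≤w zero    σ lt = SP.rat-cong {λ _ → []} {X σ F}
      (λ N → ≃-sym (below σ (subst (σ ℤ.<_) (ℤP.+-identityʳ σ₀) lt) N)) SP.rat-0
    climb 1≤w (suc k) σ lt = SP.rat-cong {λ N → X σ (SP.Del A F) N +ₚ SP.act (red A) (X (σ ℤ.- wt A) F) N} {X σ F}
      (λ N → ≃-sym (X-split σ A F N))
      (SP.rat-⊕ {X σ (SP.Del A F)} (rat′ σ) (SP.rat-act (red A) {X (σ ℤ.- wt A) F} (climb 1≤w k (σ ℤ.- wt A) (subst (σ ℤ.- wt A ℤ.<_)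
        (solve 2 (λ s k → (s :+ (con 1ℤ :+ k)) :- con 1ℤ := s :+ k) refl σ₀ (+ k))
        (ℤP.+-mono-<-≤ lt (ℤP.neg-mono-≤ 1≤w))))))
      where open ℤ-Solver

    -- A generator of weight 0 leaves σ unchanged, so its factor survives the extraction as that of
    -- `red A`.
    neutral : wt A ≡ 0ℤ → ∀ σ N → X σ (SP.Del A F) N ≃ SP.Del (red A) (X σ F) N
    neutral w≡0 σ N = ≃-sym (≃-trans
      (-ₚ-left (SP.act (red A) (X σ F) N) (≃-trans (X-split σ A F N) (+ₚ-right (X σ (SP.Del A F) N)
        (SP.act-cong (red A) {X (σ ℤ.- wt A) F} {X σ F}
          (λ n → ≡⇒≃ (cong (λ τ → X τ F n) (≡.trans (cong (λ w → σ ℤ.- w) w≡0) (ℤP.+-identityʳ σ)))) N))))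
      (solveₚ 2 (λ a b → (a PS.:+ b) PS.:- b :≃ a) ≃-refl (X σ (SP.Del A F) N) (SP.act (red A) (X σ F) N)))

    rat : ∀ σ → SP.Rat (X σ F)
    rat σ = [ (λ w≡0 → SP.rat-Del⁻ (red A) {X σ F} (SP.rat-cong {X σ (SP.Del A F)} {SP.Del (red A) (X σ F)} (neutral w≡0 σ) (rat′ σ)))
            , (λ 1≤w → climb 1≤w (suc ℤ.∣ σ ℤ.- σ₀ ∣) σ (reach σ)) ]′ (nonneg-cases (wt A) le)

  nonneg : ∀ As → All (λ A → 0ℤ ℤ.≤ wt A) As → ∀ F → SP.Killed As F → Bounded F × (∀ σ → SP.Rat (X σ F))
  nonneg []       []         F k = X-bounded k , λ σ → [] , X-ev0 σ k
  nonneg (A ∷ As) (le ∷ les) F k = (σ₀ , St.below) , St.rat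
    where
    IH = nonneg As les (SP.Del A F) k
    σ₀ = proj₁ (proj₁ IH)
    module St = Step A le F σ₀ (proj₂ (proj₁ IH)) (proj₂ IH)

module Extraction (j c : ℕ) where

  X : ℤ → SP.Seq → SP.Seq
  X σ F N = ext j (+ c ℤ.* + N ℤ.+ σ) (F N)

  -- How far t^(m+1) x^ν moves off the line of exponents cN + σ: the exponent of x_j grows by ν_j,
  -- the line by c (m + 1).
  wt : SP.Gen → ℤ
  wt (m , ν) = + ix ν j ℤ.- + c ℤ.* + suc m

  red : SP.Gen → SP.Gen
  red (m , ν) = m , put ν j 0

  X-cong : ∀ σ {F G} → F SP.≗ G → X σ F SP.≗ X σ G
  X-cong σ eq N = ext-cong j (+ c ℤ.* + N ℤ.+ σ) (eq N)

  X-⊕ : ∀ σ F G N → X σ (λ n → F n +ₚ G n) N ≃ X σ F N +ₚ X σ G N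
  X-⊕ σ F G N = lift-+ (extract j (+ c ℤ.* + N ℤ.+ σ)) (F N) (G N)

  X-sh : ∀ m τ F N → ext j (+ c ℤ.* + N ℤ.+ τ) (SP.sh m F N) ≃ SP.sh m (X (τ ℤ.+ + c ℤ.* + m) F) N
  X-sh zero τ F N = ≡⇒≃ (cong (λ z → ext j z (F N)) (solve 3 (λ c N τ → c :* N :+ τ := c :* N :+ (τ :+ c :* con 0ℤ)) refl (+ c) (+ N) τ))
    where open ℤ-Solver
  X-sh (suc m) τ F zero    = ≃-refl
  X-sh (suc m) τ F (suc N) = ≃-trans
    (≡⇒≃ (cong (λ z → ext j z (SP.sh m F N)) (solve 3 (λ c N τ → c :* (con 1ℤ :+ N) :+ τ := c :* N :+ (τ :+ c)) refl (+ c) (+ N) τ)))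
    (≃-trans (X-sh m (τ ℤ.+ + c) F N) (SP.sh-cong m (λ n → ≡⇒≃ (cong (λ z → X z F n)
      (solve 3 (λ c m τ → (τ :+ c) :+ c :* m := τ :+ c :* (con 1ℤ :+ m)) refl (+ c) (+ m) τ))) N))
    where open ℤ-Solver

  X-act : ∀ σ A F N → X σ (SP.act A F) N ≃ SP.act (red A) (X (σ ℤ.- wt A) F) N
  X-act σ (m , ν) F N = begin
    ext j (+ c ℤ.* + N ℤ.+ σ) (mono ν *ₚ SP.sh (suc m) F N)
      ≈⟨ ext-mono* j (+ c ℤ.* + N ℤ.+ σ) ν (SP.sh (suc m) F N) ⟩
    mono (put ν j 0) *ₚ ext j ((+ c ℤ.* + N ℤ.+ σ) ℤ.- + ix ν j) (SP.sh (suc m) F N)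
      ≡⟨ cong (λ z → mono (put ν j 0) *ₚ ext j z (SP.sh (suc m) F N)) (ℤP.+-assoc (+ c ℤ.* + N) σ (ℤ.- + ix ν j)) ⟩
    mono (put ν j 0) *ₚ ext j (+ c ℤ.* + N ℤ.+ (σ ℤ.- + ix ν j)) (SP.sh (suc m) F N)
      ≈⟨ *ₚ-right (mono (put ν j 0)) (X-sh (suc m) (σ ℤ.- + ix ν j) F N) ⟩
    mono (put ν j 0) *ₚ SP.sh (suc m) (X ((σ ℤ.- + ix ν j) ℤ.+ + c ℤ.* + suc m) F) N
      ≈⟨ *ₚ-right (mono (put ν j 0)) (SP.sh-cong (suc m) (λ n → ≡⇒≃ (cong (λ z → X z F n)
           (solve 4 (λ σ v c m → (σ :- v) :+ c :* m := σ :- (v :- c :* m)) refl σ (+ ix ν j) (+ c) (+ suc m)))) N) ⟩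
    SP.act (red (m , ν)) (X (σ ℤ.- wt (m , ν)) F) N ∎
    where
    open SetoidReasoning P.setoid
    open ℤ-Solver

  X-ev0 : ∀ σ {F} → SP.EventuallyZero F → SP.EventuallyZero (X σ F)
  X-ev0 σ (M , z) = M , λ N le → ext-cong j (+ c ℤ.* + N ℤ.+ σ) (z N le)

  X-below : ∀ {F} → SP.EventuallyZero F → Σ ℤ λ σ₀ → ∀ σ → σ ℤ.< σ₀ → ∀ N → X σ F N ≃ []
  X-below {F} (M , z) = ℤ.- (+ c ℤ.* + M) , vanish
    where
    vanish : ∀ σ → σ ℤ.< ℤ.- (+ c ℤ.* + M) → ∀ N → X σ F N ≃ []
    vanish σ lt N with M ≤? N
    ... | yes le = ext-cong j (+ c ℤ.* + N ℤ.+ σ) (z N le)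
    ... | no nle = ext-neg j (begin-strict
        + c ℤ.* + N ℤ.+ σ                    <⟨ ℤP.+-monoʳ-< (+ c ℤ.* + N) lt ⟩
        + c ℤ.* + N ℤ.- + c ℤ.* + M ≤⟨ ℤP.+-monoˡ-≤ (ℤ.- (+ c ℤ.* + M)) (ℤP.*-monoˡ-≤-nonNeg (+ c) (ℤ.+≤+ (ℕP.≰⇒≥ nle))) ⟩
        + c ℤ.* + M ℤ.- + c ℤ.* + M          ≡⟨ ℤP.+-inverseʳ (+ c ℤ.* + M) ⟩
        0ℤ                                   ∎) (F N)
      where open ℤP.≤-Reasoning

  -- Only finitely many terms are nonzero, so their degrees in x_j have a common bound, beyond which
  -- nothing is extracted.
  X-above : ∀ {F} → SP.EventuallyZero F → Σ ℤ λ σ₀ → ∀ σ → σ ℤ.< σ₀ → ∀ N → X (ℤ.- σ) F N ≃ []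
  X-above {F} (M , z) = ℤ.- + top M , vanish
    where
    top : ℕ → ℕ
    top zero    = 0
    top (suc M) = topExp j (F M) ⊔ top M
    top-≥ : ∀ M N → N < M → topExp j (F N) ≤ top M
    top-≥ (suc M) N (s≤s le) with ℕP.m≤n⇒m<n∨m≡n le
    ... | inj₁ lt   = ℕP.≤-trans (top-≥ M N lt) (ℕP.m≤n⊔m (topExp j (F M)) (top M))
    ... | inj₂ refl = ℕP.m≤m⊔n (topExp j (F M)) (top M)
    vanish : ∀ σ → σ ℤ.< ℤ.- + top M → ∀ N → X (ℤ.- σ) F N ≃ []
    vanish σ lt N with M ≤? N
    ... | yes le = ext-cong j (+ c ℤ.* + N ℤ.+ ℤ.- σ) (z N le)
    ... | no nle = ext-high j (F N) (begin-strict
        + topExp j (F N)         ≤⟨ ℤ.+≤+ (top-≥ M N (ℕP.≰⇒> nle)) ⟩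
        + top M                  ≡⟨ ℤP.neg-involutive (+ top M) ⟨
        ℤ.- (ℤ.- + top M)        <⟨ ℤP.neg-mono-< lt ⟩
        ℤ.- σ                    ≡⟨ ℤP.+-identityˡ (ℤ.- σ) ⟨
        0ℤ ℤ.- σ ≤⟨ ℤP.+-monoˡ-≤ (ℤ.- σ) (subst (0ℤ ℤ.≤_) (ℤP.pos-* c N) (ℤ.+≤+ z≤n)) ⟩
        + c ℤ.* + N ℤ.- σ        ∎)
      where open ℤP.≤-Reasoning

  module Nonnegative = Graded X X-cong X-⊕ wt red X-act X-ev0 X-below
  -- Negating σ and the weights turns nonpositive weights into nonnegative ones; boundedness now
  -- comes from degrees being bounded above instead of from exponents being nonnegative.
  module Nonpositive = Graded (X ∘ ℤ.-_) (X-cong ∘ ℤ.-_) (X-⊕ ∘ ℤ.-_) (ℤ.-_ ∘ wt) red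
    (λ σ A F N → ≃-trans (X-act (ℤ.- σ) A F N) (SP.act-cong (red A) (λ n → ≡⇒≃ (cong (λ z → X z F n)
      (≡.trans (≡.sym (ℤP.neg-distrib-+ σ (wt A))) (cong (λ w → ℤ.- (σ ℤ.+ w)) (≡.sym (ℤP.neg-involutive (wt A))))))) N))
    (λ σ {F} → X-ev0 (ℤ.- σ) {F}) X-above

  wt-⋆ : ∀ A B → wt (A SP.⋆ B) ≡ wt A ℤ.+ wt B
  wt-⋆ (m , ν) (n , μ) = ≡.trans (cong (λ v → + v ℤ.- + c ℤ.* (+ suc m ℤ.+ + suc n)) (ix-monoMul ν μ j))
    (solve 5 (λ v u c m n → (v :+ u) :- c :* (m :+ n) := (v :- c :* m) :+ (u :- c :* n)) refl (+ ix ν j) (+ ix μ j) (+ c) (+ suc m) (+ suc n))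
    where open ℤ-Solver

  wt-power : ∀ A s → wt (SP.power A s) ≡ + suc s ℤ.* wt A
  wt-power A zero    = ≡.sym (ℤP.*-identityˡ (wt A))
  wt-power A (suc s) = ≡.trans (wt-⋆ A (SP.power A s)) (≡.trans (cong (λ z → wt A ℤ.+ z) (wt-power A s))
    (solve 2 (λ w s → w :+ s :* w := (con 1ℤ :+ s) :* w) refl (wt A) (+ suc s)))
    where open ℤ-Solver

  Positive Negative Neutral : SP.Gen → Set
  Positive A = Σ ℕ λ p → wt A ≡ + suc p
  Negative A = Σ ℕ λ q → wt A ≡ -[1+ q ]
  Neutral  A = wt A ≡ 0ℤ

  -- Each reduction trades a pair of opposite weights for one generator of weight 0.
  reduce : ∀ n Ps Ns Zs → length Ps + length Ns ≤ n → All Positive Ps → All Negative Ns → All Neutral Zs →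
           ∀ {F} → SP.Killed (Ps ++ Ns ++ Zs) F → ∀ σ → SP.Rat (X σ F)
  reduce n [] Ns Zs len _ neg neu {F} k σ = subst (λ z → SP.Rat (X z F)) (ℤP.neg-involutive σ)
    (proj₂ (Nonpositive.nonneg (Ns ++ Zs) (AllP.++⁺
      (All.map (λ { (q , eq) → subst (λ w → 0ℤ ℤ.≤ ℤ.- w) (≡.sym eq) (ℤ.+≤+ z≤n) }) neg)
      (All.map (λ eq → subst (λ w → 0ℤ ℤ.≤ ℤ.- w) (≡.sym eq) ℤP.≤-refl) neu)) F k) (ℤ.- σ))
  reduce n (A ∷ Ps) [] Zs len pos _ neu {F} k σ =
    proj₂ (Nonnegative.nonneg ((A ∷ Ps) ++ Zs) (AllP.++⁺
      (All.map (λ { (p , eq) → subst (0ℤ ℤ.≤_) (≡.sym eq) (ℤ.+≤+ z≤n) }) pos)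
      (All.map (λ eq → ℤP.≤-reflexive (≡.sym eq)) neu)) F k) σ
  reduce (suc n) (A ∷ Ps) (B ∷ Ns) Zs (s≤s len) ((p , eqA) ∷ pos) ((q , eqB) ∷ neg) neu {F} k σ =
    SP.rat-cong (λ N → ≃-sym (≃-trans (X-cong σ E.elliott-sum N) (≃-trans (X-⊕ σ (λ n → E.F₁ n +ₚ E.F₂ n) E.F₃ N)
        (+ₚ-left (X σ E.F₃ N) (X-⊕ σ E.F₁ E.F₂ N)))))
      (SP.rat-⊕ (SP.rat-⊕
        (reduce n Ps Ns (AB ∷ Zs) (ℕP.≤-trans (ℕP.+-monoʳ-≤ (length Ps) (ℕP.n≤1+n _)) len) pos neg (neutral ∷ neu)
          (SP.killed-perm (into Ps) E.elliott₁) σ)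
        (reduce n (A₁ ∷ Ps) Ns (AB ∷ Zs) (subst (_≤ n) (ℕP.+-suc (length Ps) (length Ns)) len) ((_ , wtA₁) ∷ pos) neg (neutral ∷ neu)
          (SP.killed-perm (Perm.trans (Perm.swap AB A₁ Perm.refl) (Perm.prep A₁ (into Ps))) E.elliott₂) σ))
        (reduce n Ps (B₁ ∷ Ns) (AB ∷ Zs) len pos ((_ , wtB₁) ∷ neg) (neutral ∷ neu)
          (SP.killed-perm (Perm.trans (Perm.prep AB (Perm.↭-sym (PermP.shift B₁ Ps (Ns ++ Zs)))) (into′ Ps)) E.elliott₃) σ))
    where
    -- For weights p + 1 and -(q + 1), the powers A^(q+1) and B^(p+1) have opposite weights and
    -- their product is neutral. Each of the three summands keeps at least one generator of nonzero
    -- weight fewer.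
    A₁ = SP.power A q
    B₁ = SP.power B p
    AB = A₁ SP.⋆ B₁
    rest = Ps ++ Ns ++ Zs
    wtA₁ : wt A₁ ≡ + suc q ℤ.* + suc p
    wtA₁ = ≡.trans (wt-power A q) (cong (+ suc q ℤ.*_) eqA)
    wtB₁ : wt B₁ ≡ + suc p ℤ.* -[1+ q ]
    wtB₁ = ≡.trans (wt-power B p) (cong (+ suc p ℤ.*_) eqB)
    neutral : wt AB ≡ 0ℤ
    neutral = ≡.trans (wt-⋆ A₁ B₁) (≡.trans (cong₂ ℤ._+_ wtA₁ wtB₁)
      (solve 2 (λ a b → a :* b :+ b :* (:- a) := con 0ℤ) refl (+ suc q) (+ suc p)))
      where open ℤ-Solver
    open ≡ using (subst₂)
    into : ∀ Ps → AB ∷ Ps ++ Ns ++ Zs ↭ Ps ++ Ns ++ AB ∷ Zs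
    into Ps = subst₂ _↭_ (cong (AB ∷_) (LP.++-assoc Ps Ns Zs)) (LP.++-assoc Ps Ns (AB ∷ Zs)) (Perm.↭-sym (PermP.shift AB (Ps ++ Ns) Zs))
    into′ : ∀ Ps → AB ∷ Ps ++ (B₁ ∷ Ns) ++ Zs ↭ Ps ++ (B₁ ∷ Ns) ++ AB ∷ Zs
    into′ Ps = subst₂ _↭_ (cong (AB ∷_) (LP.++-assoc Ps (B₁ ∷ Ns) Zs)) (LP.++-assoc Ps (B₁ ∷ Ns) (AB ∷ Zs))
                 (Perm.↭-sym (PermP.shift AB (Ps ++ B₁ ∷ Ns) Zs))
    killed : SP.Killed (A₁ ∷ B₁ ∷ rest) F
    killed = SP.killed-perm {B₁ ∷ A₁ ∷ rest} {A₁ ∷ B₁ ∷ rest} (Perm.swap B₁ A₁ Perm.refl) {F}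
      (SP.killed-power B p (A₁ ∷ rest) {F} (SP.killed-perm {A₁ ∷ B ∷ rest} {B ∷ A₁ ∷ rest} (Perm.swap A₁ B Perm.refl) {F}
      (SP.killed-power A q (B ∷ rest) {F} (SP.killed-perm {A ∷ Ps ++ B ∷ Ns ++ Zs} {A ∷ B ∷ rest} (Perm.prep A (PermP.shift B Ps (Ns ++ Zs))) {F} k))))
    module E = SP.Elliott A₁ B₁ rest {F} killed

  classify : ∀ As → Σ (List SP.Gen) λ Ps → Σ (List SP.Gen) λ Ns → Σ (List SP.Gen) λ Zs →
             As ↭ Ps ++ Ns ++ Zs × All Positive Ps × All Negative Ns × All Neutral Zs
  classify [] = [] , [] , [] , Perm.refl , [] , [] , []
  classify (A ∷ As) with classify As | wt A in eq
  ... | Ps , Ns , Zs , perm , pos , neg , neu | + zero = Ps , Ns , A ∷ Zs ,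
    Perm.trans (Perm.prep A (Perm.trans perm (Perm.↭-reflexive (≡.sym (LP.++-assoc Ps Ns Zs)))))
      (Perm.trans (Perm.↭-sym (PermP.shift A (Ps ++ Ns) Zs)) (Perm.↭-reflexive (LP.++-assoc Ps Ns (A ∷ Zs)))) , pos , neg , eq ∷ neu
  ... | Ps , Ns , Zs , perm , pos , neg , neu | + suc p = A ∷ Ps , Ns , Zs , Perm.prep A perm , (p , eq) ∷ pos , neg , neu
  ... | Ps , Ns , Zs , perm , pos , neg , neu | -[1+ q ] = Ps , A ∷ Ns , Zs ,
    Perm.trans (Perm.prep A perm) (Perm.↭-sym (PermP.shift A Ps (Ns ++ Zs))) , pos , (q , eq) ∷ neg , neu

  rat-extract : ∀ F → SP.Rat F → ∀ σ → SP.Rat (X σ F)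
  rat-extract F (As , k) = let Ps , Ns , Zs , perm , pos , neg , neu = classify As in
    reduce (length Ps + length Ns) Ps Ns Zs ℕP.≤-refl pos neg neu {F} (SP.killed-perm perm {F} k)

-- Functionals and the coinvariant algebra

record Functional : Set where
  field
    app      : Poly → ℤ
    app-cong : ∀ {p q} → p ≃ q → app p ≡ app q
    app-+    : ∀ p q → app (p +ₚ q) ≡ app p ℤ.+ app q
    app-·    : ∀ k p → app (k ·ₚ p) ≡ k ℤ.* app p
open Functional

app-0 : ∀ Φ → app Φ [] ≡ 0ℤ
app-0 Φ = app-· Φ 0ℤ []

app-sub : ∀ Φ p q → app Φ (p -ₚ q) ≡ app Φ p ℤ.- app Φ q
app-sub Φ p q = ≡.trans (app-+ Φ p (-ₚ q)) (cong (λ z → app Φ p ℤ.+ z) (≡.trans (app-· Φ ℤ.-1ℤ q) (ℤP.-1*i≡-i _)))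

app-pair : ∀ Φ p → app Φ p ≡ pair (λ a → app Φ (mono a)) p
app-pair Φ []            = app-0 Φ
app-pair Φ ((a , k) ∷ p) = begin
  app Φ ((a , k) ∷ p)                       ≡⟨ cong (λ z → app Φ ((a , z) ∷ p)) (ℤP.*-identityʳ k) ⟨
  app Φ ((k ·ₚ mono a) +ₚ p)                ≡⟨ app-+ Φ (k ·ₚ mono a) p ⟩
  app Φ (k ·ₚ mono a) ℤ.+ app Φ p           ≡⟨ cong₂ ℤ._+_ (app-· Φ k (mono a)) (app-pair Φ p) ⟩
  k ℤ.* app Φ (mono a) ℤ.+ pair (λ a → app Φ (mono a)) p ∎
  where open ≡.≡-Reasoning

app-resp : ∀ Φ → Resp (λ a → app Φ (mono a))
app-resp Φ eq = app-cong Φ (mono-cong eq)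

fromPair : ∀ L → Resp L → Functional
fromPair L r = record { app = pair L ; app-cong = λ eq → pair-≡ eq L r ; app-+ = pair-++ L ; app-· = pair-· L }

ε : Functional
ε = fromPair (δ []) (δ-resp [])

D : ℕ → Functional → Functional
D i Φ = record
  { app      = λ p → app Φ (∂ i p)
  ; app-cong = λ eq → app-cong Φ (∂-cong i eq)
  ; app-+    = λ p q → ≡.trans (app-cong Φ (∂-+ i p q)) (app-+ Φ (∂ i p) (∂ i q))
  ; app-·    = λ k p → ≡.trans (app-cong Φ (∂-· i k p)) (app-· Φ k (∂ i p)) }

-- The functional p ↦ Φ(∂_{j+d-1} ... ∂_j p), in which ∂_j acts first.
Dpow : ℕ → ℕ → Functional → Functional
Dpow j zero    Φ = Φ
Dpow j (suc d) Φ = D j (Dpow (suc j) d Φ)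

-- sE j r is (-1)^r times the r-th elementary symmetric polynomial of the first j variables.
sE : ℕ → ℕ → Poly
sE j       zero    = mono []
sE zero    (suc r) = []
sE (suc j) (suc r) = sE j (suc r) -ₚ (x̂ j *ₚ sE j r)

sE-high : ∀ j r → j < r → sE j r ≃ []
sE-high zero    (suc r) lt       = ≃-refl
sE-high (suc j) (suc r) (s≤s lt) = ≃-trans
  (-ₚ-cong₂ (sE-high j (suc r) (ℕP.m≤n⇒m≤1+n lt)) (≃-trans (*ₚ-right (x̂ j) (sE-high j r lt)) (P.zeroʳ (x̂ j)))) ≃-refl

sw-x-other : ∀ i j → i ≢ j → suc i ≢ j → sw i (x̂ j) ≃ x̂ j
sw-x-other i j ne ne′ = mono-cong (repl-≋ i (e j) (e j)
  (≡.trans (ix-e-other j (suc i) (ne′ ∘ ≡.sym)) (≡.sym (ix-e-other j i (ne ∘ ≡.sym))))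
  (≡.trans (ix-e-other j i (ne ∘ ≡.sym)) (≡.sym (ix-e-other j (suc i) (ne′ ∘ ≡.sym)))) (λ _ _ _ → refl))

sw-sE-step : ∀ i j r → sw i (sE j (suc r)) ≃ sE j (suc r) → sw i (sE j r) ≃ sE j r → i ≢ j → suc i ≢ j →
             sw i (sE (suc j) (suc r)) ≃ sE (suc j) (suc r)
sw-sE-step i j r eq eq′ ne ne′ = ≃-trans (sw-sub i (sE j (suc r)) (x̂ j *ₚ sE j r))
  (-ₚ-cong₂ eq (≃-trans (sw-* i (x̂ j) (sE j r)) (*ₚ-cong (sw-x-other i j ne ne′) eq′)))

sw-sE-below : ∀ i j r → j ≤ i → sw i (sE j r) ≃ sE j r
sw-sE-below i j       zero    le = mono-cong (repl-≋ i [] [] refl refl (λ _ _ _ → refl))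
sw-sE-below i zero    (suc r) le = ≃-refl
sw-sE-below i (suc j) (suc r) le = sw-sE-step i j r (sw-sE-below i j (suc r) (ℕP.<⇒≤ le)) (sw-sE-below i j r (ℕP.<⇒≤ le))
  (λ { refl → ℕP.<-irrefl refl le }) (λ { refl → ℕP.<-irrefl refl (ℕP.<-trans (ℕP.n<1+n _) le) })

-- The last two variables enter only through their sum and product, which exhibits the invariance
-- under s_i.
sE-pair : ∀ i r → sE (suc (suc i)) (suc (suc r))
                ≃ (sE i (suc (suc r)) -ₚ ((x̂ i +ₚ x̂ (suc i)) *ₚ sE i (suc r))) +ₚ ((x̂ i *ₚ x̂ (suc i)) *ₚ sE i r)
sE-pair i r = solveₚ 5 (λ a b c x x′ → (a PS.:- x PS.:* b) PS.:- x′ PS.:* (b PS.:- x PS.:* c)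
                                     :≃ (a PS.:- (x PS.:+ x′) PS.:* b) PS.:+ (x PS.:* x′) PS.:* c)
                ≃-refl (sE i (suc (suc r))) (sE i (suc r)) (sE i r) (x̂ i) (x̂ (suc i))

sE-pair₁ : ∀ i → sE (suc (suc i)) 1 ≃ sE i 1 -ₚ ((x̂ i +ₚ x̂ (suc i)) *ₚ mono [])
sE-pair₁ i = solveₚ 4 (λ a b x x′ → (a PS.:- x PS.:* b) PS.:- x′ PS.:* b :≃ a PS.:- (x PS.:+ x′) PS.:* b)
               ≃-refl (sE i 1) (mono []) (x̂ i) (x̂ (suc i))

sw-sum : ∀ i → sw i (x̂ i +ₚ x̂ (suc i)) ≃ x̂ i +ₚ x̂ (suc i)
sw-sum i = ≃-trans (sw-+ i (x̂ i) (x̂ (suc i))) (≃-trans (+ₚ-cong (sw-x-i i) (sw-x-si i)) (+ₚ-comm (x̂ (suc i)) (x̂ i)))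

sw-prod : ∀ i → sw i (x̂ i *ₚ x̂ (suc i)) ≃ x̂ i *ₚ x̂ (suc i)
sw-prod i = ≃-trans (sw-* i (x̂ i) (x̂ (suc i))) (≃-trans (*ₚ-cong (sw-x-i i) (sw-x-si i)) (*ₚ-comm (x̂ (suc i)) (x̂ i)))

sw-sE-pair : ∀ i r → sw i (sE (suc (suc i)) r) ≃ sE (suc (suc i)) r
sw-sE-pair i zero          = sw-sE-below i 0 0 z≤n
sw-sE-pair i (suc zero)    = ≃-trans (sw-cong i (sE-pair₁ i)) (≃-trans (≃-trans
  (sw-sub i (sE i 1) ((x̂ i +ₚ x̂ (suc i)) *ₚ mono []))
  (-ₚ-cong₂ (sw-sE-below i i 1 ℕP.≤-refl) (≃-trans (sw-* i (x̂ i +ₚ x̂ (suc i)) (mono []))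
    (*ₚ-cong (sw-sum i) (sw-sE-below i 0 0 z≤n))))) (≃-sym (sE-pair₁ i)))
sw-sE-pair i (suc (suc r)) = ≃-trans (sw-cong i (sE-pair i r)) (≃-trans (≃-trans
  (sw-+ i (sE i (suc (suc r)) -ₚ ((x̂ i +ₚ x̂ (suc i)) *ₚ sE i (suc r))) ((x̂ i *ₚ x̂ (suc i)) *ₚ sE i r))
  (+ₚ-cong (≃-trans (sw-sub i (sE i (suc (suc r))) ((x̂ i +ₚ x̂ (suc i)) *ₚ sE i (suc r)))
      (-ₚ-cong₂ (sw-sE-below i i (suc (suc r)) ℕP.≤-refl) (≃-trans (sw-* i (x̂ i +ₚ x̂ (suc i)) (sE i (suc r)))
        (*ₚ-cong (sw-sum i) (sw-sE-below i i (suc r) ℕP.≤-refl)))))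
    (≃-trans (sw-* i (x̂ i *ₚ x̂ (suc i)) (sE i r)) (*ₚ-cong (sw-prod i) (sw-sE-below i i r ℕP.≤-refl))))) (≃-sym (sE-pair i r)))

sw-sE : ∀ i K r → suc i < K → sw i (sE K r) ≃ sE K r
sw-sE i (suc K) zero    lt = sw-sE-below i 0 0 z≤n
sw-sE i (suc K) (suc r) (s≤s lt) with ℕP.m≤n⇒m<n∨m≡n lt
... | inj₂ refl = sw-sE-pair i (suc r)
... | inj₁ lt′  = sw-sE-step i K r (sw-sE i K (suc r) lt′) (sw-sE i K r lt′)
  (λ { refl → ℕP.<-irrefl refl (ℕP.<-trans (ℕP.n<1+n i) lt′) }) (λ { refl → ℕP.<-irrefl refl lt′ })

-- Φ factors through the coinvariants of the symmetric group on the first K variables.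
CoInv : ℕ → Functional → Set
CoInv K Φ = ∀ r f → app Φ (sE K (suc r) *ₚ f) ≡ 0ℤ

sum-0 : ∀ a → sum a ≡ 0 → a ≋ []
sum-0 a eq = eqv (go a eq)
  where
  go : ∀ a → sum a ≡ 0 → ∀ i → ix a i ≡ 0
  go []         eq i       = refl
  go (zero ∷ a) eq zero    = refl
  go (zero ∷ a) eq (suc i) = go a eq i

0-sum : ∀ a → a ≋ [] → sum a ≡ 0
0-sum []      eq = refl
0-sum (x ∷ a) eq = cong₂ _+_ (ix≡ eq 0) (0-sum a (eqv (λ i → ix≡ eq (suc i))))

δ-yes : ∀ m {a} → a ≋ m → δ m a ≡ 1ℤ
δ-yes m {a} eq with LP.≡-dec ℕ._≟_ (stripZeros a) (stripZeros m)
... | yes _ = refl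
... | no ne = ⊥-elim (ne (stripZeros-≋ eq))

δ-no : ∀ m {a} → ¬ a ≋ m → δ m a ≡ 0ℤ
δ-no m {a} ne with LP.≡-dec ℕ._≟_ (stripZeros a) (stripZeros m)
... | yes eq = ⊥-elim (ne (≋-stripZeros {a} {m} eq))
... | no _   = refl

ε-x* : ∀ j f → app ε (x̂ j *ₚ f) ≡ 0ℤ
ε-x* j f = ≡.trans (pair-mono* (δ []) (e j) f) (≡.trans (pair-cong (λ b → δ-no [] (positive b)) f) (pair-0ᴸ f))
  where
  positive : ∀ b → ¬ monoMul (e j) b ≋ []
  positive b eq with ≡.trans (≡.sym (e*-same j b)) (ix≡ eq j)
  ... | ()

coInv-ε : ∀ K → CoInv K ε
coInv-ε zero    r f = refl
coInv-ε (suc K) r f = ≡.trans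
  (app-cong ε (solveₚ 4 (λ a x b f → (a PS.:- x PS.:* b) PS.:* f :≃ a PS.:* f PS.:- x PS.:* (b PS.:* f)) ≃-refl (sE K (suc r)) (x̂ K) (sE K r) f))
  (≡.trans (app-sub ε (sE K (suc r) *ₚ f) (x̂ K *ₚ (sE K r *ₚ f)))
    (cong₂ ℤ._-_ (coInv-ε K r f) (ε-x* K (sE K r *ₚ f))))

-- ∂_i is linear over polynomials symmetric in x_i and x_{i+1}, such as `sE K r` when i + 1 < K.
coInv-D : ∀ {K} i Φ → suc i < K → CoInv K Φ → CoInv K (D i Φ)
coInv-D {K} i Φ lt inv r f = ≡.trans (app-cong Φ (∂-linear i (sE K (suc r)) f (sw-sE i K (suc r) lt))) (inv r (∂ i f))

coInv-Dpow : ∀ {K} k m Φ → k + m < K → CoInv K Φ → CoInv K (Dpow k m Φ)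
coInv-Dpow k zero    Φ lt inv = inv
coInv-Dpow {K} k (suc m) Φ lt inv = coInv-D k (Dpow (suc k) m Φ) (ℕP.≤-<-trans (s≤s (ℕP.m≤m+n k m)) lt′) (coInv-Dpow (suc k) m Φ lt′ inv)
  where
  lt′ : suc k + m < K
  lt′ = subst (_< K) (ℕP.+-suc k m) lt

-- shE j d a is sE j (a - d), read as 0 for a < d.
shE : ℕ → ℕ → ℕ → Poly
shE j zero    a       = sE j a
shE j (suc d) zero    = []
shE j (suc d) (suc a) = shE j d a

shE-rec : ∀ j d a → shE (suc j) d a ≃ shE j d a -ₚ (x̂ j *ₚ shE j (suc d) a)
shE-rec j zero    zero    = ≃-sym (≃-trans (-ₚ-right (mono []) (P.zeroʳ (x̂ j))) ≃-refl)
shE-rec j zero    (suc a) = ≃-refl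
shE-rec j (suc d) zero    = ≃-sym (≃-trans (-ₚ-right [] (P.zeroʳ (x̂ j))) ≃-refl)
shE-rec j (suc d) (suc a) = shE-rec j d a

pow : ℕ → ℕ → Poly
pow j zero    = mono []
pow j (suc a) = x̂ j *ₚ pow j a

sw-pow : ∀ j a → sw j (pow j a) ≃ pow (suc j) a
sw-pow j zero    = sw-sE-below j 0 0 z≤n
sw-pow j (suc a) = ≃-trans (sw-* j (x̂ j) (pow j a)) (*ₚ-cong (sw-x-i j) (sw-pow j a))

∂-pow : ∀ j a → ∂ j (pow j (suc a)) ≃ (x̂ j *ₚ ∂ j (pow j a)) +ₚ pow (suc j) a
∂-pow j a = begin
  ∂ j (x̂ j *ₚ pow j a) ≈⟨ ∂-cong j (*ₚ-comm (x̂ j) (pow j a)) ⟩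
  ∂ j (pow j a *ₚ x̂ j)                                      ≈⟨ ∂-leibniz j (pow j a) (x̂ j) ⟩
  (∂ j (pow j a) *ₚ x̂ j) +ₚ (sw j (pow j a) *ₚ ∂ j (x̂ j)) ≈⟨ +ₚ-cong (*ₚ-comm (∂ j (pow j a)) (x̂ j)) (*ₚ-cong (sw-pow j a) (∂-x j)) ⟩
  (x̂ j *ₚ ∂ j (pow j a)) +ₚ (pow (suc j) a *ₚ mono []) ≈⟨ +ₚ-right (x̂ j *ₚ ∂ j (pow j a)) (P.*-identityʳ (pow (suc j) a)) ⟩
  (x̂ j *ₚ ∂ j (pow j a)) +ₚ pow (suc j) a                   ∎
  where open SetoidReasoning P.setoid

InvFrom : ℕ → Poly → Set
InvFrom j q = ∀ i → j ≤ i → sw i q ≃ q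

-- The recursion x_j ∂(x_j^a) + x_{j+1}^a = ∂(x_j^{a+1}) telescopes against shE-rec.
Dpow-pow : ∀ d j K Φ → K ≡ suc (j + d) → CoInv K Φ → ∀ q → InvFrom j q → ∀ a →
           app (Dpow j d Φ) (q *ₚ pow j a) ≡ app Φ (q *ₚ shE j d a)
Dpow-pow zero j K Φ refl inv q _ a rewrite ℕP.+-identityʳ j = go a q
  where
  -- No operator is left. Φ kills multiples of sE (j+1) (a+1) = sE j (a+1) - x_j sE j a, so x_j sE j
  -- a may be replaced by sE j (a+1).
  go : ∀ a q → app Φ (q *ₚ pow j a) ≡ app Φ (q *ₚ sE j a)
  go zero    q = refl
  go (suc a) q = begin
    app Φ (q *ₚ (x̂ j *ₚ pow j a))             ≡⟨ app-cong Φ (P.*-assoc q (x̂ j) (pow j a)) ⟨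
    app Φ ((q *ₚ x̂ j) *ₚ pow j a)             ≡⟨ go a (q *ₚ x̂ j) ⟩
    app Φ ((q *ₚ x̂ j) *ₚ sE j a)
      ≡⟨ app-cong Φ (solveₚ 4 (λ q x a b → (q PS.:* x) PS.:* a :≃ q PS.:* b PS.:- (b PS.:- x PS.:* a) PS.:* q) ≃-refl
           q (x̂ j) (sE j a) (sE j (suc a))) ⟩
    app Φ ((q *ₚ sE j (suc a)) -ₚ (sE (suc j) (suc a) *ₚ q)) ≡⟨ app-sub Φ (q *ₚ sE j (suc a)) (sE (suc j) (suc a) *ₚ q) ⟩
    app Φ (q *ₚ sE j (suc a)) ℤ.- app Φ (sE (suc j) (suc a) *ₚ q) ≡⟨ cong (λ z → app Φ (q *ₚ sE j (suc a)) ℤ.- z) (inv a q) ⟩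
    app Φ (q *ₚ sE j (suc a)) ℤ.- 0ℤ          ≡⟨ ℤP.+-identityʳ _ ⟩
    app Φ (q *ₚ sE j (suc a))                 ∎
    where open ≡.≡-Reasoning
-- Pulling q out of ∂_j uses its invariance under s_j; afterwards invariance from j + 1 on is
-- enough, so q may absorb factors x_j.
Dpow-pow (suc d) j K Φ eq inv q iq a = ≡.trans (app-cong Ψ (∂-linear j q (pow j a) (iq j ℕP.≤-refl)))
  (go a q (λ i le → iq i (ℕP.<⇒≤ le)))
  where
  Ψ = Dpow (suc j) d Φ
  go : ∀ a q → InvFrom (suc j) q → app Ψ (q *ₚ ∂ j (pow j a)) ≡ app Φ (q *ₚ shE j (suc d) a)
  go zero    q iq = ≡.trans (app-cong Ψ (≃-trans (*ₚ-right q (∂-0 j (sw-pow j 0))) (P.zeroʳ q)))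
    (≡.trans (app-0 Ψ) (≡.sym (≡.trans (app-cong Φ (P.zeroʳ q)) (app-0 Φ))))
  go (suc a) q iq = begin
    app Ψ (q *ₚ ∂ j (pow j (suc a)))
      ≡⟨ app-cong Ψ (≃-trans (*ₚ-right q (∂-pow j a)) (solveₚ 4 (λ q x d p → q PS.:* (x PS.:* d PS.:+ p) :≃ (q PS.:* x) PS.:* d PS.:+ q PS.:* p)
           ≃-refl q (x̂ j) (∂ j (pow j a)) (pow (suc j) a))) ⟩
    app Ψ (((q *ₚ x̂ j) *ₚ ∂ j (pow j a)) +ₚ (q *ₚ pow (suc j) a))
      ≡⟨ app-+ Ψ ((q *ₚ x̂ j) *ₚ ∂ j (pow j a)) (q *ₚ pow (suc j) a) ⟩
    app Ψ ((q *ₚ x̂ j) *ₚ ∂ j (pow j a)) ℤ.+ app Ψ (q *ₚ pow (suc j) a)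
      ≡⟨ cong₂ ℤ._+_ (go a (q *ₚ x̂ j) inv-qx) (Dpow-pow d (suc j) K Φ (≡.trans eq (cong suc (ℕP.+-suc j d))) inv q iq a) ⟩
    app Φ ((q *ₚ x̂ j) *ₚ shE j (suc d) a) ℤ.+ app Φ (q *ₚ shE (suc j) d a)
      ≡⟨ app-+ Φ ((q *ₚ x̂ j) *ₚ shE j (suc d) a) (q *ₚ shE (suc j) d a) ⟨
    app Φ (((q *ₚ x̂ j) *ₚ shE j (suc d) a) +ₚ (q *ₚ shE (suc j) d a))
      ≡⟨ app-cong Φ (≃-trans (+ₚ-right ((q *ₚ x̂ j) *ₚ shE j (suc d) a) (*ₚ-right q (shE-rec j d a)))
           (solveₚ 4 (λ q x s t → (q PS.:* x) PS.:* s PS.:+ q PS.:* (t PS.:- x PS.:* s) :≃ q PS.:* t) ≃-refl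
             q (x̂ j) (shE j (suc d) a) (shE j d a))) ⟩
    app Φ (q *ₚ shE j d a) ∎
    where
    open ≡.≡-Reasoning
    inv-qx : InvFrom (suc j) (q *ₚ x̂ j)
    inv-qx i le = ≃-trans (sw-* i q (x̂ j)) (*ₚ-cong (iq i le)
      (sw-x-other i j (λ { refl → ℕP.<-irrefl refl le }) (λ { refl → ℕP.<-irrefl refl (ℕP.<-trans (ℕP.n<1+n _) le) })))

-- Under a coinvariant functional, the block ∂_{k+m-1} ... ∂_k turns x_k^a into (-1)^(a-m) e_{a-m}
-- of the earlier variables, read as 0 for a < m.
peelMono : ℕ → ℕ → Mono → Poly
peelMono k m b = mono (put b k 0) *ₚ shE k m (ix b k)

peel : ℕ → ℕ → Poly → Poly
peel k m = lift (peelMono k m)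

peelMono-cong : ∀ k m {a b} → a ≋ b → peelMono k m a ≃ peelMono k m b
peelMono-cong k m {a} {b} eq = *ₚ-cong (mono-cong (put-cong k 0 eq)) (≡⇒≃ (cong (shE k m) (ix≡ eq k)))

pow-mono : ∀ k a → pow k a ≃ mono (put [] k a)
pow-mono k zero    = mono-cong (eqv zeros)
  where
  zeros : ∀ i → 0 ≡ ix (put [] k 0) i
  zeros i with k ℕ.≟ i
  ... | yes refl = ≡.sym (ix-put-same [] k 0)
  ... | no ne    = ≡.sym (ix-put-other [] k i 0 ne)
pow-mono k (suc a) = ≃-trans (*ₚ-right (x̂ k) (pow-mono k a)) (≃-trans (≃-sym (mono-* (e k) (put [] k a))) (mono-cong (eqv step)))
  where
  step : ∀ i → ix (monoMul (e k) (put [] k a)) i ≡ ix (put [] k (suc a)) i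
  step i with k ℕ.≟ i
  ... | yes refl = ≡.trans (e*-same k (put [] k a)) (≡.trans (cong suc (ix-put-same [] k a)) (≡.sym (ix-put-same [] k (suc a))))
  ... | no ne = ≡.trans (e*-other k (put [] k a) i ne) (≡.trans (ix-put-other [] k i a ne) (≡.sym (ix-put-other [] k i (suc a) ne)))

mono-split : ∀ k b → mono b ≃ mono (put b k 0) *ₚ pow k (ix b k)
mono-split k b = ≃-sym (≃-trans (*ₚ-right (mono (put b k 0)) (pow-mono k (ix b k)))
  (≃-trans (≃-sym (mono-* (put b k 0) (put [] k (ix b k)))) (mono-cong (eqv join))))
  where
  join : ∀ i → ix (monoMul (put b k 0) (put [] k (ix b k))) i ≡ ix b i
  join i with k ℕ.≟ i
  ... | yes refl = ≡.trans (ix-monoMul (put b k 0) (put [] k (ix b k)) k) (cong₂ _+_ (ix-put-same b k 0) (ix-put-same [] k (ix b k)))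
  ... | no ne    = ≡.trans (ix-monoMul (put b k 0) (put [] k (ix b k)) i)
    (≡.trans (cong₂ _+_ (ix-put-other b k i 0 ne) (ix-put-other [] k i (ix b k) ne)) (ℕP.+-identityʳ _))

vars-put : ∀ {k} b → Vars (suc k) b → Vars k (put b k 0)
vars-put {k} b vb i le with ℕP.m≤n⇒m<n∨m≡n le
... | inj₁ lt   = ≡.trans (ix-put-other b k i 0 (ℕP.<⇒≢ lt)) (vb i lt)
... | inj₂ refl = ix-put-same b k 0

vars-inv : ∀ {k} b → Vars k b → InvFrom k (mono b)
vars-inv b vb i le = mono-cong (repl-≋ i b b (≡.trans (vb (suc i) (ℕP.m≤n⇒m≤1+n le)) (≡.sym (vb i le)))
  (≡.trans (vb i le) (≡.sym (vb (suc i) (ℕP.m≤n⇒m≤1+n le)))) (λ _ _ _ → refl))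

-- A monomial in the first k + 1 variables is x_k^a times a factor in the earlier ones. That factor
-- is fixed by s_i for i ≥ k and passes through the whole block.
Dpow-peel : ∀ k m Φ → CoInv (suc (k + m)) Φ → ∀ A → Supp (Vars (suc k)) A → app (Dpow k m Φ) A ≡ app Φ (peel k m A)
Dpow-peel k m Φ inv A s = begin
  app (Dpow k m Φ) A                               ≡⟨ app-pair (Dpow k m Φ) A ⟩
  pair (λ b → app (Dpow k m Φ) (mono b)) A
    ≡⟨ s _ _ (app-resp (Dpow k m Φ)) (λ eq → app-cong Φ (peelMono-cong k m eq)) (λ b vb → ≡.trans
         (app-cong (Dpow k m Φ) (mono-split k b))
         (Dpow-pow m k _ Φ refl inv (mono (put b k 0)) (vars-inv (put b k 0) (vars-put b vb)) (ix b k))) ⟩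
  pair (λ b → app Φ (peelMono k m b)) A ≡⟨ pair-cong (λ b → app-pair Φ (peelMono k m b)) A ⟩
  pair (λ b → pair (λ a → app Φ (mono a)) (peelMono k m b)) A ≡⟨ pair-lift (λ a → app Φ (mono a)) (peelMono k m) A ⟨
  pair (λ a → app Φ (mono a)) (peel k m A)         ≡⟨ app-pair Φ (peel k m A) ⟨
  app Φ (peel k m A)                               ∎
  where open ≡.≡-Reasoning

supp-sE : ∀ j r → Supp (Vars j) (sE j r)
supp-sE j       zero    = supp-mono {Vars j} {[]} (λ _ _ → refl)
supp-sE zero    (suc r) = supp-0 {Vars 0}
supp-sE (suc j) (suc r) = supp-sub {Vars (suc j)} {sE j (suc r)} {x̂ j *ₚ sE j r} (widen (sE j (suc r)) (supp-sE j (suc r)))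
  (supp-* {Vars (suc j)} {Vars (suc j)} {Vars (suc j)} vars-monoMul {x̂ j} {sE j r}
    (supp-mono {Vars (suc j)} {e j} (λ i le → ix-e-other j i (ℕP.<⇒≢ le))) (widen (sE j r) (supp-sE j r)))
  where
  widen : ∀ p → Supp (Vars j) p → Supp (Vars (suc j)) p
  widen p s L L′ r r′ ag = s L L′ r r′ (λ a va → ag a (λ i le → va i (ℕP.<⇒≤ le)))

supp-shE : ∀ j d a → Supp (Vars j) (shE j d a)
supp-shE j zero    a       = supp-sE j a
supp-shE j (suc d) zero    = supp-0 {Vars j}
supp-shE j (suc d) (suc a) = supp-shE j d a

supp-peel : ∀ k m {A} → Supp (Vars (suc k)) A → Supp (Vars k) (peel k m A)
supp-peel k m {A} = supp-lift {Vars (suc k)} {Vars k} (peelMono k m) (peelMono-cong k m)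
  (λ b vb → supp-* {Vars k} {Vars k} {Vars k} vars-monoMul {mono (put b k 0)} {shE k m (ix b k)}
    (supp-mono {Vars k} (vars-put b vb)) (supp-shE k m (ix b k))) {A}

sumₙ : ℕ → (ℕ → Poly) → Poly
sumₙ zero    f = []
sumₙ (suc n) f = sumₙ n f +ₚ f n

sumₙ-cong : ∀ n {f g} → (∀ r → f r ≃ g r) → sumₙ n f ≃ sumₙ n g
sumₙ-cong zero    eq = ≃-refl
sumₙ-cong (suc n) eq = +ₚ-cong (sumₙ-cong n eq) (eq n)

lift-add : ∀ g h p → lift (λ a → g a +ₚ h a) p ≃ lift g p +ₚ lift h p
lift-add g h p = mk λ L r → begin
  pair L (lift (λ a → g a +ₚ h a) p)                  ≡⟨ pair-lift L _ p ⟩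
  pair (λ a → pair L (g a +ₚ h a)) p                  ≡⟨ pair-cong (λ a → pair-++ L (g a) (h a)) p ⟩
  pair (λ a → pair L (g a) ℤ.+ pair L (h a)) p        ≡⟨ pair-+ᴸ _ _ p ⟩
  pair (λ a → pair L (g a)) p ℤ.+ pair (λ a → pair L (h a)) p ≡⟨ cong₂ ℤ._+_ (pair-lift L g p) (pair-lift L h p) ⟨
  pair L (lift g p) ℤ.+ pair L (lift h p)             ≡⟨ pair-++ L (lift g p) (lift h p) ⟨
  pair L (lift g p +ₚ lift h p)                       ∎
  where open ≡.≡-Reasoning

lift-0 : ∀ p → lift (λ _ → []) p ≃ []
lift-0 p = mk λ L r → ≡.trans (pair-lift L (λ _ → []) p) (pair-0ᴸ p)

lift-sumₙ : ∀ n (g : ℕ → Mono → Poly) p → lift (λ a → sumₙ n (λ r → g r a)) p ≃ sumₙ n (λ r → lift (g r) p)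
lift-sumₙ zero    g p = lift-0 p
lift-sumₙ (suc n) g p = ≃-trans (lift-add (λ a → sumₙ n (λ r → g r a)) (g n) p) (+ₚ-left (lift (g n) p) (lift-sumₙ n g p))

pick : ℕ → ℕ → Poly → Poly
pick a t M = if does (a ℕ.≟ t) then M else []

pick-same : ∀ {a t} M → a ≡ t → pick a t M ≡ M
pick-same {a} {t} M eq = cong (λ b → if b then M else []) (dec-true (a ℕ.≟ t) eq)

pick-other : ∀ {a t} M → a ≢ t → pick a t M ≡ []
pick-other {a} {t} M ne = cong (λ b → if b then M else []) (dec-false (a ℕ.≟ t) ne)

sum-pick-none : ∀ n (f : ℕ → Poly) a M → n ≤ a → sumₙ n (λ r → f r *ₚ pick a r M) ≃ []
sum-pick-none zero    f a M le = ≃-refl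
sum-pick-none (suc n) f a M le = ≃-trans (+ₚ-cong (sum-pick-none n f a M (ℕP.<⇒≤ le))
  (≃-trans (≡⇒≃ (cong (f n *ₚ_) (pick-other {a} {n} M (λ { refl → ℕP.<-irrefl refl le })))) (P.zeroʳ (f n)))) ≃-refl

sum-pick : ∀ n (f : ℕ → Poly) a M → a < n → sumₙ n (λ r → f r *ₚ pick a r M) ≃ f a *ₚ M
sum-pick (suc n) f a M (s≤s le) with ℕP.m≤n⇒m<n∨m≡n le
... | inj₁ lt   = ≃-trans (+ₚ-cong (sum-pick n f a M lt) (≃-trans
    (≡⇒≃ (cong (f n *ₚ_) (pick-other {a} {n} M (ℕP.<⇒≢ lt)))) (P.zeroʳ (f n)))) (P.+-identityʳ (f a *ₚ M))
... | inj₂ refl = +ₚ-cong (sum-pick-none n f a M ℕP.≤-refl) (≡⇒≃ (cong (f a *ₚ_) (pick-same {a} {a} M refl)))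

shE-sum : ∀ k m a M → shE k m a *ₚ M ≃ sumₙ (suc k) (λ r → sE k r *ₚ pick a (m + r) M)
shE-sum k (suc m) zero    M = ≃-sym (vanish (suc k))
  where
  vanish : ∀ n → sumₙ n (λ r → sE k r *ₚ []) ≃ []
  vanish zero    = ≃-refl
  vanish (suc n) = ≃-trans (+ₚ-cong (vanish n) (P.zeroʳ (sE k n))) ≃-refl
shE-sum k (suc m) (suc a) M = shE-sum k m a M
shE-sum k zero    a       M with a <? suc k
... | yes lt = ≃-sym (sum-pick (suc k) (sE k) a M lt)
... | no nlt = ≃-trans (*ₚ-left M (sE-high k a (ℕP.≮⇒≥ nlt))) (≃-sym (sum-pick-none (suc k) (sE k) a M (ℕP.≮⇒≥ nlt)))

extract-pick : ∀ k t b → extract k (+ t) b ≡ pick (ix b k) t (mono (put b k 0))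
extract-pick k t b with ix b k ℕ.≟ t
... | yes eq = ≡.trans (extract-yes k b (cong (+_) eq)) (≡.sym (pick-same {ix b k} (mono (put b k 0)) eq))
... | no ne = ≡.trans (extract-no k b (ne ∘ ℤP.+-injective)) (≡.sym (pick-other {ix b k} (mono (put b k 0)) ne))

-- In k variables e_r vanishes for r > k, so k + 1 extractions suffice whatever m is. Along a family
-- of codes `peel` is therefore a finite sum of fixed length.
peel-sum : ∀ k m p → peel k m p ≃ sumₙ (suc k) (λ r → sE k r *ₚ ext k (+ (m + r)) p)
peel-sum k m p = begin
  lift (peelMono k m) p
    ≈⟨ lift-ext (λ b → ≃-trans (*ₚ-comm (mono (put b k 0)) (shE k m (ix b k))) (≃-trans (shE-sum k m (ix b k) (mono (put b k 0)))
         (sumₙ-cong (suc k) (λ r → ≡⇒≃ (cong (sE k r *ₚ_) (≡.sym (extract-pick k (m + r) b))))))) p ⟩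
  lift (λ b → sumₙ (suc k) (λ r → sE k r *ₚ extract k (+ (m + r)) b)) p
    ≈⟨ lift-sumₙ (suc k) (λ r b → sE k r *ₚ extract k (+ (m + r)) b) p ⟩
  sumₙ (suc k) (λ r → lift (λ b → sE k r *ₚ extract k (+ (m + r)) b) p)
    ≈⟨ sumₙ-cong (suc k) (λ r → lift-* (extract k (+ (m + r))) (sE k r) p) ⟩
  sumₙ (suc k) (λ r → sE k r *ₚ ext k (+ (m + r)) p) ∎
  where open SetoidReasoning P.setoid

lin-affine : ∀ m r → Σ ℤ λ σ → ∀ N → from m ≤ N → + (val m N + r) ≡ + slope m ℤ.* + N ℤ.+ σ
lin-affine m r = (+ val m M ℤ.+ + r) ℤ.- + slope m ℤ.* + M , λ N le → begin
  + (val m N + r) ≡⟨ cong (λ n → + (val m n + r)) (ℕP.m∸n+n≡m le) ⟨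
  + (val m (N ∸ M + M) + r) ≡⟨ cong (λ v → + (v + r)) (lin-at m M ℕP.≤-refl (N ∸ M)) ⟩
  + ((N ∸ M) * slope m + val m M) ℤ.+ + r ≡⟨ cong (λ z → (z ℤ.+ + val m M) ℤ.+ + r) (ℤP.pos-* (N ∸ M) (slope m)) ⟩
  (+ (N ∸ M) ℤ.* + slope m ℤ.+ + val m M) ℤ.+ + r
    ≡⟨ solve 5 (λ d s v r n → (d :* s :+ v) :+ r := s :* (d :+ n) :+ ((v :+ r) :- s :* n)) refl
         (+ (N ∸ M)) (+ slope m) (+ val m M) (+ r) (+ M) ⟩
  + slope m ℤ.* + (N ∸ M + M) ℤ.+ ((+ val m M ℤ.+ + r) ℤ.- + slope m ℤ.* + M)
    ≡⟨ cong (λ n → + slope m ℤ.* + n ℤ.+ ((+ val m M ℤ.+ + r) ℤ.- + slope m ℤ.* + M)) (ℕP.m∸n+n≡m le) ⟩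
  + slope m ℤ.* + N ℤ.+ ((+ val m M ℤ.+ + r) ℤ.- + slope m ℤ.* + M) ∎
  where
  open ≡.≡-Reasoning
  open ℤ-Solver
  M = from m

rat-ext : ∀ k m r {A} → SP.Rat A → SP.Rat (λ N → ext k (+ (val m N + r)) (A N))
rat-ext k m r {A} rat = let σ , affine = lin-affine m r in
  SP.rat-ev {λ N → ext k (+ slope m ℤ.* + N ℤ.+ σ) (A N)} (from m)
    (λ N le → ≡⇒≃ (cong (λ z → ext k z (A N)) (≡.sym (affine N le))))
    (Extraction.rat-extract k (slope m) A rat σ)

rat-peel : ∀ k m {A} → SP.Rat A → SP.Rat (λ N → peel k (val m N) (A N))
rat-peel k m {A} rat = SP.rat-cong (λ N → ≃-sym (peel-sum k (val m N) (A N))) (go (suc k))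
  where
  go : ∀ n → SP.Rat (λ N → sumₙ n (λ r → sE k r *ₚ ext k (+ (val m N + r)) (A N)))
  go zero    = SP.rat-0
  go (suc n) = SP.rat-⊕ {λ N → sumₙ n (λ r → sE k r *ₚ ext k (+ (val m N + r)) (A N))} (go n)
    (SP.rat-scale (sE k n) {λ N → ext k (+ (val m N + n)) (A N)} (rat-ext k m n rat))

-- Functionals dual to Schubert polynomials

module SZ = Series ℤP.+-*-commutativeRing {⊤} (λ _ _ → tt) (λ _ → 1ℤ) (λ _ _ → refl)

-- At x₁ = x₂ = ⋯ = 1 every generator t^m x^ν becomes t^m.
ev₁ : Poly → ℤ
ev₁ = pair (λ _ → 1ℤ)

ev₁-sh : ∀ m F N → ev₁ (SP.sh m F N) ≡ SZ.sh m (ev₁ ∘ F) N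
ev₁-sh zero    F N       = refl
ev₁-sh (suc m) F zero    = refl
ev₁-sh (suc m) F (suc N) = ev₁-sh m F N

forget : SP.Gen → SZ.Gen
forget (m , x) = m , tt

ev₁-Dels : ∀ As F N → ev₁ (SP.Dels As F N) ≡ SZ.Dels (map forget As) (ev₁ ∘ F) N
ev₁-Dels []             F N = refl
ev₁-Dels ((m , x) ∷ As) F N = ≡.trans (ev₁-Dels As (SP.Del (m , x) F) N) (SZ.Dels-cong (map forget As) (λ n → begin
  ev₁ (F n -ₚ (mono x *ₚ SP.sh (suc m) F n)) ≡⟨ pair-sub (λ _ → 1ℤ) (F n) (mono x *ₚ SP.sh (suc m) F n) ⟩
  ev₁ (F n) ℤ.- ev₁ (mono x *ₚ SP.sh (suc m) F n) ≡⟨ cong (λ z → ev₁ (F n) ℤ.- z) (pair-mono* (λ _ → 1ℤ) x (SP.sh (suc m) F n)) ⟩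
  ev₁ (F n) ℤ.- ev₁ (SP.sh (suc m) F n) ≡⟨ cong (λ z → ev₁ (F n) ℤ.- z) (ev₁-sh (suc m) F n) ⟩
  ev₁ (F n) ℤ.- SZ.sh (suc m) (ev₁ ∘ F) n ≡⟨ cong (λ z → ev₁ (F n) ℤ.- z) (ℤP.*-identityˡ (SZ.sh (suc m) (ev₁ ∘ F) n)) ⟨
  SZ.Del (m , tt) (ev₁ ∘ F) n                            ∎) N)
  where open ≡.≡-Reasoning

rat-ev₁ : ∀ {F} → SP.Rat F → SZ.Rat (ev₁ ∘ F)
rat-ev₁ {F} (As , M , z) = map forget As , M , λ N le → ≡.trans (≡.sym (ev₁-Dels As F N)) (pair-≡ (z N le) (λ _ → 1ℤ) (λ _ → refl))

-- R is a code read backwards; with k = length R, the operator ∂_{k+m-1} ⋯ ∂_k lowers its last entry m to 0.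
Γ : List ℕ → Functional
Γ []      = ε
Γ (m ∷ R) = Dpow (length R) m (Γ R)

-- Sortedness keeps the operators of Γ R inside the first K variables: an entry m′ ≤ m stands at an
-- earlier position, so its block ends before that of m. Symmetric polynomials in these K variables
-- then pass through all blocks.
coInv-Γ : ∀ {K} m R → WeaklyDecreasing (m ∷ R) → length R + m < K → CoInv K (Γ R)
coInv-Γ {K} m []       dec        lt = coInv-ε K
coInv-Γ {K} m (m′ ∷ R) (le ∷ dec) lt = coInv-Dpow (length R) m′ (Γ R) lt′ (coInv-Γ m′ R dec lt′)
  where
  lt′ : length R + m′ < K
  lt′ = ℕP.≤-<-trans (ℕP.≤-trans (ℕP.+-monoʳ-≤ (length R) le) (ℕP.n≤1+n _)) lt

infix 4 _⊒_
_⊒_ : Lin → Lin → Set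
a ⊒ b = b ⊑ a

eventually-decreasing : ∀ {R} → Linked _⊒_ R → Σ ℕ λ M → ∀ N → M ≤ N → WeaklyDecreasing (vals R N)
eventually-decreasing []  = 0 , λ _ _ → []
eventually-decreasing [-] = 0 , λ _ _ → [-]
eventually-decreasing ((M , le) ∷ l) = let M′ , dec = eventually-decreasing l in M + M′ ,
  λ N leN → le N (ℕP.≤-trans (ℕP.m≤m+n M M′) leN) ∷ dec N (ℕP.≤-trans (ℕP.m≤n+m M′ M) leN)

rat-Γ : ∀ R → Linked _⊒_ R → ∀ A → SP.Rat A → (∀ N → Supp (Vars (length R)) (A N)) → SZ.Rat (λ N → app (Γ (vals R N)) (A N))
-- Without variables every A N is constant, where ε agrees with `ev₁`.
rat-Γ [] dec A rat s = SZ.rat-cong (λ N → ≡.sym (s N (δ []) (λ _ → 1ℤ) (δ-resp []) (λ _ → refl) (λ a va → δ-yes [] {a} (eqv (λ i → va i z≤n))))) (rat-ev₁ rat)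
rat-Γ (m ∷ R) dec A rat s = let M , ev = eventually-decreasing dec in
  SZ.rat-ev M (λ N le → ≡.sym (peeled N (ev N le)))
    (rat-Γ R (linked-tail dec) (λ N → peel (length R) (val m N) (A N)) (rat-peel (length R) m rat)
      (λ N → supp-peel (length R) (val m N) {A N} (s N)))
  where
  peeled : ∀ N → WeaklyDecreasing (vals (m ∷ R) N) →
           app (Γ (vals (m ∷ R) N)) (A N) ≡ app (Γ (vals R N)) (peel (length R) (val m N) (A N))
  peeled N dec′ rewrite LP.length-map (λ a → val a N) R = Dpow-peel (length R) (val m N) (Γ (vals R N))
    (coInv-Γ (val m N) (vals R N) dec′ (subst (λ z → z + val m N < suc (length R + val m N)) (≡.sym (LP.length-map (λ a → val a N) R)) ℕP.≤-refl))
    (A N) (s N)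

down : ℕ → Mono → Mono
down i c = repl i c (ix c (suc i)) (pred (ix c i))

down-cong : ∀ i {a b} → a ≋ b → down i a ≋ down i b
down-cong i {a} {b} eq = repl-≋ i a (down i b)
  (≡.trans (ix≡ eq (suc i)) (≡.sym (ix-repl-i i b (ix b (suc i)) (pred (ix b i)))))
  (≡.trans (cong pred (ix≡ eq i)) (≡.sym (ix-repl-si i b (ix b (suc i)) (pred (ix b i)))))
  (λ j ne ne′ → ≡.trans (ix≡ eq j) (≡.sym (repl-off i b (ix b (suc i)) (pred (ix b i)) j ne ne′)))

up-down : ∀ i c → ix c (suc i) < ix c i → up i (down i c) ≋ c
up-down i c lt = repl-≋ i (down i c) c
  (≡.trans (cong suc (ix-repl-si i c (ix c (suc i)) (pred (ix c i)))) (suc-pred lt))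
  (ix-repl-i i c (ix c (suc i)) (pred (ix c i))) (repl-off i c (ix c (suc i)) (pred (ix c i)))
  where
  suc-pred : ∀ {a b} → b < a → suc (pred a) ≡ a
  suc-pred (s≤s _) = refl

down-++ : ∀ pre a b post → down (length pre) (pre ++ a ∷ b ∷ post) ≡ pre ++ b ∷ pred a ∷ post
down-++ pre a b post = ≡.trans (repl-++ pre a b post _ _)
  (cong₂ (λ u v → pre ++ u ∷ pred v ∷ post) (ix-++₁ pre a b post) (ix-++₀ pre a (b ∷ post)))

∷ʳ-put : ∀ l m → l ∷ʳ m ≡ put l (length l) m
∷ʳ-put []      m = refl
∷ʳ-put (x ∷ l) m = cong (x ∷_) (∷ʳ-put l m)

ix-beyond : ∀ l i → length l ≤ i → ix l i ≡ 0
ix-beyond []      i       le       = refl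
ix-beyond (x ∷ l) (suc i) (s≤s le) = ix-beyond l i le

reverse-split : ∀ (hd tl : List ℕ) b a → reverse (hd ++ b ∷ a ∷ tl) ≡ reverse tl ++ a ∷ b ∷ reverse hd
reverse-split hd tl b a = begin
  reverse (hd ++ b ∷ a ∷ tl)                 ≡⟨ LP.reverse-++ hd (b ∷ a ∷ tl) ⟩
  reverse (b ∷ a ∷ tl) ++ reverse hd ≡⟨ cong (_++ reverse hd) (≡.trans (LP.unfold-reverse b (a ∷ tl)) (cong (_∷ʳ b) (LP.unfold-reverse a tl))) ⟩
  ((reverse tl ∷ʳ a) ∷ʳ b) ++ reverse hd ≡⟨ LP.++-assoc (reverse tl ∷ʳ a) (b ∷ []) (reverse hd) ⟩
  (reverse tl ∷ʳ a) ++ b ∷ reverse hd        ≡⟨ LP.++-assoc (reverse tl) (a ∷ []) (b ∷ reverse hd) ⟩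
  reverse tl ++ a ∷ b ∷ reverse hd           ∎
  where open ≡.≡-Reasoning

-- b ⊏ a makes a eventually positive, so that `pred` is a true subtraction there and the slope is
-- kept.
lin-pred : ∀ a b → b ⊏ a → Lin
lin-pred a b (M , lt) = record { val = pred ∘ val a ; slope = slope a ; from = from a + M
  ; linear = λ N le → pred-linear (linear a N (ℕP.≤-trans (ℕP.m≤m+n (from a) M) le)) (lt N (ℕP.≤-trans (ℕP.m≤n+m M (from a)) le)) }
  where
  pred-linear : ∀ {x y z w} → x ≡ z + y → w < y → pred x ≡ z + pred y
  pred-linear {z = z} refl (s≤s {n = y} _) = cong pred (ℕP.+-suc z y)

-- Insertion sort of a reversed code by the moves (a , b) ↦ (b , a - 1) for a > b.
insertDown : Lin → List Lin → List Lin
insertDown b []      = b ∷ []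
insertDown b (a ∷ R) with lin-cmp a b
... | inj₁ _   = b ∷ a ∷ R
... | inj₂ b⊏a = lin-pred a b b⊏a ∷ insertDown b R

⊏⇒⊑pred : ∀ {a b} (b⊏a : b ⊏ a) → b ⊑ lin-pred a b b⊏a
⊏⇒⊑pred (M , lt) = M , λ N le → ℕP.pred-mono-≤ (lt N le)

pred-⊑ : ∀ b {a R} (b⊏a : b ⊏ a) → Linked _⊒_ (a ∷ R) → ∀ {a′ R′} → R ≡ a′ ∷ R′ → ∀ (b⊏a′ : b ⊏ a′) → lin-pred a′ b b⊏a′ ⊑ lin-pred a b b⊏a
pred-⊑ b b⊏a ((M , le) ∷ _) refl _ = M , λ N leN → ℕP.pred-mono-≤ (le N leN)

insertDown-below : ∀ h b R → b ⊑ h → (∀ {a R′} → R ≡ a ∷ R′ → ∀ (b⊏a : b ⊏ a) → lin-pred a b b⊏a ⊑ h) →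
                   Linked _⊒_ R → Linked _⊒_ (h ∷ insertDown b R)
insertDown-below h b []      b⊑h p⊑h dec = b⊑h ∷ [-]
insertDown-below h b (a ∷ R) b⊑h p⊑h dec with lin-cmp a b
... | inj₁ a⊑b = b⊑h ∷ a⊑b ∷ dec
... | inj₂ b⊏a = p⊑h refl b⊏a ∷ insertDown-below (lin-pred a b b⊏a) b R (⊏⇒⊑pred {a} {b} b⊏a) (pred-⊑ b b⊏a dec) (linked-tail dec)

insertDown-sorted : ∀ b R → Linked _⊒_ R → Linked _⊒_ (insertDown b R)
insertDown-sorted b []      dec = [-]
insertDown-sorted b (a ∷ R) dec with lin-cmp a b
... | inj₁ a⊑b = a⊑b ∷ dec
... | inj₂ b⊏a = insertDown-below (lin-pred a b b⊏a) b R (⊏⇒⊑pred {a} {b} b⊏a) (pred-⊑ b b⊏a dec) (linked-tail dec)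

sortDown : List Lin → List Lin
sortDown []      = []
sortDown (b ∷ R) = insertDown b (sortDown R)

sortDown-sorted : ∀ R → Linked _⊒_ (sortDown R)
sortDown-sorted []      = []
sortDown-sorted (b ∷ R) = insertDown-sorted b (sortDown R) (sortDown-sorted R)

module SchubertDual (𝔖 : Key → Poly) (isSchubert : IsSchubert 𝔖) where
  open SchubertExpansion 𝔖 isSchubert public

  IsDual : List ℕ → Functional → Set
  IsDual c Φ = ∀ d → (c ≋ d → app Φ (S d) ≡ 1ℤ) × (¬ c ≋ d → app Φ (S d) ≡ 0ℤ)

  isDual-cong : ∀ {c c′ Φ} → c ≋ c′ → IsDual c Φ → IsDual c′ Φ
  isDual-cong eq dual d = (λ eq′ → proj₁ (dual d) (≋-trans eq eq′)) , (λ ne → proj₂ (dual d) (λ eq′ → ne (≋-trans (≋-sym eq) eq′)))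

  -- 𝔖_d is homogeneous of degree sum d, so its constant term vanishes unless d is zero.
  isDual-ε : IsDual [] ε
  isDual-ε d = (λ eq → ≡.trans (app-cong ε (≃-trans (S-cong (≋-sym eq)) (S-dominant [] []))) (≡.trans (pair-mono (δ []) []) (δ-yes [] {[]} ≋-refl)))
             , (λ ne → ≡.trans (S-varsDeg d (δ []) (λ _ → 0ℤ) (δ-resp []) (λ _ → refl)
                  (λ a (_ , deg) → δ-no [] (λ a≋[] → ne (≋-sym (sum-0 d (≡.trans (≡.sym deg) (0-sum a a≋[])))))))
                  (pair-0ᴸ (S d)))

  ∂-S-ascent : ∀ i d → ix d i ≤ ix d (suc i) → ∂ i (S d) ≃ []
  ∂-S-ascent i d le = ≃-trans (∂-cong i (S-step d i le)) (∂-∂ i (S (up i d)))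

  ∂-S-descent : ∀ i d → ix d (suc i) < ix d i → ∂ i (S d) ≃ S (down i d)
  ∂-S-descent i d lt = ≃-sym (≃-trans (S-step (down i d) i (≡.subst₂ _≤_
      (≡.sym (ix-repl-i i d (ix d (suc i)) (pred (ix d i)))) (≡.sym (ix-repl-si i d (ix d (suc i)) (pred (ix d i)))) (ℕP.pred-mono-≤ lt)))
    (∂-cong i (S-cong (up-down i d lt))))

  -- ∂_i kills 𝔖_d unless the code d drops at i, and then gives 𝔖 of `down i d`. There `up i` undoes
  -- `down i`, so no d other than c is sent to `down i c`.
  isDual-D : ∀ i c Φ → ix c (suc i) < ix c i → IsDual (down i c) Φ → IsDual c (D i Φ)
  isDual-D i c Φ lt dual d with ℕP.≤-<-connex (ix d i) (ix d (suc i))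
  ... | inj₁ le = (λ eq → ⊥-elim (ℕP.<⇒≱ lt (≡.subst₂ _≤_ (≡.sym (ix≡ eq i)) (≡.sym (ix≡ eq (suc i))) le)))
                , (λ _ → ≡.trans (app-cong Φ (∂-S-ascent i d le)) (app-0 Φ))
  ... | inj₂ lt′ = (λ eq → ≡.trans (app-cong Φ (∂-S-descent i d lt′)) (proj₁ (dual (down i d)) (down-cong i eq)))
                 , (λ ne → ≡.trans (app-cong Φ (∂-S-descent i d lt′)) (proj₂ (dual (down i d)) (λ eq → ne
                     (≋-trans (≋-sym (up-down i c lt)) (≋-trans (up-cong i eq) (up-down i d lt′))))))

  -- `down k` turns the entries (m + 1 , 0) at positions k and k + 1 into (0 , m): the last entry
  -- walks to the right and loses one per step until it is gone.
  isDual-Dpow : ∀ m k c Φ → (∀ i → k ≤ i → ix c i ≡ 0) → IsDual c Φ → IsDual (put c k m) (Dpow k m Φ)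
  isDual-Dpow zero    k c Φ z dual = isDual-cong {Φ = Φ} (eqv same) dual
    where
    same : ∀ i → ix c i ≡ ix (put c k 0) i
    same i with k ℕ.≟ i
    ... | yes refl = ≡.trans (z k ℕP.≤-refl) (≡.sym (ix-put-same c k 0))
    ... | no ne    = ≡.sym (ix-put-other c k i 0 ne)
  isDual-Dpow (suc m) k c Φ z dual = isDual-D k c′ (Dpow (suc k) m Φ)
    (≡.subst₂ _<_ (≡.sym c′-next) (≡.sym (ix-put-same c k (suc m))) (s≤s z≤n))
    (isDual-cong {Φ = Dpow (suc k) m Φ} (≋-sym (repl-≋ k c′ (put c (suc k) m)
        (≡.trans c′-next (≡.sym (≡.trans (ix-put-other c (suc k) k m (λ ())) (z k ℕP.≤-refl))))
        (≡.trans (cong pred (ix-put-same c k (suc m))) (≡.sym (ix-put-same c (suc k) m)))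
        (λ j ne ne′ → ≡.trans (ix-put-other c k j (suc m) ne) (≡.sym (ix-put-other c (suc k) j m ne′)))))
      (isDual-Dpow m (suc k) c Φ (λ i le → z i (ℕP.<⇒≤ le)) dual))
    where
    c′ = put c k (suc m)
    c′-next : ix c′ (suc k) ≡ 0
    c′-next = ≡.trans (ix-put-other c k (suc k) (suc m) i≢si) (z (suc k) (ℕP.n≤1+n k))

  isDual-Γ : ∀ R → IsDual (reverse R) (Γ R)
  isDual-Γ []      = isDual-ε
  isDual-Γ (m ∷ R) = subst (λ z → IsDual z (Γ (m ∷ R)))
    (≡.sym (≡.trans (LP.unfold-reverse m R) (≡.trans (∷ʳ-put (reverse R) m) (cong (λ k → put (reverse R) k m) (LP.length-reverse R)))))
    (isDual-Dpow m (length R) (reverse R) (Γ R)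
      (λ i le → ix-beyond (reverse R) i (subst (_≤ i) (≡.sym (LP.length-reverse R)) le)) (isDual-Γ R))

  record RationalDual (R : List Lin) (A : SP.Seq) : Set where
    field
      functional : ℕ → Functional
      start      : ℕ
      isDual     : ∀ N → start ≤ N → IsDual (reverse (vals R N)) (functional N)
      rational   : SZ.Rat (λ N → app (functional N) (A N))

  -- Quantified over A because a move replaces A by ∂_i A, the value of `D i Φ` at A being by
  -- definition that of Φ at ∂_i A. `Rat₁` is the form of rationality that ∂_i preserves.
  Extractable : List Lin → Set
  Extractable R = ∀ A → SP.Rat₁ A → (∀ N → Supp (Vars (length R)) (A N)) → RationalDual R A

  extractable-sorted : ∀ R → Linked _⊒_ R → Extractable R
  extractable-sorted R dec A rat s = record
    { functional = λ N → Γ (vals R N) ; start = 0 ; isDual = λ N _ → isDual-Γ (vals R N)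
    ; rational = rat-Γ R dec A (SP.rat₁⇒rat rat) s }

  extractable-step : ∀ hd b a tl (b⊏a : b ⊏ a) → Extractable (hd ++ lin-pred a b b⊏a ∷ b ∷ tl) → Extractable (hd ++ b ∷ a ∷ tl)
  extractable-step hd b a tl (M , lt) ex A rat s = record
    { functional = λ N → D i (Φ.functional N)
    ; start      = M + Φ.start
    ; isDual     = λ N le → subst (λ z → IsDual z (D i (Φ.functional N))) (≡.sym (split N b a))
        (subst (λ j → IsDual (pre N ++ val a N ∷ val b N ∷ reverse (vals hd N)) (D j (Φ.functional N))) (pre-length N)
          (isDual-D (length (pre N)) (pre N ++ val a N ∷ val b N ∷ reverse (vals hd N)) (Φ.functional N)
          (≡.subst₂ _<_ (≡.sym (ix-++₁ (pre N) (val a N) (val b N) _)) (≡.sym (ix-++₀ (pre N) (val a N) _))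
            (lt N (ℕP.≤-trans (ℕP.m≤m+n M Φ.start) le)))
          (subst (λ z → IsDual z (Φ.functional N)) (≡.trans (split N a⁻ b) (≡.sym (down-++ (pre N) (val a N) (val b N) (reverse (vals hd N)))))
            (Φ.isDual N (ℕP.≤-trans (ℕP.m≤n+m Φ.start M) le)))))
    ; rational   = Φ.rational }
    where
    -- The list is the code read backwards: b and a stand at positions i + 1 and i of the code,
    -- where i counts the entries behind them.
    i = length tl
    a⁻ = lin-pred a b (M , lt)
    pre : ℕ → List ℕ
    pre N = reverse (vals tl N)
    pre-length : ∀ N → length (pre N) ≡ i
    pre-length N = ≡.trans (LP.length-reverse (vals tl N)) (LP.length-map (λ x → val x N) tl)
    split : ∀ N x y → reverse (vals (hd ++ x ∷ y ∷ tl) N) ≡ pre N ++ val y N ∷ val x N ∷ reverse (vals hd N)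
    split N x y = ≡.trans (cong reverse (LP.map-++ (λ x → val x N) hd (x ∷ y ∷ tl))) (reverse-split (vals hd N) (vals tl N) (val x N) (val y N))
    same-length : length (hd ++ a⁻ ∷ b ∷ tl) ≡ length (hd ++ b ∷ a ∷ tl)
    same-length = ≡.trans (LP.length-++ hd) (≡.sym (LP.length-++ hd))
    inside : suc i < length (hd ++ b ∷ a ∷ tl)
    inside = subst (suc i <_) (≡.sym (LP.length-++ hd)) (ℕP.m≤n+m (suc (suc i)) (length hd))
    module Φ = RationalDual (ex (λ N → ∂ i (A N)) (rat₁-∂ i rat)
      (λ N → subst (λ k → Supp (Vars k) (∂ i (A N))) (≡.sym same-length) (vars-∂ i inside {A N} (s N))))

  extractable-insert : ∀ hd b R → Extractable (hd ++ insertDown b R) → Extractable (hd ++ b ∷ R)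
  extractable-insert hd b []      ex = ex
  extractable-insert hd b (a ∷ R) ex with lin-cmp a b
  ... | inj₁ _   = ex
  ... | inj₂ b⊏a = extractable-step hd b a R b⊏a (subst Extractable (LP.++-assoc hd _ _)
        (extractable-insert (hd ∷ʳ lin-pred a b b⊏a) b R (subst Extractable (≡.sym (LP.++-assoc hd _ _)) ex)))

  extractable-sort : ∀ hd R → Extractable (hd ++ sortDown R) → Extractable (hd ++ R)
  extractable-sort hd []      ex = ex
  extractable-sort hd (b ∷ R) ex = subst Extractable (LP.++-assoc hd _ _) (extractable-sort (hd ∷ʳ b) R
    (subst Extractable (≡.sym (LP.++-assoc hd _ _)) (extractable-insert hd b (sortDown R) ex)))

  extractable : ∀ R → Extractable R
  extractable R = extractable-sort [] R (extractable-sorted (sortDown R) (sortDown-sorted R))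

  -- Schubert coefficients as values of dual functionals

  module Coefficients (c : Key → Key → Key → ℤ) (isCoeff : IsSchubertCoeff 𝔖 c) where
    open DecMembership (LP.≡-dec ℕ._≟_) using (_∈?_)

    private
      expansion : (List ℕ → ℤ) → List (List ℕ) → Poly
      expansion g ws = sumₚ (map (λ w → g (key w) ·ₚ 𝔖 (key w)) ws)

    module _ (Φ : Functional) (d : List ℕ) (dual : IsDual d Φ) (g : List ℕ → ℤ) where
      app-cons : ∀ w ws → app Φ (expansion g (w ∷ ws)) ≡ g (key w) ℤ.* app Φ (𝔖 (key w)) ℤ.+ app Φ (expansion g ws)
      app-cons w ws = ≡.trans (app-+ Φ (g (key w) ·ₚ 𝔖 (key w)) (expansion g ws))
        (cong (ℤ._+ app Φ (expansion g ws)) (app-· Φ (g (key w)) (𝔖 (key w))))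

      app-absent : ∀ ws → stripZeros d ∉ map key ws → app Φ (expansion g ws) ≡ 0ℤ
      app-absent []       out = app-0 Φ
      app-absent (w ∷ ws) out = ≡.trans (app-cons w ws) (cong₂ ℤ._+_
        (≡.trans (cong (g (key w) ℤ.*_) (proj₂ (dual (lehmer w)) (λ eq → out (here (stripZeros-≋ eq))))) (ℤP.*-zeroʳ (g (key w))))
        (app-absent ws (out ∘ there)))

      app-present : ∀ ws → Unique (map key ws) → stripZeros d ∈ map key ws → app Φ (expansion g ws) ≡ g (stripZeros d)
      app-present (w ∷ ws) (fresh ∷ uniq) (here eq) = ≡.trans (app-cons w ws) (≡.trans (cong₂ ℤ._+_
        (≡.trans (cong (g (key w) ℤ.*_) (proj₁ (dual (lehmer w)) (≋-stripZeros eq))) (ℤP.*-identityʳ (g (key w))))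
        (app-absent ws (λ mem → All.lookup fresh mem (≡.sym eq)))) (≡.trans (ℤP.+-identityʳ (g (key w))) (cong g (≡.sym eq))))
      app-present (w ∷ ws) (fresh ∷ uniq) (there mem) = ≡.trans (app-cons w ws) (≡.trans (cong₂ ℤ._+_
        (≡.trans (cong (g (key w) ℤ.*_) (proj₂ (dual (lehmer w)) (λ eq → All.lookup fresh mem (≡.sym (stripZeros-≋ eq))))) (ℤP.*-zeroʳ (g (key w))))
        (app-present ws uniq mem)) (ℤP.+-identityˡ _))

    -- Φ kills every term of the expansion except that of d; when d does not occur in the expansion,
    -- both sides are 0.
    coefficient : ∀ a b d Φ → IsDual d Φ → c (stripZeros a) (stripZeros b) (stripZeros d) ≡ app Φ (S a *ₚ S b)
    coefficient a b d Φ dual = ≡.subst₂ (λ u v → c u v (stripZeros d) ≡ app Φ (𝔖 u *ₚ 𝔖 v))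
      (stripZeros-≋ U.codes) (stripZeros-≋ V.codes) main
      where
      -- Padding a by length b + K zeros and b by length a + K zeros puts both permutations into the
      -- same S_n, as `IsSchubertCoeff` demands.
      K = sum a + sum b
      module U = CodePerm (codePerm a (length b + K) (ℕP.≤-trans (ℕP.m≤m+n (sum a) (sum b)) (ℕP.m≤n+m K (length b))))
      module V = CodePerm (codePerm b (length a + K) (ℕP.≤-trans (ℕP.m≤n+m (sum b) (sum a)) (ℕP.m≤n+m K (length a))))
      module W = CodePerm (codePerm d (sum d) ℕP.≤-refl)
      swap-lengths : length b + (length a + K) ≡ length a + (length b + K)
      swap-lengths = ≡.trans (≡.sym (ℕP.+-assoc (length b) (length a) K))
        (≡.trans (cong (_+ K) (ℕP.+-comm (length b) (length a))) (ℕP.+-assoc (length a) (length b) K))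
      expand = isCoeff (length a + (length b + K)) U.w V.w U.isPerm (subst (λ n → IsPerm n V.w) swap-lengths V.isPerm)
      ws = proj₁ expand
      uniq = proj₁ (proj₂ (proj₂ expand))
      product = proj₁ (proj₂ (proj₂ (proj₂ expand)))
      absent = proj₂ (proj₂ (proj₂ (proj₂ expand)))
      g = c (key U.w) (key V.w)
      main : g (stripZeros d) ≡ app Φ (𝔖 (key U.w) *ₚ 𝔖 (key V.w))
      main = ≡.trans (value (stripZeros d ∈? map key ws)) (≡.sym (app-cong Φ (≈ₚ⇒≃ product)))
        where
        value : Dec (stripZeros d ∈ map key ws) → g (stripZeros d) ≡ app Φ (expansion g ws)
        value (yes mem) = ≡.sym (app-present Φ d dual g ws uniq mem)
        value (no out)  = ≡.trans
          (subst (λ k → k ∉ map key ws → g k ≡ 0ℤ) (stripZeros-≋ W.codes) (absent _ W.w W.isPerm) out)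
          (≡.sym (app-absent Φ d dual g ws out))

    stretched : ℕ → Lin
    stretched k = record { val = λ N → N * k ; slope = k ; from = 0 ; linear = λ N _ → refl }

    vals-stretched : ∀ l N → vals (map stretched l) N ≡ map (N *_) l
    vals-stretched l N = ≡.sym (LP.map-∘ l)

    rational : ∀ n u v w → IsPerm n u → IsPerm n v → IsPerm n w →
               SZ.Rat (λ N → c (starKey N u) (starKey N v) (starKey N w))
    rational n u v w pu pv pw = SZ.rat-ev R.start
      (λ N le → ≡.sym (≡.trans
        (≡.subst₂ (λ a b → c (starKey N u) (starKey N v) (starKey N w) ≡ app (R.functional N) (S a *ₚ S b))
          (≡.sym (vals-stretched (lehmer u) N)) (≡.sym (vals-stretched (lehmer v) N))
          (coefficient (map (N *_) (lehmer u)) (map (N *_) (lehmer v)) (map (N *_) (lehmer w)) (R.functional N)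
            (subst (λ z → IsDual z (R.functional N)) (reversed N) (R.isDual N le)))) refl)) R.rational
      where
      Cu = map stretched (lehmer u)
      Cv = map stretched (lehmer v)
      Rw = reverse (map stretched (lehmer w))
      A : SP.Seq
      A N = S (vals Cu N) *ₚ S (vals Cv N)
      code-length : ∀ {x} → IsPerm n x → length (map stretched (lehmer x)) ≡ n
      code-length {x} p = ≡.trans (LP.length-map stretched (lehmer x)) (≡.trans (lehmer-length x) (perm-length p))
      factor : ∀ x → IsPerm n x → ∀ N → Supp (Vars n) (S (vals (map stretched (lehmer x)) N))
      factor x p N L L′ r r′ ag = S-varsDeg (vals (map stretched (lehmer x)) N) L L′ r r′
        (λ a (va , _) → ag a (subst (λ k → Vars k a)
          (≡.trans (LP.length-map (λ y → val y N) (map stretched (lehmer x))) (code-length p)) va))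
      support : ∀ N → Supp (Vars (length Rw)) (A N)
      support N = subst (λ k → Supp (Vars k) (A N)) (≡.sym (≡.trans (LP.length-reverse (map stretched (lehmer w))) (code-length pw)))
        (supp-* {Vars n} {Vars n} {Vars n} vars-monoMul {S (vals Cu N)} {S (vals Cv N)} (factor u pu N) (factor v pv N))
      module R = RationalDual (extractable Rw A (SP.rat₁-⊛ {λ N → S (vals Cu N)} {λ N → S (vals Cv N)} (S-rat₁ Cu) (S-rat₁ Cv)) support)
      reversed : ∀ N → reverse (vals Rw N) ≡ map (N *_) (lehmer w)
      reversed N = ≡.trans (cong reverse (LP.reverse-map (λ y → val y N) (map stretched (lehmer w))))
        (≡.trans (LP.reverse-involutive (vals (map stretched (lehmer w)) N)) (vals-stretched (lehmer w) N))

-- Rational generating functions and quasi-polynomials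

ι : ℤ → ℚ
ι z = z ℚ./ 1

private
  ι-toℚᵘ : ∀ z → ℚ.toℚᵘ (ι z) ℚᵘ.≃ ℚᵘ.mkℚᵘ z 0
  ι-toℚᵘ z = ℚP.toℚᵘ-fromℚᵘ (ℚᵘ.mkℚᵘ z 0)

  open ℤ-Solver using () renaming (solve to solveℤ; _:+_ to _+ℤ_; _:*_ to _*ℤ_; con to conℤ; _:=_ to _≡ℤ_)

ι-+ : ∀ x y → ι (x ℤ.+ y) ≡ ι x ℚ.+ ι y
ι-+ x y = ℚP.toℚᵘ-injective (begin
  ℚ.toℚᵘ (ι (x ℤ.+ y))                  ≈⟨ ι-toℚᵘ (x ℤ.+ y) ⟩
  ℚᵘ.mkℚᵘ (x ℤ.+ y) 0
    ≈⟨ ℚᵘ.*≡* (solveℤ 2 (λ x y → (x +ℤ y) *ℤ conℤ 1ℤ ≡ℤ (x *ℤ conℤ 1ℤ +ℤ y *ℤ conℤ 1ℤ) *ℤ conℤ 1ℤ) refl x y) ⟩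
  ℚᵘ.mkℚᵘ x 0 ℚᵘ.+ ℚᵘ.mkℚᵘ y 0          ≈⟨ ℚᵘP.+-cong (ι-toℚᵘ x) (ι-toℚᵘ y) ⟨
  ℚ.toℚᵘ (ι x) ℚᵘ.+ ℚ.toℚᵘ (ι y)        ≈⟨ ℚP.toℚᵘ-homo-+ (ι x) (ι y) ⟨
  ℚ.toℚᵘ (ι x ℚ.+ ι y)                  ∎)
  where open SetoidReasoning ℚᵘP.≃-setoid

ι-* : ∀ x y → ι (x ℤ.* y) ≡ ι x ℚ.* ι y
ι-* x y = ℚP.toℚᵘ-injective (begin
  ℚ.toℚᵘ (ι (x ℤ.* y))                  ≈⟨ ι-toℚᵘ (x ℤ.* y) ⟩
  ℚᵘ.mkℚᵘ x 0 ℚᵘ.* ℚᵘ.mkℚᵘ y 0          ≈⟨ ℚᵘP.*-cong (ι-toℚᵘ x) (ι-toℚᵘ y) ⟨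
  ℚ.toℚᵘ (ι x) ℚᵘ.* ℚ.toℚᵘ (ι y)        ≈⟨ ℚP.toℚᵘ-homo-* (ι x) (ι y) ⟨
  ℚ.toℚᵘ (ι x ℚ.* ι y)                  ∎)
  where open SetoidReasoning ℚᵘP.≃-setoid

ι-neg : ∀ x → ι (ℤ.- x) ≡ ℚ.- ι x
ι-neg x = ℚP.toℚᵘ-injective (begin
  ℚ.toℚᵘ (ι (ℤ.- x))                    ≈⟨ ι-toℚᵘ (ℤ.- x) ⟩
  ℚᵘ.- ℚᵘ.mkℚᵘ x 0                      ≈⟨ ℚᵘP.-‿cong (ι-toℚᵘ x) ⟨
  ℚᵘ.- ℚ.toℚᵘ (ι x)                     ≈⟨ ℚP.toℚᵘ-homo‿- (ι x) ⟨
  ℚ.toℚᵘ (ℚ.- ι x)                      ∎)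
  where open SetoidReasoning ℚᵘP.≃-setoid

ι-sub : ∀ x y → ι (x ℤ.- y) ≡ ι x ℚ.- ι y
ι-sub x y = ≡.trans (ι-+ x (ℤ.- y)) (cong (ι x ℚ.+_) (ι-neg y))

recip : ℕ → ℚ
recip n = 1ℤ ℚ./ suc n

recip-inverse : ∀ n → ι (+ suc n) ℚ.* recip n ≡ ℚ.1ℚ
recip-inverse n = ℚP.toℚᵘ-injective (begin
  ℚ.toℚᵘ (ι (+ suc n) ℚ.* recip n)                    ≈⟨ ℚP.toℚᵘ-homo-* (ι (+ suc n)) (recip n) ⟩
  ℚ.toℚᵘ (ι (+ suc n)) ℚᵘ.* ℚ.toℚᵘ (recip n) ≈⟨ ℚᵘP.*-cong (ι-toℚᵘ (+ suc n)) (ℚP.toℚᵘ-fromℚᵘ (ℚᵘ.mkℚᵘ 1ℤ n)) ⟩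
  ℚᵘ.mkℚᵘ (+ suc n) 0 ℚᵘ.* ℚᵘ.mkℚᵘ 1ℤ n
    ≈⟨ ℚᵘ.*≡* (cong (+_) (solve 1 (λ n → n :* con 1 :* con 1 := con 1 :* (con 1 :* n)) refl (suc n))) ⟩
  ℚᵘ.mkℚᵘ 1ℤ 0                                        ∎)
  where
  open SetoidReasoning ℚᵘP.≃-setoid
  open ℕS.+-*-Solver

module SQ = Series ℚP.+-*-commutativeRing {⊤} (λ _ _ → tt) (λ _ → ℚ.1ℚ) (λ _ _ → refl)

ι-Dels : ∀ As f N → ι (SZ.Dels As f N) ≡ SQ.Dels As (ι ∘ f) N
ι-Dels []             f N = refl
ι-Dels ((m , tt) ∷ As) f N = ≡.trans (ι-Dels As (SZ.Del (m , tt) f) N) (SQ.Dels-cong As (λ n →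
  ≡.trans (ι-sub (f n) (1ℤ ℤ.* SZ.sh (suc m) f n)) (cong (λ z → ι (f n) ℚ.- z)
    (≡.trans (ι-* 1ℤ (SZ.sh (suc m) f n)) (cong (ℚ.1ℚ ℚ.*_) (ι-sh (suc m) f n))))) N)
  where
  ι-sh : ∀ m f N → ι (SZ.sh m f N) ≡ SQ.sh m (ι ∘ f) N
  ι-sh zero    f N       = refl
  ι-sh (suc m) f zero    = refl
  ι-sh (suc m) f (suc N) = ι-sh m f N

convSum : List ℚ → (ℕ → ℚ) → ℕ → ℕ → ℚ
convSum q a N zero    = coefQ q 0 ℚ.* a N
convSum q a N (suc k) = coefQ q (suc k) ℚ.* a (N ∸ suc k) ℚ.+ convSum q a N k

-- The loop inside conv is a local function without a name; the omitted left-hand side of loop-convSum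
-- is inferred to be that function from its use in conv-suc, where abstracting suc k
-- separates its two numeric arguments.
mutual
  loop-convSum : ∀ q a N k → _ ≡ convSum q a N k
  loop-convSum q a N zero    = refl
  loop-convSum q a N (suc k) = cong (λ z → coefQ q (suc k) ℚ.* a (N ∸ suc k) ℚ.+ z) (loop-convSum q a N k)

  conv-suc : ∀ q a k → conv q a (suc k) ≡ convSum q a (suc k) (suc k)
  conv-suc q a k with suc k
  ... | N = cong (λ z → coefQ q N ℚ.* a (k ∸ k) ℚ.+ z) (loop-convSum q a N k)

conv-convSum : ∀ q a N → conv q a N ≡ convSum q a N N
conv-convSum q a zero    = refl
conv-convSum q a (suc N) = conv-suc q a N

-- Recursion on q makes multiplication by t visible as `sh 1`, in contrast to the recursion of
-- `conv` on an index.
mulSeries : List ℚ → (ℕ → ℚ) → ℕ → ℚ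
mulSeries []      a N = ℚ.0ℚ
mulSeries (x ∷ q) a N = x ℚ.* a N ℚ.+ SQ.sh 1 (mulSeries q a) N

open ℚS.+-*-Solver using () renaming (solve to solveℚ; _:+_ to _+ℚ_; _:*_ to _*ℚ_; _:-_ to _-ℚ_; :-_ to -ℚ_; con to conℚ; _:=_ to _≡ℚ_)

convSum-∷ : ∀ x q a N k → convSum (x ∷ q) a (suc N) (suc k) ≡ x ℚ.* a (suc N) ℚ.+ convSum q a N k
convSum-∷ x q a N zero    = ℚP.+-comm (coefQ q 0 ℚ.* a N) (x ℚ.* a (suc N))
convSum-∷ x q a N (suc k) = ≡.trans (cong (λ z → coefQ q (suc k) ℚ.* a (N ∸ suc k) ℚ.+ z) (convSum-∷ x q a N k))
  (solveℚ 3 (λ u v w → u +ℚ (v +ℚ w) ≡ℚ v +ℚ (u +ℚ w)) refl (coefQ q (suc k) ℚ.* a (N ∸ suc k)) (x ℚ.* a (suc N)) (convSum q a N k))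

convSum-[] : ∀ a N k → convSum [] a N k ≡ ℚ.0ℚ
convSum-[] a N zero    = ℚP.*-zeroˡ (a N)
convSum-[] a N (suc k) = cong₂ ℚ._+_ (ℚP.*-zeroˡ (a (N ∸ suc k))) (convSum-[] a N k)

convSum-mulSeries : ∀ q a N → convSum q a N N ≡ mulSeries q a N
convSum-mulSeries []      a N       = convSum-[] a N N
convSum-mulSeries (x ∷ q) a zero    = ≡.sym (ℚP.+-identityʳ (x ℚ.* a 0))
convSum-mulSeries (x ∷ q) a (suc N) = ≡.trans (convSum-∷ x q a N N) (cong (λ z → x ℚ.* a (suc N) ℚ.+ z) (convSum-mulSeries q a N))

subList : List ℚ → List ℚ → List ℚ
subList q       []      = q
subList []      (y ∷ r) = (ℚ.0ℚ ℚ.- y) ∷ subList [] r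
subList (x ∷ q) (y ∷ r) = (x ℚ.- y) ∷ subList q r

sh1-sub : ∀ {f g h : ℕ → ℚ} → (∀ n → f n ≡ g n ℚ.- h n) → ∀ N → SQ.sh 1 f N ≡ SQ.sh 1 g N ℚ.- SQ.sh 1 h N
sh1-sub eq zero    = refl
sh1-sub eq (suc N) = eq N

mulSeries-sub : ∀ q r a N → mulSeries (subList q r) a N ≡ mulSeries q a N ℚ.- mulSeries r a N
mulSeries-sub q       []      a N = solveℚ 1 (λ u → u ≡ℚ u -ℚ conℚ ℚ.0ℚ) refl (mulSeries q a N)
mulSeries-sub [] (y ∷ r) a N = ≡.trans (cong ((ℚ.0ℚ ℚ.- y) ℚ.* a N ℚ.+_) (sh1-sub {g = λ _ → ℚ.0ℚ} (mulSeries-sub [] r a) N))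
  (≡.trans (cong (λ z → (ℚ.0ℚ ℚ.- y) ℚ.* a N ℚ.+ (z ℚ.- SQ.sh 1 (mulSeries r a) N)) (sh1-0 N))
  (solveℚ 3 (λ y u v → (conℚ ℚ.0ℚ -ℚ y) *ℚ u +ℚ (conℚ ℚ.0ℚ -ℚ v) ≡ℚ conℚ ℚ.0ℚ -ℚ (y *ℚ u +ℚ v)) refl y (a N) (SQ.sh 1 (mulSeries r a) N)))
  where
  sh1-0 : ∀ N → SQ.sh 1 (λ _ → ℚ.0ℚ) N ≡ ℚ.0ℚ
  sh1-0 zero    = refl
  sh1-0 (suc N) = refl
mulSeries-sub (x ∷ q) (y ∷ r) a N = ≡.trans (cong ((x ℚ.- y) ℚ.* a N ℚ.+_) (sh1-sub (mulSeries-sub q r a) N))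
  (solveℚ 5 (λ x y u v w → (x -ℚ y) *ℚ u +ℚ (v -ℚ w) ≡ℚ (x *ℚ u +ℚ v) -ℚ (y *ℚ u +ℚ w)) refl
    x y (a N) (SQ.sh 1 (mulSeries q a) N) (SQ.sh 1 (mulSeries r a) N))

mulSeries-shift : ∀ m q a N → mulSeries (replicate m ℚ.0ℚ ++ q) a N ≡ SQ.sh m (mulSeries q a) N
mulSeries-shift zero    q a N = refl
mulSeries-shift (suc m) q a N = ≡.trans (cong (ℚ._+ SQ.sh 1 (mulSeries (replicate m ℚ.0ℚ ++ q) a) N) (ℚP.*-zeroˡ (a N)))
  (≡.trans (ℚP.+-identityˡ (SQ.sh 1 (mulSeries (replicate m ℚ.0ℚ ++ q) a) N)) (shifted N))
  where
  shifted : ∀ N → SQ.sh 1 (mulSeries (replicate m ℚ.0ℚ ++ q) a) N ≡ SQ.sh (suc m) (mulSeries q a) N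
  shifted zero    = refl
  shifted (suc N) = mulSeries-shift m q a N

-- Coefficients of ∏ (1 - t^(m+1)).
denominator : List SQ.Gen → List ℚ
denominator []             = ℚ.1ℚ ∷ []
denominator ((m , _) ∷ As) = subList (denominator As) (replicate (suc m) ℚ.0ℚ ++ denominator As)

denominator-0 : ∀ As → coefQ (denominator As) 0 ≡ ℚ.1ℚ
denominator-0 []             = refl
denominator-0 ((m , _) ∷ As) = ≡.trans (unchanged (denominator As)) (denominator-0 As)
  where
  unchanged : ∀ q {r} → coefQ (subList q (ℚ.0ℚ ∷ r)) 0 ≡ coefQ q 0
  unchanged []      = refl
  unchanged (x ∷ q) = solveℚ 1 (λ x → x -ℚ conℚ ℚ.0ℚ ≡ℚ x) refl x

denominator-Dels : ∀ As a N → mulSeries (denominator As) a N ≡ SQ.Dels As a N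
denominator-Dels [] a N = ≡.trans (cong (ℚ.1ℚ ℚ.* a N ℚ.+_) (sh1-0 N)) (solveℚ 1 (λ u → conℚ ℚ.1ℚ *ℚ u +ℚ conℚ ℚ.0ℚ ≡ℚ u) refl (a N))
  where
  sh1-0 : ∀ N → SQ.sh 1 (mulSeries [] a) N ≡ ℚ.0ℚ
  sh1-0 zero    = refl
  sh1-0 (suc N) = refl
denominator-Dels (A@(m , tt) ∷ As) a N = begin
  mulSeries (subList q (replicate (suc m) ℚ.0ℚ ++ q)) a N ≡⟨ mulSeries-sub q (replicate (suc m) ℚ.0ℚ ++ q) a N ⟩
  mulSeries q a N ℚ.- mulSeries (replicate (suc m) ℚ.0ℚ ++ q) a N
    ≡⟨ cong (λ z → mulSeries q a N ℚ.- z) (≡.trans (mulSeries-shift (suc m) q a N) (≡.sym (ℚP.*-identityˡ (SQ.sh (suc m) (mulSeries q a) N)))) ⟩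
  SQ.Del A (mulSeries q a) N ≡⟨ SQ.Del-cong A (denominator-Dels As a) N ⟩
  SQ.Del A (SQ.Dels As a) N                                         ≡⟨ SQ.Dels-Del As A a N ⟨
  SQ.Dels (A ∷ As) a N                                              ∎
  where
  open ≡.≡-Reasoning
  q = denominator As

coefQ-applyUpTo : ∀ (f : ℕ → ℚ) M → (∀ N → M ≤ N → f N ≡ ℚ.0ℚ) → ∀ N → f N ≡ coefQ (applyUpTo f M) N
coefQ-applyUpTo f zero    z N       = z N z≤n
coefQ-applyUpTo f (suc M) z zero    = refl
coefQ-applyUpTo f (suc M) z (suc N) = coefQ-applyUpTo (f ∘ suc) M (λ N le → z (suc N) (s≤s le)) N

rational⇒gf : ∀ f → SZ.Rat f → IsRationalGF f
rational⇒gf f (As , M , z) = applyUpTo (mulSeries q _) (proj₁ killed) , q ,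
  (0 , λ eq → 1≢0 (≡.trans (≡.sym (denominator-0 As)) eq)) ,
  λ N → ≡.trans (≡.trans (conv-convSum q _ N) (convSum-mulSeries q _ N)) (coefQ-applyUpTo (mulSeries q _) (proj₁ killed)
    (λ N le → ≡.trans (denominator-Dels As _ N) (proj₂ killed N le)) N)
  where
  q = denominator As
  1≢0 : ℚ.1ℚ ≢ ℚ.0ℚ
  1≢0 ()
  -- The series starts at N = 1 with constant term 0, whereas f 0 is arbitrary; the two sequences
  -- agree from 1 on.
  killed = SQ.killed-ev As 1 (λ { (suc N) (s≤s _) → refl }) (M , λ N le → ≡.trans (≡.sym (ι-Dels As f N)) (cong ι (z N le)))

-- Newton expansions along residue classes

period : ∀ As → Σ ℕ λ p → All (λ (A : SZ.Gen) → Σ ℕ λ s → suc s * suc (proj₁ A) ≡ suc p) As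
period []       = 0 , []
period ((m , _) ∷ As) with period As
... | p , alls = p + m * suc p , (p , ℕP.*-comm (suc p) (suc m)) ∷ All.map (λ { {n , _} (s , eq) → s + m * suc s ,
    ≡.trans (ℕP.*-assoc (suc m) (suc s) (suc n)) (cong (suc m *_) eq) }) alls

power-delay : ∀ m s → suc (proj₁ (SZ.power (m , tt) s)) ≡ suc s * suc m
power-delay m zero    = ≡.sym (ℕP.*-identityˡ (suc m))
power-delay m (suc s) = cong (λ z → suc m + z) (power-delay m s)

-- 1 - t^(p+1) is a multiple of every factor 1 - t^m in the list, so r = `length As` copies of it
-- kill f: on each residue class mod p + 1 the r-th differences eventually vanish.
common-period : ∀ p As → All (λ (A : SZ.Gen) → Σ ℕ λ s → suc s * suc (proj₁ A) ≡ suc p) As →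
                ∀ f → SZ.Killed As f → SZ.Killed (replicate (length As) (p , tt)) f
common-period p []              []               f k = k
common-period p ((m , tt) ∷ As) ((s , eq) ∷ alls) f k = common-period p As alls (SZ.Del (p , tt) f)
  (subst (λ r → SZ.Killed As (SZ.Del (r , tt) f)) (ℕP.suc-injective (≡.trans (power-delay m s) eq)) (SZ.killed-power (m , tt) s As {f} k))

-- Newton's forward formula: the list holds the iterated differences at 0, so its tail describes the
-- first difference.
newton : List ℤ → ℕ → ℤ
newton []      j       = 0ℤ
newton (x ∷ q) zero    = x
newton (x ∷ q) (suc j) = newton (x ∷ q) j ℤ.+ newton q j

sh-plus : ∀ m (f : ℕ → ℤ) N → SZ.sh m f (m + N) ≡ f N
sh-plus zero    f N = refl
sh-plus (suc m) f N = sh-plus m f N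

killed⇒newton : ∀ r p M f → (∀ N → M ≤ N → SZ.Dels (replicate r (p , tt)) f N ≡ 0ℤ) →
                ∀ i → M ≤ i → Σ (List ℤ) λ q → ∀ j → f (j * suc p + i) ≡ newton q j
killed⇒newton zero    p M f z i le = [] , λ j → z _ (ℕP.≤-trans le (ℕP.m≤n+m i (j * suc p)))
-- `Del` at N is f(N) - f(N - p - 1), so the differences of the subsequence that starts at i are the
-- values of `Del` from p + 1 + i on.
killed⇒newton (suc r) p M f z i le with killed⇒newton r p M (SZ.Del (p , tt) f) z (suc p + i) (ℕP.≤-trans le (ℕP.m≤n+m i (suc p)))
... | q , eq = f i ∷ q , go
  where
  go : ∀ j → f (j * suc p + i) ≡ newton (f i ∷ q) j
  go zero    = refl
  go (suc j) = begin
    f (suc j * suc p + i)                             ≡⟨ cong f (ℕP.+-assoc (suc p) (j * suc p) i) ⟩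
    f N ≡⟨ solve 2 (λ u v → u := v :+ (u :- con 1ℤ :* v)) refl (f N) (f (j * suc p + i)) ⟩
    f (j * suc p + i) ℤ.+ (f N ℤ.- 1ℤ ℤ.* f (j * suc p + i))
      ≡⟨ cong (λ w → f (j * suc p + i) ℤ.+ (f N ℤ.- 1ℤ ℤ.* w)) (sh-plus (suc p) f (j * suc p + i)) ⟨
    f (j * suc p + i) ℤ.+ SZ.Del (p , tt) f N ≡⟨ cong₂ ℤ._+_ (go j) (≡.trans (cong (SZ.Del (p , tt) f) shuffle) (eq j)) ⟩
    newton (f i ∷ q) j ℤ.+ newton q j                 ∎
    where
    open ≡.≡-Reasoning
    open ℤ-Solver
    N = suc p + (j * suc p + i)
    shuffle : N ≡ j * suc p + (suc p + i)
    shuffle = ≡.trans (≡.sym (ℕP.+-assoc (suc p) (j * suc p) i))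
      (≡.trans (cong (_+ i) (ℕP.+-comm (suc p) (j * suc p))) (ℕP.+-assoc (j * suc p) (suc p) i))

binom : ℕ → ℕ → ℕ
binom j       zero    = 1
binom zero    (suc l) = 0
binom (suc j) (suc l) = binom j l + binom j (suc l)

-- (l + 1) C(j, l + 1) = (j - l) C(j, l) with the subtraction moved across; this is the recursion
-- behind `binomPoly`.
binom-absorb : ∀ j l → suc l * binom j (suc l) + l * binom j l ≡ j * binom j l
binom-absorb zero    zero    = refl
binom-absorb zero    (suc l) = cong₂ _+_ (ℕP.*-zeroʳ (suc (suc l))) (ℕP.*-zeroʳ (suc l))
binom-absorb (suc j) zero = ≡.trans (cong (_+ 0) (ℕP.*-distribˡ-+ 1 1 (binom j 1))) (cong suc (binom-absorb j zero))
binom-absorb (suc j) (suc l) = begin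
  suc (suc l) * (b₁ + b₂) + suc l * (b₀ + b₁)
    ≡⟨ solve 4 (λ l b₀ b₁ b₂ → (con 2 :+ l) :* (b₁ :+ b₂) :+ (con 1 :+ l) :* (b₀ :+ b₁)
         := ((con 2 :+ l) :* b₂ :+ (con 1 :+ l) :* b₁) :+ ((con 1 :+ l) :* b₁ :+ l :* b₀) :+ (b₀ :+ b₁)) refl l b₀ b₁ b₂ ⟩
  (suc (suc l) * b₂ + suc l * b₁) + (suc l * b₁ + l * b₀) + (b₀ + b₁)
    ≡⟨ cong₂ (λ u v → u + v + (b₀ + b₁)) (binom-absorb j (suc l)) (binom-absorb j l) ⟩
  j * b₁ + j * b₀ + (b₀ + b₁)
    ≡⟨ solve 3 (λ j b₀ b₁ → j :* b₁ :+ j :* b₀ :+ (b₀ :+ b₁) := (con 1 :+ j) :* (b₀ :+ b₁)) refl j b₀ b₁ ⟩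
  suc j * (b₀ + b₁) ∎
  where
  open ≡.≡-Reasoning
  open ℕS.+-*-Solver
  b₀ = binom j l
  b₁ = binom j (suc l)
  b₂ = binom j (suc (suc l))

binomSum : ℕ → List ℤ → ℕ → ℤ
binomSum l []      j = 0ℤ
binomSum l (x ∷ q) j = x ℤ.* + binom j l ℤ.+ binomSum (suc l) q j

binomSum-pascal : ∀ l q j → binomSum (suc l) q (suc j) ≡ binomSum l q j ℤ.+ binomSum (suc l) q j
binomSum-pascal l []      j = refl
binomSum-pascal l (x ∷ q) j = ≡.trans (cong (λ z → x ℤ.* (+ binom j l ℤ.+ + binom j (suc l)) ℤ.+ z) (binomSum-pascal (suc l) q j))
  (solve 5 (λ x b b′ u v → x :* (b :+ b′) :+ (u :+ v) := (x :* b :+ u) :+ (x :* b′ :+ v)) refl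
    x (+ binom j l) (+ binom j (suc l)) (binomSum (suc l) q j) (binomSum (suc (suc l)) q j))
  where open ℤ-Solver

binomSum-suc-0 : ∀ l q → binomSum (suc l) q 0 ≡ 0ℤ
binomSum-suc-0 l []      = refl
binomSum-suc-0 l (x ∷ q) = cong₂ ℤ._+_ (ℤP.*-zeroʳ x) (binomSum-suc-0 (suc l) q)

-- Both sides satisfy the same difference equation, which on the binomial side is Pascal's rule.
newton-binomSum : ∀ q j → newton q j ≡ binomSum 0 q j
newton-binomSum []      j       = refl
newton-binomSum (x ∷ q) zero = ≡.sym (≡.trans (cong₂ ℤ._+_ (ℤP.*-identityʳ x) (binomSum-suc-0 0 q)) (ℤP.+-identityʳ x))
newton-binomSum (x ∷ q) (suc j) = ≡.trans (cong₂ ℤ._+_ (newton-binomSum (x ∷ q) j) (newton-binomSum q j))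
  (≡.trans (solve 3 (λ x u v → (x :* con 1ℤ :+ u) :+ v := x :* con 1ℤ :+ (v :+ u)) refl x (binomSum 1 q j) (binomSum 0 q j))
    (cong (λ z → x ℤ.* 1ℤ ℤ.+ z) (≡.sym (binomSum-pascal 0 q j))))
  where open ℤ-Solver

addList : List ℚ → List ℚ → List ℚ
addList []      r       = r
addList (x ∷ q) []      = x ∷ q
addList (x ∷ q) (y ∷ r) = (x ℚ.+ y) ∷ addList q r

mulList : List ℚ → List ℚ → List ℚ
mulList []      r = []
mulList (x ∷ q) r = addList (map (x ℚ.*_) r) (ℚ.0ℚ ∷ mulList q r)

evalQ-add : ∀ q r t → evalQ (addList q r) t ≡ evalQ q t ℚ.+ evalQ r t
evalQ-add []      r       t = ≡.sym (ℚP.+-identityˡ (evalQ r t))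
evalQ-add (x ∷ q) []      t = ≡.sym (ℚP.+-identityʳ (evalQ (x ∷ q) t))
evalQ-add (x ∷ q) (y ∷ r) t = ≡.trans (cong (λ z → (x ℚ.+ y) ℚ.+ t ℚ.* z) (evalQ-add q r t))
  (solveℚ 5 (λ x y t u v → (x +ℚ y) +ℚ t *ℚ (u +ℚ v) ≡ℚ (x +ℚ t *ℚ u) +ℚ (y +ℚ t *ℚ v)) refl x y t (evalQ q t) (evalQ r t))

evalQ-scale : ∀ x r t → evalQ (map (x ℚ.*_) r) t ≡ x ℚ.* evalQ r t
evalQ-scale x []      t = ≡.sym (ℚP.*-zeroʳ x)
evalQ-scale x (y ∷ r) t = ≡.trans (cong (λ z → x ℚ.* y ℚ.+ t ℚ.* z) (evalQ-scale x r t))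
  (solveℚ 4 (λ x y t u → x *ℚ y +ℚ t *ℚ (x *ℚ u) ≡ℚ x *ℚ (y +ℚ t *ℚ u)) refl x y t (evalQ r t))

evalQ-mul : ∀ q r t → evalQ (mulList q r) t ≡ evalQ q t ℚ.* evalQ r t
evalQ-mul []      r t = ≡.sym (ℚP.*-zeroˡ (evalQ r t))
evalQ-mul (x ∷ q) r t = begin
  evalQ (addList (map (x ℚ.*_) r) (ℚ.0ℚ ∷ mulList q r)) t ≡⟨ evalQ-add (map (x ℚ.*_) r) (ℚ.0ℚ ∷ mulList q r) t ⟩
  evalQ (map (x ℚ.*_) r) t ℚ.+ (ℚ.0ℚ ℚ.+ t ℚ.* evalQ (mulList q r) t)
    ≡⟨ cong₂ (λ u v → u ℚ.+ (ℚ.0ℚ ℚ.+ t ℚ.* v)) (evalQ-scale x r t) (evalQ-mul q r t) ⟩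
  x ℚ.* evalQ r t ℚ.+ (ℚ.0ℚ ℚ.+ t ℚ.* (evalQ q t ℚ.* evalQ r t))
    ≡⟨ solveℚ 4 (λ x t u v → x *ℚ v +ℚ (conℚ ℚ.0ℚ +ℚ t *ℚ (u *ℚ v)) ≡ℚ (x +ℚ t *ℚ u) *ℚ v) refl x t (evalQ q t) (evalQ r t) ⟩
  evalQ (x ∷ q) t ℚ.* evalQ r t ∎
  where open ≡.≡-Reasoning

evalQ-const : ∀ x t → evalQ (x ∷ []) t ≡ x
evalQ-const x t = solveℚ 2 (λ x t → x +ℚ t *ℚ conℚ ℚ.0ℚ ≡ℚ x) refl x t

-- The polynomial binom(g, l), where g is the polynomial with coefficient list g.
binomPoly : List ℚ → ℕ → List ℚ
binomPoly g zero    = ℚ.1ℚ ∷ []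
binomPoly g (suc l) = mulList (mulList (binomPoly g l) (addList g ((ℚ.- ι (+ l)) ∷ []))) (recip l ∷ [])

evalQ-binomPoly : ∀ g t j → evalQ g t ≡ ι (+ j) → ∀ l → evalQ (binomPoly g l) t ≡ ι (+ binom j l)
evalQ-binomPoly g t j eq zero    = evalQ-const ℚ.1ℚ t
evalQ-binomPoly g t j eq (suc l) = begin
  evalQ (binomPoly g (suc l)) t
    ≡⟨ ≡.trans (evalQ-mul (mulList (binomPoly g l) shifted) (recip l ∷ []) t)
         (cong₂ ℚ._*_ (evalQ-mul (binomPoly g l) shifted t) (evalQ-const (recip l) t)) ⟩
  (evalQ (binomPoly g l) t ℚ.* evalQ shifted t) ℚ.* recip l
    ≡⟨ cong₂ (λ u v → (u ℚ.* v) ℚ.* recip l) (evalQ-binomPoly g t j eq l)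
         (≡.trans (evalQ-add g ((ℚ.- ι (+ l)) ∷ []) t) (cong₂ ℚ._+_ eq (evalQ-const (ℚ.- ι (+ l)) t))) ⟩
  (B ℚ.* (ι (+ j) ℚ.- ι (+ l))) ℚ.* recip l
    ≡⟨ cong (ℚ._* recip l) (solveℚ 3 (λ b j l → b *ℚ (j -ℚ l) ≡ℚ j *ℚ b -ℚ l *ℚ b) refl B (ι (+ j)) (ι (+ l))) ⟩
  (ι (+ j) ℚ.* B ℚ.- ι (+ l) ℚ.* B) ℚ.* recip l
    ≡⟨ cong (λ z → (z ℚ.- ι (+ l) ℚ.* B) ℚ.* recip l) (absorb) ⟩
  ((ι (+ suc l) ℚ.* B′ ℚ.+ ι (+ l) ℚ.* B) ℚ.- ι (+ l) ℚ.* B) ℚ.* recip l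
    ≡⟨ solveℚ 4 (λ s b′ w r → ((s *ℚ b′ +ℚ w) -ℚ w) *ℚ r ≡ℚ (s *ℚ r) *ℚ b′) refl (ι (+ suc l)) B′ (ι (+ l) ℚ.* B) (recip l) ⟩
  (ι (+ suc l) ℚ.* recip l) ℚ.* B′   ≡⟨ cong (ℚ._* B′) (recip-inverse l) ⟩
  ℚ.1ℚ ℚ.* B′                        ≡⟨ ℚP.*-identityˡ B′ ⟩
  B′                                 ∎
  where
  open ≡.≡-Reasoning
  shifted = addList g ((ℚ.- ι (+ l)) ∷ [])
  B = ι (+ binom j l)
  B′ = ι (+ binom j (suc l))
  ι-*ℕ : ∀ a b → ι (+ (a * b)) ≡ ι (+ a) ℚ.* ι (+ b)
  ι-*ℕ a b = ≡.trans (cong ι (ℤP.pos-* a b)) (ι-* (+ a) (+ b))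
  absorb : ι (+ j) ℚ.* B ≡ ι (+ suc l) ℚ.* B′ ℚ.+ ι (+ l) ℚ.* B
  absorb = begin
    ι (+ j) ℚ.* B                                                  ≡⟨ ι-*ℕ j (binom j l) ⟨
    ι (+ (j * binom j l)) ≡⟨ cong (ι ∘ +_) (binom-absorb j l) ⟨
    ι (+ (suc l * binom j (suc l)) ℤ.+ + (l * binom j l)) ≡⟨ ι-+ (+ (suc l * binom j (suc l))) (+ (l * binom j l)) ⟩
    ι (+ (suc l * binom j (suc l))) ℚ.+ ι (+ (l * binom j l)) ≡⟨ cong₂ ℚ._+_ (ι-*ℕ (suc l) (binom j (suc l))) (ι-*ℕ l (binom j l)) ⟩
    ι (+ suc l) ℚ.* B′ ℚ.+ ι (+ l) ℚ.* B                           ∎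

binomSumPoly : List ℚ → ℕ → List ℤ → List ℚ
binomSumPoly g l []      = []
binomSumPoly g l (x ∷ q) = addList (map (ι x ℚ.*_) (binomPoly g l)) (binomSumPoly g (suc l) q)

evalQ-binomSumPoly : ∀ g t j → evalQ g t ≡ ι (+ j) → ∀ l q → evalQ (binomSumPoly g l q) t ≡ ι (binomSum l q j)
evalQ-binomSumPoly g t j eq l []      = refl
evalQ-binomSumPoly g t j eq l (x ∷ q) = begin
  evalQ (addList (map (ι x ℚ.*_) (binomPoly g l)) (binomSumPoly g (suc l) q)) t
    ≡⟨ evalQ-add (map (ι x ℚ.*_) (binomPoly g l)) (binomSumPoly g (suc l) q) t ⟩
  evalQ (map (ι x ℚ.*_) (binomPoly g l)) t ℚ.+ evalQ (binomSumPoly g (suc l) q) t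
    ≡⟨ cong₂ ℚ._+_ (≡.trans (evalQ-scale (ι x) (binomPoly g l) t) (cong (ι x ℚ.*_) (evalQ-binomPoly g t j eq l)))
         (evalQ-binomSumPoly g t j eq (suc l) q) ⟩
  ι x ℚ.* ι (+ binom j l) ℚ.+ ι (binomSum (suc l) q j)
    ≡⟨ cong (ℚ._+ ι (binomSum (suc l) q j)) (ι-* x (+ binom j l)) ⟨
  ι (x ℤ.* + binom j l) ℚ.+ ι (binomSum (suc l) q j) ≡⟨ ι-+ (x ℤ.* + binom j l) (binomSum (suc l) q j) ⟨
  ι (binomSum l (x ∷ q) j)                             ∎
  where open ≡.≡-Reasoning

-- On the class of ρ modulo L = p + 1, N = j L + (ρ + M L) with j = (N - ρ - M L) / L.
rational⇒quasiPoly : ∀ f → SZ.Rat f → IsEventuallyQuasiPoly f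
rational⇒quasiPoly f (As , k) with period As
... | p , alls with common-period p As alls f k
-- For N > (M + 1) L the quotient N / L is at least M, so the index N / L - M is not truncated.
... | M , z = p , suc (suc p + M * L) , (λ ρ → binomSumPoly (position (start (Fin.toℕ ρ))) 0 (proj₁ (coeffs (Fin.toℕ ρ)))) , s≤s z≤n , agree
  where
  L = suc p
  start : ℕ → ℕ
  -- Adding M L rather than M keeps the residue class, and M ≤ M L because L ≥ 1.
  start ρ = ρ + M * L
  coeffs : ∀ ρ → Σ (List ℤ) λ q → ∀ j → f (j * L + start ρ) ≡ newton q j
  coeffs ρ = killed⇒newton (length As) p M f z (start ρ) (ℕP.≤-trans (ℕP.m≤m*n M L) (ℕP.m≤n+m (M * L) ρ))
  position : ℕ → List ℚ
  position i = mulList ((ℚ.- ι (+ i)) ∷ ℚ.1ℚ ∷ []) (recip p ∷ [])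
  evalQ-position : ∀ i j → evalQ (position i) (ι (+ (j * L + i))) ≡ ι (+ j)
  evalQ-position i j = begin
    evalQ (position i) t ≡⟨ evalQ-mul ((ℚ.- ι (+ i)) ∷ ℚ.1ℚ ∷ []) (recip p ∷ []) t ⟩
    evalQ ((ℚ.- ι (+ i)) ∷ ℚ.1ℚ ∷ []) t ℚ.* evalQ (recip p ∷ []) t
      ≡⟨ cong₂ ℚ._*_ (solveℚ 2 (λ i t → (-ℚ i) +ℚ t *ℚ (conℚ ℚ.1ℚ +ℚ t *ℚ conℚ ℚ.0ℚ) ≡ℚ t -ℚ i) refl (ι (+ i)) t) (evalQ-const (recip p) t) ⟩
    (t ℚ.- ι (+ i)) ℚ.* recip p
      ≡⟨ cong (λ z → (z ℚ.- ι (+ i)) ℚ.* recip p) (≡.trans (ι-+ (+ (j * L)) (+ i)) (cong (ℚ._+ ι (+ i))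
           (≡.trans (cong ι (ℤP.pos-* j L)) (ι-* (+ j) (+ L))))) ⟩
    ((ι (+ j) ℚ.* ι (+ L) ℚ.+ ι (+ i)) ℚ.- ι (+ i)) ℚ.* recip p
      ≡⟨ solveℚ 4 (λ j l i r → ((j *ℚ l +ℚ i) -ℚ i) *ℚ r ≡ℚ j *ℚ (l *ℚ r)) refl (ι (+ j)) (ι (+ L)) (ι (+ i)) (recip p) ⟩
    ι (+ j) ℚ.* (ι (+ L) ℚ.* recip p) ≡⟨ cong (ι (+ j) ℚ.*_) (recip-inverse p) ⟩
    ι (+ j) ℚ.* ℚ.1ℚ                                           ≡⟨ ℚP.*-identityʳ (ι (+ j)) ⟩
    ι (+ j)                                                    ∎
    where
    open ≡.≡-Reasoning
    t = ι (+ (j * L + i))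
  decompose : ∀ N → suc (L + M * L) ≤ N → (N DivMod./ L ∸ M) * L + start (N DivMod.% L) ≡ N
  decompose N le = begin
    (d ∸ M) * L + (r + M * L) ≡⟨ solve 3 (λ u r v → u :+ (r :+ v) := r :+ (u :+ v)) refl ((d ∸ M) * L) r (M * L) ⟩
    r + ((d ∸ M) * L + M * L) ≡⟨ cong (λ z → r + z) (≡.trans (≡.sym (ℕP.*-distribʳ-+ L (d ∸ M) M)) (cong (_* L) (ℕP.m∸n+n≡m M≤d))) ⟩
    r + d * L                         ≡⟨ DivMod.m≡m%n+[m/n]*n N L ⟨
    N                                 ∎
    where
    open ≡.≡-Reasoning
    open ℕS.+-*-Solver
    d = N DivMod./ L
    r = N DivMod.% L
    M≤d : M ≤ d
    M≤d = ℕP.≮⇒≥ λ d<M → ℕP.<⇒≱ le (subst (_≤ L + M * L) (≡.sym (DivMod.m≡m%n+[m/n]*n N L))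
      (ℕP.+-mono-≤ (ℕP.<⇒≤ (DivMod.m%n<n N L)) (ℕP.*-monoˡ-≤ L (ℕP.<⇒≤ d<M))))
  agree : ∀ N → suc (suc p + M * L) ≤ N →
          ι (f N) ≡ evalQ (binomSumPoly (position (start (Fin.toℕ (N DivMod.mod L)))) 0 (proj₁ (coeffs (Fin.toℕ (N DivMod.mod L))))) (ι (+ N))
  agree N le rewrite FinP.toℕ-fromℕ< (DivMod.m%n<n N L) = begin
    ι (f N)                                ≡⟨ cong (ι ∘ f) (decompose N le) ⟨
    ι (f (j * L + i)) ≡⟨ cong ι (≡.trans (proj₂ (coeffs ρ) j) (newton-binomSum (proj₁ (coeffs ρ)) j)) ⟩
    ι (binomSum 0 (proj₁ (coeffs ρ)) j)
      ≡⟨ evalQ-binomSumPoly (position i) (ι (+ (j * L + i))) j (evalQ-position i j) 0 (proj₁ (coeffs ρ)) ⟨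
    evalQ (binomSumPoly (position i) 0 (proj₁ (coeffs ρ))) (ι (+ (j * L + i)))
      ≡⟨ cong (λ n → evalQ (binomSumPoly (position i) 0 (proj₁ (coeffs ρ))) (ι (+ n))) (decompose N le) ⟩
    evalQ (binomSumPoly (position i) 0 (proj₁ (coeffs ρ))) (ι (+ N)) ∎
    where
    open ≡.≡-Reasoning
    ρ = N DivMod.% L
    i = start ρ
    j = N DivMod./ L ∸ M

theorem1p1 : (𝔖 : Key → Poly) (c : Key → Key → Key → ℤ) →
    IsSchubert 𝔖 → IsSchubertCoeff 𝔖 c →
    ∀ n u v w → IsPerm n u → IsPerm n v → IsPerm n w →
    IsRationalGF (λ N → c (starKey N u) (starKey N v) (starKey N w))
    × IsEventuallyQuasiPoly (λ N → c (starKey N u) (starKey N v) (starKey N w))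
theorem1p1 𝔖 c isSchubert isCoeff n u v w pu pv pw = rational⇒gf _ rat , rational⇒quasiPoly _ rat
  where
  rat = SchubertDual.Coefficients.rational 𝔖 isSchubert c isCoeff n u v w pu pv pw
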